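{- Let $G=C(m,n;k,l;c,d)$ be a $C$-shaped supergrid graph (with $m\geqslant 2$, $n\geqslant 3$, $k,l,c\geqslant 1$, $a=m-k\geqslant 1$, $d=n-l-c\geqslant 1$) and let $s,t$ be two distinct vertices of $G$, labeled so that $s_x\leqslant t_x$. Then $G$ contains a Hamiltonian path from $s$ to $t$ if and only if $(G,s,t)$ satisfies none of the conditions (F1), (F3), (F7), (F8), (F9) defined below.
   Context: The supergrid graph on a finite set $V\subset\mathbb{Z}^2$ has vertex set $V$, two distinct vertices $u,v$ adjacent iff $|u_x-v_x|\leqslant 1$ and $|u_y-v_y|\leqslant 1$. $R(m,n)$ is the supergrid graph on $\{(x,y):1\leqslant x\leqslant m, 1\leqslant y\leqslant n\}$. $C(m,n;k,l;c,d)$ is the supergrid graph on $V(R(m,n))\setminus\{(x,y): a+1\leqslant x\leqslant m,\ c+1\leqslant y\leqslant c+l\}$, where $a=m-k$, $d=n-l-c$. (F1) $s$ or $t$ is a cut vertex of $G$, or $\{s,t\}$ is a vertex cut of $G$ (i.e. $G-\{s,t\}$ is disconnected). (F3) there is a vertex $w\notin\{s,t\}$ with $\deg(w)=1$. (F7) $m=3$, $a=2$, and either ($c=1$ and $\{s,t\}=\{(1,1),(2,2)\}$ or $\{(1,2),(2,1)\}$) or ($d=1$ and $\{s,t\}=\{(1,n),(2,n-1)\}$ or $\{(1,n-1),(2,n)\}$). (F8) $n=3$, $k=c=d=1$, and (1) $a\geqslant 2$, $s_x=t_x=m-1$, $|s_y-t_y|=2$; or (2) $a=2$, $s_x=1$,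 $t_x=2$, $|s_y-t_y|=2$; or (3) $a>2$, $s_x<m-1$, and $t=(m-1,2)$. (F9) $a=1$, and ($s_y,t_y\leqslant c$ or $s_y,t_y>c+l$). -}

module Defs where

open import Data.Bool using (Bool; true; false; _∧_; _∨_; not; T)
open import Data.Nat using (ℕ; zero; suc; _+_; _∸_; _≤_; _<_; _≤ᵇ_; _≡ᵇ_; ∣_-_∣)
open import Data.Product using (_×_; _,_; proj₁; proj₂; ∃; ∃-syntax)
open import Data.Sum using (_⊎_)
open import Data.List using (List; []; _∷_; filter; length; head; last; cartesianProduct; applyUpTo)
open import Data.List.Relation.Unary.All using (All)
open import Data.List.Relation.Unary.Unique.Propositional using (Unique)
open import Data.List.Relation.Unary.Linked using (Linked)
open import Data.List.Membership.Propositional using (_∈_; _∉_)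
open import Data.Maybe using (just)
open import Relation.Binary.PropositionalEquality using (_≡_; _≢_)
open import Relation.Nullary using (¬_)
open import Relation.Nullary.Decidable using (T?)

-- A point of ℤ² restricted to positive coordinates: (x , y)
Point : Set
Point = ℕ × ℕ

_ₓ : Point → ℕ
p ₓ = proj₁ p

_ᵧ : Point → ℕ
p ᵧ = proj₂ p

record CParams : Set where
  constructor cparams
  field
    m n k l c : ℕ
  a : ℕ
  a = m ∸ k
  d : ℕ
  d = n ∸ l ∸ c
open CParams public

inCᵇ : CParams → Point → Bool
inCᵇ P (x , y) =
  (1 ≤ᵇ x) ∧ (x ≤ᵇ m P) ∧ (1 ≤ᵇ y) ∧ (y ≤ᵇ n P) ∧
  not ((suc (a P) ≤ᵇ x) ∧ (x ≤ᵇ m P) ∧ (suc (c P) ≤ᵇ y) ∧ (y ≤ᵇ c P + l P))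

InC : CParams → Point → Set
InC P v = T (inCᵇ P v)

adjᵇ : Point → Point → Bool
adjᵇ (ux , uy) (vx , vy) =
  not ((ux ≡ᵇ vx) ∧ (uy ≡ᵇ vy)) ∧ (∣ ux - vx ∣ ≤ᵇ 1) ∧ (∣ uy - vy ∣ ≤ᵇ 1)

Adj : Point → Point → Set
Adj u v = T (adjᵇ u v)

vertices : CParams → List Point
vertices P = filter (λ v → T? (inCᵇ P v))
  (cartesianProduct (applyUpTo suc (m P)) (applyUpTo suc (n P)))

deg : CParams → Point → ℕ
deg P w = length (filter (λ v → T? (adjᵇ w v)) (vertices P))

HamiltonianPath : CParams → Point → Point → Set
HamiltonianPath P s t =
  ∃[ p ] (head p ≡ just s × last p ≡ just t × Unique p × All (InC P) p ×
          (∀ v → InC P v → v ∈ p) × Linked Adj p)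

ReachableAvoiding : CParams → List Point → Point → Point → Set
ReachableAvoiding P X u v =
  ∃[ p ] (head p ≡ just u × last p ≡ just v ×
          All (λ w → InC P w × w ∉ X) p × Linked Adj p)

Disconnected : CParams → List Point → Set
Disconnected P X =
  ∃[ u ] ∃[ v ] (InC P u × u ∉ X × InC P v × v ∉ X × ¬ ReachableAvoiding P X u v)

SameSet : Point → Point → Point → Point → Set
SameSet s t p q = (s ≡ p × t ≡ q) ⊎ (s ≡ q × t ≡ p)

F1 : CParams → Point → Point → Set
F1 P s t = Disconnected P (s ∷ []) ⊎ Disconnected P (t ∷ []) ⊎ Disconnected P (s ∷ t ∷ [])

F3 : CParams → Point → Point → Set
F3 P s t = ∃[ w ] (InC P w × w ≢ s × w ≢ t × deg P w ≡ 1)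

F7 : CParams → Point → Point → Set
F7 P s t = m P ≡ 3 × a P ≡ 2 ×
  ((c P ≡ 1 × (SameSet s t (1 , 1) (2 , 2) ⊎ SameSet s t (1 , 2) (2 , 1)))
   ⊎ (d P ≡ 1 × (SameSet s t (1 , n P) (2 , n P ∸ 1) ⊎ SameSet s t (1 , n P ∸ 1) (2 , n P))))

F8 : CParams → Point → Point → Set
F8 P s t = n P ≡ 3 × k P ≡ 1 × c P ≡ 1 × d P ≡ 1 ×
  ((2 ≤ a P × s ₓ ≡ m P ∸ 1 × t ₓ ≡ m P ∸ 1 × ∣ s ᵧ - t ᵧ ∣ ≡ 2)
   ⊎ (a P ≡ 2 × s ₓ ≡ 1 × t ₓ ≡ 2 × ∣ s ᵧ - t ᵧ ∣ ≡ 2)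
   ⊎ (2 < a P × s ₓ < m P ∸ 1 × t ≡ (m P ∸ 1 , 2)))

F9 : CParams → Point → Point → Set
F9 P s t = a P ≡ 1 ×
  ((s ᵧ ≤ c P × t ᵧ ≤ c P) ⊎ (c P + l P < s ᵧ × c P + l P < t ᵧ))

Forbidden : CParams → Point → Point → Set
Forbidden P s t = F1 P s t ⊎ F3 P s t ⊎ F7 P s t ⊎ F8 P s t ⊎ F9 P s t

{-# OPTIONS --safe #-}
module Submission where

-- Paths are glued along edges: if a Hamiltonian path of a region uses the edge u – v, and a second region has a
-- Hamiltonian path from a neighbour of u to a neighbour of v, then this path can replace the edge.  So one looks
-- for Hamiltonian paths of rectangles between given ends that moreover use an edge of each side: on three to five
-- rows and columns they come from a search evaluated by the type checker, larger rectangles arise by gluing on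
-- lines that contain no end or by cutting between the ends, and two rows are treated by hand.
--
-- The C-shaped region is a rectangular body with two arms.  An arm without ends replaces an edge of the right
-- side of the body, an arm with one end is traversed last, and if both ends lie in one arm its path is left for
-- the rest of the region and re-entered along an edge of its left side.  What resists are ends that cut the
-- region, pendant cells, and arms consisting of one cell, whose two neighbours in the body have to be their
-- neighbours on the path: this produces (F7) and (F8).
--
-- Conversely, cells with two neighbours force edges of a Hamiltonian path, and in (F7) and (F8) a chain of forced
-- edges closes up before all cells are visited.

open import Defs hiding (a; c; d; k; l; m; n)
open import Agda.Builtin.Nat using (div-helper; mod-helper)
open import Algebra.Bundles using (CommutativeMonoid)
open import Data.Bool using (Bool; true; false; _∧_; _∨_; not; T; if_then_else_)
open import Data.Bool.ListAction using (all)
open import Data.Bool.Properties using (T-∧)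
open import Data.Empty using (⊥; ⊥-elim)
open import Data.List using (List; []; _∷_; _++_; _∷ʳ_; [_]; map; reverse; foldr; head; last; length; filter; cartesianProduct; applyUpTo)
import Data.List.Properties as List
open import Data.List.Membership.Propositional using (_∈_; _∉_)
open import Data.List.Membership.Propositional.Properties
  using (∈-++⁺ˡ; ∈-++⁺ʳ; ∈-++⁻; ∈-cartesianProduct⁺; ∈-cartesianProduct⁻; ∈-map⁺; ∈-map⁻; ∈-∃++; ∈-applyUpTo⁺; ∈-filter⁺; ∈-filter⁻)
open import Data.List.Relation.Binary.Permutation.Propositional
  using (_↭_; ↭-refl; ↭-sym; ↭-trans; ↭-reflexive; prep; ↭⇒↭ₛ)
import Data.List.Relation.Binary.Permutation.Propositional as Perm
import Data.List.Relation.Binary.Permutation.Propositional.Properties as Perm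
import Algebra.Solver.CommutativeMonoid (Perm.++-commutativeMonoid {A = Point}) as Bag
open import Data.List.Relation.Binary.Permutation.Setoid.Properties using (Unique-resp-↭)
open import Data.List.Relation.Unary.All as All using (All; []; _∷_)
import Data.List.Relation.Unary.All.Properties as All
open import Data.List.Relation.Unary.AllPairs using ([]; _∷_)
open import Data.List.Relation.Unary.Any using (here; there)
open import Data.List.Relation.Unary.Any.Properties using (¬Any[])
open import Data.List.Relation.Unary.Linked using (Linked; []; [-]; _∷_)
open import Data.List.Relation.Unary.Unique.Propositional using (Unique)
import Data.List.Relation.Unary.Unique.Propositional.Properties as Unique
open import Data.Maybe as Maybe using (Maybe; just; nothing; is-just; _>>=_)
open import Data.Nat
open import Data.Nat.Properties
open import Data.Nat.Solver using (module +-*-Solver)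
open import Data.Product hiding (map)
open import Data.Product.Properties using (≡-dec)
open import Data.Sum using (_⊎_; inj₁; inj₂)
import Data.Sum as Sum
open import Data.Unit using (tt)
open import Function using (_∘_; id; case_of_)
open import Function.Bundles using (Equivalence; _⇔_; mk⇔)
open import Relation.Binary using (tri<; tri≈; tri>)
open import Relation.Binary.PropositionalEquality using (_≡_; _≢_; refl; sym; trans; cong; cong₂; subst; subst₂; setoid)
open import Relation.Nullary
open import Relation.Nullary.Decidable using (_×-dec_; _⊎-dec_; _→-dec_; ¬?; ⌊_⌋; dec⇒maybe; decidable-stable; T?)

-- Gluing works with two lines at a time. The ends of a long line are too far apart for a single
-- line to replace an edge, whereas two columns form a cycle that can be opened anywhere along a
-- side. Every reduction leaves at least three lines, since two lines admit fewer paths. Hence five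
-- lines with one end among the first two and the other among the last two allow neither gluing nor
-- a cut, and the search has to include them.
--
-- An arm with at least two rows and two columns can replace the first or the second edge of the
-- right side, counted from its corner; an arm of one cell can only replace the first. Asking for
-- the first edge alone is what creates exceptions. A tall arm of one column replaces no edge of the
-- body, so for `k` = 1 the region is cut into horizontal bands unless both arms are single cells.
--
-- A region is a multiset of cells, so that gluing is concatenation; that the cells are distinct
-- enters only for the whole C-shaped region.

infix 4 _~_

-- Walks and their edges

record Close (x y : ℕ) : Set where
  constructor close
  field
    ≤suc : x ≤ suc y
    suc≥ : y ≤ suc x

same : ∀ {x} → Close x x
same = close (n≤1+n _) (n≤1+n _)

up : ∀ {x} → Close x (suc x)
up = close (m≤n⇒m≤1+n (n≤1+n _)) ≤-refl

down : ∀ {x} → Close (suc x) x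
down = close ≤-refl (m≤n⇒m≤1+n (n≤1+n _))

Close-sym : ∀ {x y} → Close x y → Close y x
Close-sym (close p q) = close q p

record _~_ (u v : Point) : Set where
  constructor near
  field
    nearₓ : Close (proj₁ u) (proj₁ v)
    nearᵧ : Close (proj₂ u) (proj₂ v)

~-sym : ∀ {u v} → u ~ v → v ~ u
~-sym (near p q) = near (Close-sym p) (Close-sym q)

data Walk : Point → Point → List Point → Set where
  one  : ∀ {u} → Walk u u [ u ]
  step : ∀ {u v t ps} → u ~ v → Walk v t ps → Walk u t (u ∷ ps)

data Edge : Point × Point → List Point → Set where
  fwd   : ∀ {u v ps} → Edge (u , v) (u ∷ v ∷ ps)
  bwd   : ∀ {u v ps} → Edge (u , v) (v ∷ u ∷ ps)
  there : ∀ {e p ps} → Edge e ps → Edge e (p ∷ ps)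

Edge-sym : ∀ {u v ps} → Edge (u , v) ps → Edge (v , u) ps
Edge-sym fwd       = bwd
Edge-sym bwd       = fwd
Edge-sym (there e) = there (Edge-sym e)

walk-head : ∀ {u t p ps} → Walk u t (p ∷ ps) → p ≡ u
walk-head one        = refl
walk-head (step _ _) = refl

_++ʷ_ : ∀ {s u v t ps qs} → Walk s u ps → u ~ v × Walk v t qs → Walk s t (ps ++ qs)
one      ++ʷ (n , w) = step n w
step m w ++ʷ nw      = step m (w ++ʷ nw)

reverseʷ : ∀ {s t ps} → Walk s t ps → Walk t s (reverse ps)
reverseʷ one = one
reverseʷ (step {u} {ps = ps} n w) =
  subst (Walk _ _) (sym (List.unfold-reverse u ps)) (reverseʷ w ++ʷ (~-sym n , one))

Edge-++ˡ : ∀ {e ps} qs → Edge e ps → Edge e (ps ++ qs)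
Edge-++ˡ qs fwd       = fwd
Edge-++ˡ qs bwd       = bwd
Edge-++ˡ qs (there e) = there (Edge-++ˡ qs e)

Edge-++ʳ : ∀ {e} ps {qs} → Edge e qs → Edge e (ps ++ qs)
Edge-++ʳ []       e = e
Edge-++ʳ (p ∷ ps) e = there (Edge-++ʳ ps e)

Edge-∷ʳ : ∀ ps {u v qs} → Edge (u , v) ((ps ∷ʳ u) ++ v ∷ qs)
Edge-∷ʳ []       = fwd
Edge-∷ʳ (p ∷ ps) = there (Edge-∷ʳ ps)

Edge-reverse : ∀ {e ps} → Edge e ps → Edge e (reverse ps)
Edge-reverse {ps = u ∷ v ∷ ps} fwd
  rewrite List.unfold-reverse u (v ∷ ps) | List.unfold-reverse v ps = Edge-sym (Edge-∷ʳ (reverse ps))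
Edge-reverse {ps = u ∷ v ∷ ps} bwd
  rewrite List.unfold-reverse u (v ∷ ps) | List.unfold-reverse v ps = Edge-∷ʳ (reverse ps)
Edge-reverse {ps = p ∷ ps} (there e) rewrite List.unfold-reverse p ps = Edge-++ˡ [ p ] (Edge-reverse e)

Edge-join : ∀ {s u v t ps qs} → Walk s u ps → Walk v t qs → Edge (u , v) (ps ++ qs)
Edge-join one        one        = fwd
Edge-join one        (step _ _) = fwd
Edge-join (step _ w) w′         = there (Edge-join w w′)

-- Regions and their Hamiltonian paths

infixr 5 _∪_
infix 4 _≈_

-- A syntax for regions instead of bare lists: the solver for commutative monoids then rearranges
-- unions without unfolding the rectangles.
data Region : Set where
  ∅    : Region
  rect : (x w y h : ℕ) → Region
  _∪_  : Region → Region → Region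

range : ℕ → ℕ → List ℕ
range x zero    = []
range x (suc n) = x ∷ range (suc x) n

⟦_⟧ : Region → List Point
⟦ ∅ ⟧            = []
⟦ rect x w y h ⟧ = cartesianProduct (range x w) (range y h)
⟦ R ∪ S ⟧        = ⟦ R ⟧ ++ ⟦ S ⟧

-- A record instead of a plain permutation: `⟦_⟧` is not injective, and the wrapper lets both
-- regions be inferred.
record _≈_ (R S : Region) : Set where
  constructor bag
  field perms : ⟦ R ⟧ ↭ ⟦ S ⟧

open _≈_

≈-refl : ∀ {R} → R ≈ R
≈-refl = bag ↭-refl

≈-sym : ∀ {R S} → R ≈ S → S ≈ R
≈-sym (bag p) = bag (↭-sym p)

infixr 4 _⨾_

_⨾_ : ∀ {R S T} → R ≈ S → S ≈ T → R ≈ T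
bag p ⨾ bag q = bag (↭-trans p q)

∪-cong : ∀ {R R′ S S′} → R ≈ R′ → S ≈ S′ → R ∪ S ≈ R′ ∪ S′
∪-cong (bag p) (bag q) = bag (Perm.++⁺ p q)

∪-commutativeMonoid : CommutativeMonoid _ _
∪-commutativeMonoid = record
  { Carrier = Region ; _≈_ = _≈_ ; _∙_ = _∪_ ; ε = ∅
  ; isCommutativeMonoid = record
    { isMonoid = record
      { isSemigroup = record
        { isMagma = record
          { isEquivalence = record { refl = ≈-refl ; sym = ≈-sym ; trans = _⨾_ }
          ; ∙-cong = ∪-cong }
        ; assoc = λ R S T → bag (↭-reflexive (List.++-assoc ⟦ R ⟧ ⟦ S ⟧ ⟦ T ⟧)) }
      ; identity = (λ _ → bag ↭-refl) , λ R → bag (↭-reflexive (List.++-identityʳ ⟦ R ⟧)) }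
    ; comm = λ R S → bag (Perm.++-comm ⟦ R ⟧ ⟦ S ⟧) } }

open import Algebra.Solver.CommutativeMonoid ∪-commutativeMonoid public
  using (_⊕_; _⊜_; solve)

-- `E` records edges that are known to be used, not all of them; `keep` selects from it what the
-- next gluing requires.
record Path (R : Region) (s t : Point) (E : List (Point × Point)) : Set where
  constructor path
  field
    {cells} : List Point
    walk    : Walk s t cells
    perm    : cells ↭ ⟦ R ⟧
    edges   : All (λ e → Edge e cells) E

open Path

infixr 5 _⟨_⟩_

_⟨_⟩_ : ∀ {R R′ s u v t E E′} → Path R s u E → u ~ v → Path R′ v t E′ →
        Path (R ∪ R′) s t ((u , v) ∷ E ++ E′)
P ⟨ n ⟩ Q = path (walk P ++ʷ (n , walk Q)) (Perm.++⁺ (perm P) (perm Q))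
  (Edge-join (walk P) (walk Q) ∷
   All.++⁺ (All.map (Edge-++ˡ _) (edges P)) (All.map (Edge-++ʳ (cells P)) (edges Q)))

rev : ∀ {R s t E} → Path R s t E → Path R t s E
rev P = path (reverseʷ (walk P)) (↭-trans (Perm.↭-reverse (cells P)) (perm P))
  (All.map Edge-reverse (edges P))

resp : ∀ {R R′ s t E} → R ≈ R′ → Path R s t E → Path R′ s t E
resp (bag r) P = path (walk P) (↭-trans (perm P) r) (edges P)

keep : ∀ {R s t E E′} → (∀ {ps} → All (λ e → Edge e ps) E → All (λ e → Edge e ps) E′) →
       Path R s t E → Path R s t E′
keep f P = path (walk P) (perm P) (f (edges P))

forget : ∀ {R s t E} → Path R s t E → Path R s t []
forget = keep (λ _ → [])

single : ∀ {x y} → Path (rect x 1 y 1) (x , y) (x , y) []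
single = path one ↭-refl []

-- Images of paths, and replacing an edge by a path

mapEdge : (Point → Point) → Point × Point → Point × Point
mapEdge f (u , v) = f u , f v

Edge-map : ∀ (f : Point → Point) {e ps} → Edge e ps → Edge (mapEdge f e) (map f ps)
Edge-map f fwd       = fwd
Edge-map f bwd       = bwd
Edge-map f (there e) = there (Edge-map f e)

mapʷ : ∀ (f : Point → Point) → (∀ {u v} → u ~ v → f u ~ f v) →
       ∀ {s t ps} → Walk s t ps → Walk (f s) (f t) (map f ps)
mapʷ f f~ one        = one
mapʷ f f~ (step n w) = step (f~ n) (mapʷ f f~ w)

mapᵖ : ∀ (f : Point → Point) → (∀ {u v} → u ~ v → f u ~ f v) → ∀ {R R′} → map f ⟦ R ⟧ ↭ ⟦ R′ ⟧ →
       ∀ {s t E} → Path R s t E → Path R′ (f s) (f t) (map (mapEdge f) E)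
mapᵖ f f~ r P = path (mapʷ f f~ (walk P)) (↭-trans (Perm.map⁺ f (perm P)) r)
  (All.map⁺ (All.map (Edge-map f) (edges P)))

-- Distinct edges may share a cell, but one end of each lies off the other. This is what keeps an
-- edge alive when another is replaced, in whichever direction the two are traversed.
data Differ : Point × Point → Point × Point → Set where
  fst : ∀ {x y u v} → x ≢ u → x ≢ v → Differ (x , y) (u , v)
  snd : ∀ {x y u v} → y ≢ u → y ≢ v → Differ (x , y) (u , v)

record Spliced (s t u v u′ v′ : Point) (ps qs : List Point) : Set where
  constructor spliced
  field
    {out}  : List Point
    walkˢ  : Walk s t out
    permˢ  : out ↭ ps ++ qs
    old    : ∀ {e} → Differ e (u , v) → Edge e ps → Edge e out
    new    : ∀ {e} → Edge e qs → Edge e out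
    entry  : Edge (u , u′) out
    exit   : Edge (v′ , v) out

splice-head : ∀ {t u v u′ v′ ps qs} → Walk v t (v ∷ ps) → Walk u′ v′ qs → u ~ u′ → v′ ~ v →
              Spliced u t u v u′ v′ (u ∷ v ∷ ps) qs
splice-head {u = u} {v} {ps = ps} {qs} w w′ n n′ = spliced
  (step n (w′ ++ʷ (n′ , w)))
  (prep u (Perm.++-comm qs (v ∷ ps)))
  (λ { (fst a b) fwd → ⊥-elim (a refl) ; (snd a b) fwd → ⊥-elim (b refl)
     ; (fst a b) bwd → ⊥-elim (b refl) ; (snd a b) bwd → ⊥-elim (a refl)
     ; d (there e) → there (Edge-++ʳ qs e) })
  (λ e → there (Edge-++ˡ (v ∷ ps) e))
  (Edge-join one (w′ ++ʷ (n′ , w)))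
  (there (Edge-join w′ w))

splice-sym : ∀ {s t u v u′ v′ ps qs} → Spliced s t v u v′ u′ ps (reverse qs) → Spliced s t u v u′ v′ ps qs
splice-sym {ps = ps} {qs} (spliced w p o n a b) = spliced w
  (↭-trans p (Perm.++⁺ˡ ps (Perm.↭-reverse qs)))
  (λ { (fst x y) → o (fst y x) ; (snd x y) → o (snd y x) })
  (λ e → n (Edge-reverse e)) (Edge-sym b) (Edge-sym a)

-- An edge from `p` to the next cell survives a change of the tail because both tails begin at `z`.
Edge-cons : ∀ {z t t′ p ps qs e} → Walk z t ps → Walk z t′ qs →
            (Edge e ps → Edge e qs) → Edge e (p ∷ ps) → Edge e (p ∷ qs)
Edge-cons w one         f fwd       with refl ← walk-head w = fwd
Edge-cons w (step _ _)  f fwd       with refl ← walk-head w = fwd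
Edge-cons w one         f bwd       with refl ← walk-head w = bwd
Edge-cons w (step _ _)  f bwd       with refl ← walk-head w = bwd
Edge-cons w w′          f (there e) = there (f e)

splice : ∀ {s t u v u′ v′ ps qs} → Walk s t ps → Edge (u , v) ps → Walk u′ v′ qs → u ~ u′ → v′ ~ v →
         Spliced s t u v u′ v′ ps qs
splice (step m w) fwd w′ n n′ with refl ← walk-head w = splice-head w w′ n n′
splice (step m w) bwd w′ n n′ with refl ← walk-head w =
  splice-sym (splice-head w (reverseʷ w′) (~-sym n′) (~-sym n))
splice {ps = p ∷ _} (step m w) (there e) w′ n n′ with splice w e w′ n n′
... | spliced w″ r o nw a b = spliced (step m w″) (prep p r) (Edge-cons w w″ ∘ o)
  (there ∘ nw) (there a) (there b)

insert : ∀ {R R′ s t u v u′ v′ E E′} → Path R s t ((u , v) ∷ E) → u ~ u′ → Path R′ u′ v′ E′ → v′ ~ v →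
         All (λ e → Differ e (u , v)) E → Path (R ∪ R′) s t ((u , u′) ∷ (v′ , v) ∷ E ++ E′)
insert (path w p (e ∷ es)) n (path w′ p′ es′) n′ ds with splice w e w′ n n′
... | spliced w″ r o nw a b = path w″ (↭-trans r (Perm.++⁺ p p′))
  (a ∷ b ∷ All.++⁺ (All.zipWith (λ (d , x) → o d x) (ds , es)) (All.map nw es′))

-- Products of ranges and the symmetries of rectangles

infixr 6 _⊗_

_⊗_ : List ℕ → List ℕ → List Point
_⊗_ = cartesianProduct

range-+ : ∀ x m n → range x (m + n) ≡ range x m ++ range (x + m) n
range-+ x zero    n = cong (λ z → range z n) (sym (+-identityʳ x))
range-+ x (suc m) n = cong (x ∷_) (trans (range-+ (suc x) m n)
  (cong (λ z → range (suc x) m ++ range z n) (sym (+-suc x m))))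

map-range : ∀ a x n → map (_+ a) (range x n) ≡ range (x + a) n
map-range a x zero    = refl
map-range a x (suc n) = cong (x + a ∷_) (map-range a (suc x) n)

-- The reflection reverses the order, so in the induction the image of the first element has to be
-- moved to the last place.
flip-range : ∀ p h q → map (λ z → p + h + q ∸ suc z) (range p h) ↭ range q h
flip-range p zero    q = ↭-refl
flip-range p (suc h) q = ↭-trans
  (Perm.prep _ (subst (λ z → map (λ z₁ → z + q ∸ suc z₁) (range (suc p) h) ↭ range q h)
                 (sym (+-suc p h)) (flip-range (suc p) h q)))
  (↭-trans (Perm.∷↭∷ʳ _ _) (↭-reflexive (trans (cong (λ z → range q h ++ [ z ]) lem)
    (trans (sym (range-+ q h 1)) (cong (range q) (+-comm h 1))))))
  where
  lem : p + suc h + q ∸ suc p ≡ q + h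
  lem rewrite +-suc p h | +-assoc p h q | m+n∸m≡n p (h + q) = +-comm h q

⊗-++ˡ : ∀ xs xs′ ys → (xs ++ xs′) ⊗ ys ≡ xs ⊗ ys ++ xs′ ⊗ ys
⊗-++ˡ = List.cartesianProductWith-distribʳ-++ _,_

⊗-++ʳ : ∀ xs ys ys′ → xs ⊗ (ys ++ ys′) ↭ xs ⊗ ys ++ xs ⊗ ys′
⊗-++ʳ []       ys ys′ = ↭-refl
⊗-++ʳ (x ∷ xs) ys ys′ =
  ↭-trans (Perm.++⁺ (↭-reflexive (List.map-++ (x ,_) ys ys′)) (⊗-++ʳ xs ys ys′))
    (Bag.solve 4 (λ a b c d → (a Bag.⊕ b) Bag.⊕ (c Bag.⊕ d) Bag.⊜ (a Bag.⊕ c) Bag.⊕ (b Bag.⊕ d)) ↭-refl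
      (map (x ,_) ys) (map (x ,_) ys′) (xs ⊗ ys) (xs ⊗ ys′))

⊗-congʳ : ∀ xs {ys ys′} → ys ↭ ys′ → xs ⊗ ys ↭ xs ⊗ ys′
⊗-congʳ []       p = ↭-refl
⊗-congʳ (x ∷ xs) p = Perm.++⁺ (Perm.map⁺ (x ,_) p) (⊗-congʳ xs p)

⊗-swap : ∀ xs ys → map swap (xs ⊗ ys) ↭ ys ⊗ xs
⊗-swap []       ys = ↭-reflexive (sym (List.cartesianProductWith-zeroʳ _,_ ys))
⊗-swap (x ∷ xs) ys = ↭-trans
  (↭-reflexive (trans (List.map-++ swap (map (x ,_) ys) (xs ⊗ ys))
     (cong (_++ map swap (xs ⊗ ys)) (trans (sym (List.map-∘ ys)) (sym (col x ys))))))
  (↭-trans (Perm.++⁺ˡ (ys ⊗ [ x ]) (⊗-swap xs ys)) (↭-sym (⊗-++ʳ ys [ x ] xs)))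
  where
  col : ∀ x ys → ys ⊗ [ x ] ≡ map (_, x) ys
  col x []       = refl
  col x (y ∷ ys) = cong ((y , x) ∷_) (col x ys)

⊗-congˡ : ∀ {xs xs′} ys → xs ↭ xs′ → xs ⊗ ys ↭ xs′ ⊗ ys
⊗-congˡ {xs} {xs′} ys p = ↭-trans (↭-sym (⊗-swap ys xs))
  (↭-trans (Perm.map⁺ swap (⊗-congʳ ys p)) (⊗-swap ys xs′))

map-⊗ : ∀ (f g : ℕ → ℕ) xs ys → map (λ (x , y) → f x , g y) (xs ⊗ ys) ≡ map f xs ⊗ map g ys
map-⊗ f g []       ys = refl
map-⊗ f g (x ∷ xs) ys = trans (List.map-++ _ (map (x ,_) ys) (xs ⊗ ys))
  (cong₂ _++_ (trans (sym (List.map-∘ ys)) (List.map-∘ ys)) (map-⊗ f g xs ys))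

splitX : ∀ m {n x y h} → rect x (m + n) y h ≈ rect x m y h ∪ rect (x + m) n y h
splitX m {n} {x} {y} {h} = bag (↭-reflexive
  (trans (cong (_⊗ range y h) (range-+ x m n)) (⊗-++ˡ (range x m) (range (x + m) n) (range y h))))

splitY : ∀ m {n x w y} → rect x w y (m + n) ≈ rect x w y m ∪ rect x w (y + m) n
splitY m {n} {x} {w} {y} = bag (↭-trans (↭-reflexive (cong (range x w ⊗_) (range-+ y m n)))
  (⊗-++ʳ (range x w) (range y m) (range (y + m) n)))

splitX₁ : ∀ {n x y h} → rect x (suc n) y h ≈ rect x 1 y h ∪ rect (suc x) n y h
splitX₁ {n} {x} {y} {h} = subst (λ z → rect x (suc n) y h ≈ rect x 1 y h ∪ rect z n y h) (+-comm x 1) (splitX 1)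

splitY₁ : ∀ {n x w y} → rect x w y (suc n) ≈ rect x w y 1 ∪ rect x w (suc y) n
splitY₁ {n} {x} {w} {y} = subst (λ z → rect x w y (suc n) ≈ rect x w y 1 ∪ rect x w z n) (+-comm y 1) (splitY 1)

width : ∀ {w w′ x y h} → w ≡ w′ → rect x w y h ≈ rect x w′ y h
width refl = ≈-refl

height : ∀ {h h′ x w y} → h ≡ h′ → rect x w y h ≈ rect x w y h′
height refl = ≈-refl

Close-+ : ∀ a {x y} → Close x y → Close (x + a) (y + a)
Close-+ a (close p q) = close (+-monoˡ-≤ a p) (+-monoˡ-≤ a q)

Close-flip : ∀ n {x y} → Close x y → Close (n ∸ suc x) (n ∸ suc y)
Close-flip n (close p q) = close (lem n q) (lem n p)
  where
  lem : ∀ n {x y} → x ≤ suc y → n ∸ suc y ≤ suc (n ∸ suc x)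
  lem n {x} {y} p = ≤-trans (∸-monoʳ-≤ {m = x} {n = suc y} n p)
    (≤-trans (∸-suc≤ n x) ≤-refl)
    where
    ∸-suc≤ : ∀ n x → n ∸ x ≤ suc (n ∸ suc x)
    ∸-suc≤ zero    zero    = z≤n
    ∸-suc≤ zero    (suc x) = z≤n
    ∸-suc≤ (suc n) zero    = ≤-refl
    ∸-suc≤ (suc n) (suc x) = ∸-suc≤ n x

shiftX : ∀ a {x w y h s t E} → Path (rect x w y h) s t E →
         Path (rect (x + a) w y h) (proj₁ s + a , proj₂ s) (proj₁ t + a , proj₂ t)
              (map (mapEdge (λ (x , y) → x + a , y)) E)
shiftX a {x} {w} {y} {h} = mapᵖ (λ (x , y) → x + a , y) (λ (near p q) → near (Close-+ a p) q)
  (↭-reflexive (trans (map-⊗ (_+ a) id (range x w) (range y h))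
    (cong₂ _⊗_ (map-range a x w) (List.map-id (range y h)))))

transpose : ∀ {x w y h s t E} → Path (rect x w y h) s t E →
            Path (rect y h x w) (swap s) (swap t) (map (mapEdge swap) E)
transpose {x} {w} {y} {h} = mapᵖ swap (λ (near p q) → near q p) (⊗-swap (range x w) (range y h))

shiftY : ∀ b {x w y h s t E} → Path (rect x w y h) s t E →
         Path (rect x w (y + b) h) (proj₁ s , proj₂ s + b) (proj₁ t , proj₂ t + b)
              (map (mapEdge (λ (x , y) → x , y + b)) E)
shiftY b {x} {w} {y} {h} = mapᵖ (λ (x , y) → x , y + b) (λ (near p q) → near p (Close-+ b q))
  (↭-reflexive (trans (map-⊗ id (_+ b) (range x w) (range y h))
    (cong₂ _⊗_ (List.map-id (range x w)) (map-range b y h))))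

flipX : ∀ n {x w x′ y h s t E} → x + w + x′ ≡ n → Path (rect x w y h) s t E →
        Path (rect x′ w y h) (n ∸ suc (proj₁ s) , proj₂ s) (n ∸ suc (proj₁ t) , proj₂ t)
             (map (mapEdge (λ (x , y) → n ∸ suc x , y)) E)
flipX n {x} {w} {x′} {y} {h} refl = mapᵖ (λ (x , y) → n ∸ suc x , y) (λ (near p q) → near (Close-flip n p) q)
  (↭-trans (↭-reflexive (trans (map-⊗ _ id (range x w) (range y h))
    (cong (map (λ z → n ∸ suc z) (range x w) ⊗_) (List.map-id (range y h)))))
    (⊗-congˡ (range y h) (flip-range x w x′)))

rect-flipY : ∀ n {x w} y h y′ → y + h + y′ ≡ n →
             map (λ (x , y) → x , n ∸ suc y) ⟦ rect x w y h ⟧ ↭ ⟦ rect x w y′ h ⟧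
rect-flipY n {x} {w} y h y′ refl = ↭-trans (↭-reflexive (trans (map-⊗ id _ (range x w) (range y h))
    (cong (_⊗ map (λ z → n ∸ suc z) (range y h)) (List.map-id (range x w)))))
    (⊗-congʳ (range x w) (flip-range y h y′))

flipY : ∀ n {x w y h y′ s t E} → y + h + y′ ≡ n → Path (rect x w y h) s t E →
        Path (rect x w y′ h) (proj₁ s , n ∸ suc (proj₂ s)) (proj₁ t , n ∸ suc (proj₂ t))
             (map (mapEdge (λ (x , y) → x , n ∸ suc y)) E)
flipY n {x} {w} {y} {h} {y′} eq = mapᵖ (λ (x , y) → x , n ∸ suc y) (λ (near p q) → near p (Close-flip n q))
  (rect-flipY n {x} {w} y h y′ eq)

-- Lines, cycles of two columns, and frames

lineX : ∀ n {x y} → Path (rect x (suc n) y 1) (x , y) (x + n , y) []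
lineX zero    {x} {y} = subst (λ z → Path (rect x 1 y 1) (x , y) (z , y) []) (sym (+-identityʳ x)) single
lineX (suc n) {x} {y} = forget (resp (≈-sym (splitX′))
  (subst (λ z → Path (rect x 1 y 1 ∪ rect (suc x) (suc n) y 1) (x , y) (z , y) (((x , y) , (suc x , y)) ∷ [])) (sym (+-suc x n))
  (single ⟨ near up same ⟩ lineX n)))
  where
  splitX′ : rect x (2 + n) y 1 ≈ rect x 1 y 1 ∪ rect (suc x) (suc n) y 1
  splitX′ = bag ↭-refl

lineY : ∀ n {x y} → Path (rect x 1 y (suc n)) (x , y) (x , y + n) []
lineY n = transpose (lineX n)

-- A Hamiltonian cycle of two columns, cut open at two consecutive cells of the left one.
ring : ∀ y j h → suc y + suc j ≡ 3 + h → Path (rect 0 2 0 (3 + h)) (0 , y) (0 , suc y)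
  (((1 , 0) , (1 , 1)) ∷ ((1 , 1 + h) , (1 , 2 + h)) ∷ ((0 , 0) , (1 , 0)) ∷ ((1 , 2 + h) , (0 , 2 + h)) ∷ [])
ring y j h eq = keep (λ { (a ∷ b ∷ c ∷ d ∷ _) → c ∷ d ∷ a ∷ b ∷ [] })
  (resp region (rev (lineY y) ⟨ near up same ⟩ right ⟨ near down same ⟩ left))
  where
  left : Path (rect 0 1 (suc y) (suc j)) (0 , 2 + h) (0 , suc y) []
  left = subst (λ z → Path (rect 0 1 (suc y) (suc j)) (0 , z) (0 , suc y) [])
    (suc-injective (trans (sym (+-suc (suc y) j)) eq)) (rev (lineY j))
  right : Path (rect 1 1 0 (3 + h)) (1 , 0) (1 , 2 + h)
    (((1 , 0) , (1 , 1)) ∷ ((1 , 1 + h) , (1 , 2 + h)) ∷ [])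
  right = resp (∪-cong ≈-refl (≈-sym (splitY (suc h))) ⨾ ≈-sym (splitY 1) ⨾
      subst (λ z → rect 1 1 0 (2 + z) ≈ rect 1 1 0 (3 + h)) (+-comm 1 h) ≈-refl)
    (single ⟨ near same up ⟩ lineY h ⟨ near same up ⟩ single)
  region : rect 0 1 0 (suc y) ∪ rect 1 1 0 (3 + h) ∪ rect 0 1 (suc y) (suc j) ≈ rect 0 2 0 (3 + h)
  region = solve 3 (λ a b c → a ⊕ b ⊕ c ⊜ (a ⊕ c) ⊕ b) ≈-refl _ _ _ ⨾
    ∪-cong (≈-sym (splitY (suc y)) ⨾ subst (λ z → rect 0 1 0 z ≈ rect 0 1 0 (3 + h)) (sym eq) ≈-refl) ≈-refl ⨾
    ≈-sym (splitX 1)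

-- `Frame i j W H s t` is a Hamiltonian path on the (W+1)×(H+1) rectangle using an edge of each side;
-- on the right side it uses one of the first i and one of the last j edges.
record Frame (i j W H : ℕ) (s t : Point) : Set where
  constructor frame
  field
    {l tp bt rt rb} : ℕ
    l<  : l < H
    tp< : tp < W
    bt< : bt < W
    rt< : rt < i
    rb< : rb < H
    <rb : H ≤ rb + j
    thePath : Path (rect 0 (suc W) 0 (suc H)) s t
      ( ((0 , l) , (0 , suc l)) ∷ ((tp , 0) , (suc tp , 0)) ∷ ((bt , H) , (suc bt , H))
      ∷ ((W , rt) , (W , suc rt)) ∷ ((W , rb) , (W , suc rb)) ∷ [])

_≟ᵖ_ : (p q : Point) → Dec (p ≡ q)
_≟ᵖ_ = ≡-dec _≟_ _≟_

_≟ᵉ_ : (e f : Point × Point) → Dec (e ≡ f)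
_≟ᵉ_ = ≡-dec _≟ᵖ_ _≟ᵖ_

SameSet? : ∀ s t u v → Dec (SameSet s t u v)
SameSet? s t u v = (s ≟ᵖ u ×-dec t ≟ᵖ v) ⊎-dec (s ≟ᵖ v ×-dec t ≟ᵖ u)

-- If a required edge had both ends of the path as its cells, it would be the whole path. With three
-- rows and both depths 1, the last column is traversed in one go through its middle cell, which is
-- therefore no end; and if its outer cells were the two ends, that column would be the whole path.
Fine : (i j W H : ℕ) → Point → Point → Set
Fine i j W H s t = (i ≡ 1 → ¬ SameSet s t (W , 0) (W , 1)) × (j ≡ 1 → ¬ SameSet s t (W , H) (W , H ∸ 1)) ×
  (i ≡ 1 → j ≡ 1 → H ≡ 2 → s ≢ (W , 1) × t ≢ (W , 1) × ¬ SameSet s t (W , 0) (W , 2))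

Fine? : ∀ i j W H s t → Dec (Fine i j W H s t)
Fine? i j W H s t = (i ≟ 1 →-dec ¬? (SameSet? s t _ _)) ×-dec (j ≟ 1 →-dec ¬? (SameSet? s t _ _)) ×-dec
  (i ≟ 1 →-dec (j ≟ 1 →-dec (H ≟ 2 →-dec (¬? (s ≟ᵖ _) ×-dec ¬? (t ≟ᵖ _) ×-dec ¬? (SameSet? s t _ _)))))

-- The validated search for small frames

module Check where

  close? : ∀ x y → Maybe (Close x y)
  close? x y = do
    p ← dec⇒maybe (x ≤? suc y)
    q ← dec⇒maybe (y ≤? suc x)
    just (close p q)

  near? : ∀ u v → Maybe (u ~ v)
  near? (x , y) (x′ , y′) = do
    p ← close? x x′
    q ← close? y y′
    just (near p q)

  walk? : ∀ u ps t → Maybe (Walk u t (u ∷ ps))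
  walk? u []       t with u ≟ᵖ t
  ... | yes refl = just one
  ... | no _     = nothing
  walk? u (v ∷ ps) t = do
    n ← near? u v
    w ← walk? v ps t
    just (step n w)

  remove? : ∀ p (qs : List Point) → Maybe (∃ λ rs → p ∷ rs ↭ qs)
  remove? p [] = nothing
  remove? p (q ∷ qs) with p ≟ᵖ q
  ... | yes refl = just (qs , ↭-refl)
  ... | no _     = do
    rs , r ← remove? p qs
    just (q ∷ rs , ↭-trans (Perm.swap p q ↭-refl) (prep q r))

  perm? : ∀ (ps qs : List Point) → Maybe (ps ↭ qs)
  perm? []       []      = just ↭-refl
  perm? []       (_ ∷ _) = nothing
  perm? (p ∷ ps) qs      = do
    rs , r ← remove? p qs
    r′ ← perm? ps rs
    just (↭-trans (prep p r′) r)

  edge? : ∀ e p ps → Maybe (Edge e (p ∷ ps))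
  edge? e p []       = nothing
  edge? e p (q ∷ ps) with e ≟ᵉ (p , q) | e ≟ᵉ (q , p)
  ... | yes refl | _        = just fwd
  ... | no _     | yes refl = just bwd
  ... | no _     | no _     = Maybe.map there (edge? e q ps)

  slot? : ∀ (f : ℕ → Point × Point) p ps m n → Maybe (∃ λ k → m ≤ k × k < m + n × Edge (f k) (p ∷ ps))
  slot? f p ps m zero    = nothing
  slot? f p ps m (suc n) with edge? (f m) p ps
  ... | just e  = just (m , ≤-refl , m<m+n m (s≤s z≤n) , e)
  ... | nothing = do
    k , m< , k< , e ← slot? f p ps (suc m) n
    just (k , <⇒≤ m< , subst (k <_) (sym (+-suc m n)) k< , e)

  frame? : ∀ i j W H s t → List Point → Maybe (Frame i j W H s t)
  frame? i j W H s t []       = nothing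
  frame? i j W H s t (p ∷ ps) with p ≟ᵖ s
  ... | no _     = nothing
  ... | yes refl = do
    w ← walk? s ps t
    r ← perm? (s ∷ ps) ⟦ rect 0 (suc W) 0 (suc H) ⟧
    l , _ , l< , e₁ ← slot? (λ y → (0 , y) , (0 , suc y)) s ps 0 H
    tp , _ , tp< , e₂ ← slot? (λ x → (x , 0) , (suc x , 0)) s ps 0 W
    bt , _ , bt< , e₃ ← slot? (λ x → (x , H) , (suc x , H)) s ps 0 W
    rt , _ , rt< , e₄ ← slot? (λ y → (W , y) , (W , suc y)) s ps 0 i
    rb , _ , rb< , e₅ ← slot? (λ y → (W , y) , (W , suc y)) s ps (H ∸ j) j
    p ← dec⇒maybe (rb <? H)
    q ← dec⇒maybe (H ≤? rb + j)
    just (frame l< tp< bt< rt< p q (path w r (e₁ ∷ e₂ ∷ e₃ ∷ e₄ ∷ e₅ ∷ [])))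

-- Warnsdorff's rule: always move to the free cell with fewest free neighbours.  Sets of cells are bit
-- vectors in which (x , y) is the bit 8(x+1) + (y+1), so that the eight neighbours are reached by shifts.
-- Nothing is proved about the walks found, which are validated by `Check.frame?`.
module Greedy where

  -- Both displacements are stored raised by one, which keeps them natural numbers.
  Move : Set
  Move = ℕ × ℕ

  record Cell : Set where
    constructor cell
    field
      bit : ℕ
      pos : Point

  toCell : Point → Cell
  toCell (x , y) = cell (256 ^ suc x * 2 ^ suc y) (x , y)

  -- `div-helper 0 511 n 511` is the quotient of n by 512 = 256 · 2, which cancels the one that a
  -- move carries in each coordinate.
  shiftBit : ℕ → Move → ℕ
  shiftBit b (dx , dy) = div-helper 0 511 (b * (256 ^ dx * 2 ^ dy)) 511

  -- `b` is a power of two; dividing by it and taking the remainder modulo 2 reads off one binary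
  -- digit of the set.
  has : ℕ → ℕ → Bool
  has set b = mod-helper 0 1 (div-helper 0 (b ∸ 1) set (b ∸ 1)) 1 ≡ᵇ 1

  move : Cell → Move → Cell
  move (cell b (x , y)) m@(dx , dy) = cell (shiftBit b m) (x + dx ∸ 1 , y + dy ∸ 1)

  degree : List Move → ℕ → ℕ → ℕ
  degree []       set b = 0
  degree (m ∷ ms) set b = if has set (shiftBit b m) then suc (degree ms set b) else degree ms set b

  best : Maybe (ℕ × Cell) → Maybe (ℕ × Cell) → Maybe (ℕ × Cell)
  best nothing          q                = q
  best p                nothing          = p
  best p@(just (m , _)) q@(just (n , _)) = if m ≤ᵇ n then p else q

  -- The target counts as a free neighbour, but is not entered before the last move.
  choose : List Move → List Move → ℕ → ℕ → Cell → Maybe (ℕ × Cell)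
  choose []       ms set target p = nothing
  choose (m ∷ as) ms set target p =
    if has set (Cell.bit q) then best (just (degree ms (target + set) (Cell.bit q) , q)) rest else rest
    where
    q    = move p m
    rest = choose as ms set target p

  greedy : ℕ → List Move → ℕ → ℕ → Cell → List Point
  greedy zero    ms set target p = Cell.pos p ∷ []
  greedy (suc n) ms set target p with choose ms ms set target p
  ... | just (_ , q) = Cell.pos p ∷ greedy n ms (set ∸ Cell.bit q) target q
  ... | nothing      = []

  preferences : List (List Move)
  preferences =
    ((1 , 2) ∷ (0 , 2) ∷ (1 , 0) ∷ (0 , 0) ∷ (2 , 2) ∷ (0 , 1) ∷ (2 , 1) ∷ (2 , 0) ∷ []) ∷
    ((0 , 1) ∷ (2 , 0) ∷ (2 , 1) ∷ (0 , 0) ∷ (1 , 0) ∷ (1 , 2) ∷ (0 , 2) ∷ (2 , 2) ∷ []) ∷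
    ((1 , 0) ∷ (2 , 1) ∷ (1 , 2) ∷ (0 , 1) ∷ (2 , 0) ∷ (2 , 2) ∷ (0 , 0) ∷ (0 , 2) ∷ []) ∷
    ((1 , 0) ∷ (2 , 0) ∷ (0 , 2) ∷ (0 , 0) ∷ (1 , 2) ∷ (2 , 2) ∷ (2 , 1) ∷ (0 , 1) ∷ []) ∷
    ((0 , 2) ∷ (0 , 0) ∷ (2 , 1) ∷ (1 , 2) ∷ (0 , 1) ∷ (2 , 2) ∷ (2 , 0) ∷ (1 , 0) ∷ []) ∷ []

  attempt : (W H : ℕ) → Point → Point → List Move → List Point
  -- There are W · H + W + H + 1 cells; the start needs no move and the target is appended
  -- afterwards, so two moves fewer remain.
  attempt W H s t ms = greedy (W * H + W + H ∸ 1) ms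
    (foldr (λ p n → Cell.bit (toCell p) + n) 0 ⟦ rect 0 (suc W) 0 (suc H) ⟧ ∸ Cell.bit (toCell s) ∸ Cell.bit (toCell t))
    (Cell.bit (toCell t)) (toCell s) ++ [ t ]

  -- Walks for the instances on which the rule fails for every preference above.
  extra : List (List Point)
  extra =
    ((0 , 1) ∷ (0 , 2) ∷ (1 , 2) ∷ (2 , 2) ∷ (3 , 2) ∷ (2 , 1) ∷ (1 , 1) ∷ (0 , 0) ∷ (1 , 0) ∷ (2 , 0) ∷ (3 , 0) ∷ (3 , 1) ∷ []) ∷
    ((0 , 1) ∷ (0 , 0) ∷ (1 , 0) ∷ (2 , 0) ∷ (3 , 0) ∷ (2 , 1) ∷ (1 , 2) ∷ (0 , 2) ∷ (1 , 1) ∷ (2 , 2) ∷ (3 , 2) ∷ (3 , 1) ∷ []) ∷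
    ((1 , 0) ∷ (0 , 0) ∷ (0 , 1) ∷ (0 , 2) ∷ (1 , 1) ∷ (2 , 0) ∷ (2 , 1) ∷ (2 , 2) ∷ (2 , 3) ∷ (1 , 2) ∷ (0 , 3) ∷ (1 , 3) ∷ []) ∷ []

  -- The rule treats the two ends differently, so walks from `t` to `s` are tried as well and then
  -- reversed.
  attempts : (W H : ℕ) → Point → Point → List (List Point)
  attempts W H s t = foldr (λ ms ps → attempt W H s t ms ∷ reverse (attempt W H t s ms) ∷ ps) extra preferences

firstJust : ∀ {A B : Set} → (A → Maybe B) → List A → Maybe B
firstJust f []       = nothing
firstJust f (x ∷ xs) with f x
... | just b  = just b
... | nothing = firstJust f xs

find : ∀ i j W H s t → Maybe (Frame i j W H s t)
find i j W H s t = firstJust (Check.frame? i j W H s t) (Greedy.attempts W H s t)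

-- For lines numbered 0 to 4: an end in the first two prevents gluing there, an end in the last two
-- prevents it on the other side. Other pairs on five lines reduce to three lines and are left out
-- of the search.
Spread : ℕ → ℕ → Set
Spread x x′ = (x < 2 ⊎ x′ < 2) × (2 < x ⊎ 2 < x′)

Spread? : ∀ x x′ → Dec (Spread x x′)
Spread? x x′ = (x <? 2 ⊎-dec x′ <? 2) ×-dec (2 <? x ⊎-dec 2 <? x′)

Before : Point → Point → Set
Before (x , y) (x′ , y′) = x < x′ ⊎ x ≡ x′ × y < y′

Before? : ∀ s t → Dec (Before s t)
Before? (x , y) (x′ , y′) = x <? x′ ⊎-dec x ≟ x′ ×-dec y <? y′

before-cmp : ∀ s t → s ≢ t → Before s t ⊎ Before t s
before-cmp (x , y) (x′ , y′) s≢t with <-cmp x x′ | <-cmp y y′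
... | tri< p _ _    | _             = inj₁ (inj₁ p)
... | tri> _ _ p    | _             = inj₂ (inj₁ p)
... | tri≈ _ e _    | tri< p _ _    = inj₁ (inj₂ (e , p))
... | tri≈ _ e _    | tri> _ _ p    = inj₂ (inj₂ (sym e , p))
... | tri≈ _ refl _ | tri≈ _ refl _ = ⊥-elim (s≢t refl)

Small : (i j W H : ℕ) → Point → Point → Set
Small i j W H s t = Fine i j W H s t × (W ≡ 4 → Spread (s ₓ) (t ₓ)) × (H ≡ 4 → Spread (s ᵧ) (t ᵧ))

Small? : ∀ i j W H s t → Dec (Small i j W H s t)
Small? i j W H s t = Fine? i j W H s t ×-dec (W ≟ 4 →-dec Spread? _ _) ×-dec (H ≟ 4 →-dec Spread? _ _)

Instance : Set
Instance = (ℕ × ℕ) × (ℕ × ℕ) × Point × Point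

depths sizes : List (ℕ × ℕ)
depths = cartesianProduct (range 1 2) (range 1 2)
sizes  = cartesianProduct (range 2 3) (range 2 3)

cells₅ : List Point
cells₅ = ⟦ rect 0 5 0 5 ⟧

ends : List (Point × Point)
ends = cartesianProduct cells₅ cells₅

boards : List ((ℕ × ℕ) × Point × Point)
boards = cartesianProduct sizes ends

instances : List Instance
instances = cartesianProduct depths boards

within : ℕ → ℕ → Point → Bool
within W H (x , y) = (x ≤ᵇ W) ∧ (y ≤ᵇ H)

settled : Instance → Bool
settled ((i , j) , (W , H) , s , t) =
  not (within W H s) ∨ not (within W H t) ∨ not ⌊ Before? s t ⌋ ∨ not ⌊ Small? i j W H s t ⌋ ∨ is-just (find i j W H s t)

-- Here the search is evaluated, on 4 · 9 · 625 instances: two depths at either corner, three to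
-- five columns and rows, two cells of a 5 × 5 square. `settled` passes over cells outside the
-- rectangle, pairs not in lexicographic order and pairs that are not `Small`, so `refl` certifies a
-- frame for every remaining one.
all-settled : all settled instances ≡ true
all-settled = refl

∈-range : ∀ {x y n} → x ≤ y → y < x + n → y ∈ range x n
∈-range {x} {y} {zero}  p q = ⊥-elim (<⇒≱ (subst (y <_) (+-identityʳ x) q) p)
∈-range {x} {y} {suc n} p q with m≤n⇒m<n∨m≡n p
... | inj₂ refl = here refl
... | inj₁ x<y  = there (∈-range x<y (subst (y <_) (+-suc x n) q))

all-∈ : ∀ {A : Set} (f : A → Bool) xs {x} → all f xs ≡ true → x ∈ xs → T (f x)
all-∈ f xs p = All.lookup (All.all⁺ f xs (subst T (sym p) tt))

within-true : ∀ {W H s} → s ₓ ≤ W → s ᵧ ≤ H → T (within W H s)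
within-true p q = Equivalence.from T-∧ (≤⇒≤ᵇ p , ≤⇒≤ᵇ q)

fromSettled : ∀ i j W H s t → T (settled ((i , j) , (W , H) , s , t)) → T (within W H s) → T (within W H t) →
              Before s t → Small i j W H s t → Frame i j W H s t
fromSettled i j W H s t p s∈ t∈ s<t small
  with within W H s | within W H t | Before? s t | Small? i j W H s t | find i j W H s t
... | true | true | yes _  | yes _ | just F = F
... | true | true | yes _  | no ¬s | _      = ⊥-elim (¬s small)
... | true | true | no s≮t | _     | _      = ⊥-elim (s≮t s<t)

settled-∈ : ∀ q → q ∈ instances → T (settled q)
settled-∈ q = all-∈ settled instances all-settled

∈cells : ∀ {x y} → x ≤ 4 → y ≤ 4 → (x , y) ∈ cells₅
∈cells p q = ∈-cartesianProduct⁺ {xs = range 0 5} {range 0 5} (∈-range z≤n (s≤s p)) (∈-range z≤n (s≤s q))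

before-frame : ∀ {i j W H s t} → 1 ≤ i → i ≤ 2 → 1 ≤ j → j ≤ 2 → 2 ≤ W → W ≤ 4 → 2 ≤ H → H ≤ 4 →
               s ₓ ≤ W → s ᵧ ≤ H → t ₓ ≤ W → t ᵧ ≤ H → Before s t → Small i j W H s t → Frame i j W H s t
before-frame {i} {j} {W} {H} {s} {t} i≥ i≤ j≥ j≤ W≥ W≤ H≥ H≤ sx sy tx ty =
  fromSettled i j W H s t (settled-∈ _ ∈instances) (within-true sx sy) (within-true tx ty)
  where
  ∈ends : (s , t) ∈ ends
  ∈ends = ∈-cartesianProduct⁺ {xs = cells₅} {cells₅} (∈cells (≤-trans sx W≤) (≤-trans sy H≤)) (∈cells (≤-trans tx W≤) (≤-trans ty H≤))
  ∈sizes : (W , H) ∈ sizes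
  ∈sizes = ∈-cartesianProduct⁺ {xs = range 2 3} {range 2 3} (∈-range W≥ (s≤s W≤)) (∈-range H≥ (s≤s H≤))
  ∈depths : (i , j) ∈ depths
  ∈depths = ∈-cartesianProduct⁺ {xs = range 1 2} {range 1 2} (∈-range i≥ (s≤s i≤)) (∈-range j≥ (s≤s j≤))
  ∈boards : ((W , H) , s , t) ∈ boards
  ∈boards = ∈-cartesianProduct⁺ {xs = sizes} {ends} ∈sizes ∈ends
  ∈instances : ((i , j) , (W , H) , s , t) ∈ instances
  ∈instances = ∈-cartesianProduct⁺ {xs = depths} {boards} ∈depths ∈boards

-- Frames of all rectangles, by induction on the size

map-range′ : ∀ a n → map (a +_) (range 0 n) ≡ range a n
map-range′ a n = trans (List.map-cong (+-comm a) (range 0 n)) (map-range a 0 n)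

-- The translation `shiftX` with the summand on the left: for a numeral `a` the new coordinates then
-- reduce to successors, so that inequalities with small numbers are settled by pattern matching.
pushX : ∀ a {w y h s t E} → Path (rect 0 w y h) s t E →
        Path (rect a w y h) (a + proj₁ s , proj₂ s) (a + proj₁ t , proj₂ t)
             (map (mapEdge (λ (x , y) → a + x , y)) E)
pushX a {w} {y} {h} = mapᵖ (λ (x , y) → a + x , y)
  (λ (near (close p q) r) → near (close (≤-trans (+-monoʳ-≤ a p) (≤-reflexive (+-suc a _)))
                                       (≤-trans (+-monoʳ-≤ a q) (≤-reflexive (+-suc a _)))) r)
  (↭-reflexive (trans (map-⊗ (a +_) id (range 0 w) (range y h))
    (cong₂ _⊗_ (map-range′ a w) (List.map-id (range y h)))))

pushY : ∀ b {x w h s t E} → Path (rect x w 0 h) s t E →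
        Path (rect x w b h) (proj₁ s , b + proj₂ s) (proj₁ t , b + proj₂ t)
             (map (mapEdge (λ (x , y) → x , b + y)) E)
pushY b {x} {w} {h} = mapᵖ (λ (x , y) → x , b + y)
  (λ (near r (close p q)) → near r (close (≤-trans (+-monoʳ-≤ b p) (≤-reflexive (+-suc b _)))
                                         (≤-trans (+-monoʳ-≤ b q) (≤-reflexive (+-suc b _)))))
  (↭-reflexive (trans (map-⊗ id (b +_) (range x w) (range 0 h))
    (cong₂ _⊗_ (List.map-id (range x w)) (map-range′ b h))))

∪-comm : ∀ {R S} → R ∪ S ≈ S ∪ R
∪-comm = solve 2 (λ a b → a ⊕ b ⊜ b ⊕ a) ≈-refl _ _

ring-at : ∀ {y h} → y < 2 + h → Path (rect 0 2 0 (3 + h)) (0 , y) (0 , suc y)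
  (((1 , 0) , (1 , 1)) ∷ ((1 , 1 + h) , (1 , 2 + h)) ∷ ((0 , 0) , (1 , 0)) ∷ ((1 , 2 + h) , (0 , 2 + h)) ∷ [])
ring-at {y} {h} y< with m≤n⇒∃[o]m+o≡n y<
... | o , eq = ring y o h (trans (+-suc (suc y) o) (cong suc eq))

≢-by : ∀ {A B : Set} (f : A → B) {x y} → f x ≢ f y → x ≢ y
≢-by f ne refl = ne refl

-- The cycle of the two new columns is opened next to the left edge of the smaller frame, wherever
-- that edge is, and its outer column supplies the new left edge. Nothing changes on the right, so
-- both depths are inherited.
peelLeft : ∀ {i j W h x y x′ y′} → Frame i j (suc W) (2 + h) (x , y) (x′ , y′) →
           Frame i j (3 + W) (2 + h) (2 + x , y) (2 + x′ , y′)
peelLeft {W = W} {h} (frame l< tp< bt< rt< rb< <rb P) =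
  frame (s≤s z≤n) (s≤s (s≤s tp<)) (s≤s (s≤s bt<)) rt< rb< <rb
    (keep (λ { (_ ∷ _ ∷ t ∷ b ∷ rt ∷ rb ∷ l ∷ _) → l ∷ t ∷ b ∷ rt ∷ rb ∷ [] })
      (resp (∪-comm ⨾ ≈-sym (splitX 2))
        (insert (pushX 2 P) (near down same) (flipX 2 refl (ring-at l<)) (near up same)
          (snd (λ ()) (λ ()) ∷ snd (λ ()) (λ ()) ∷ fst (λ ()) (λ ()) ∷ fst (λ ()) (λ ()) ∷ []))))

-- The outer column of the cycle contains the first and the last edge of the new right side. Hence
-- every depth is reached from a frame of depth 2, for which `Fine` has no exceptions.
peelRight : ∀ {i j W h s t} → 1 ≤ i → 1 ≤ j → Frame 2 2 (suc W) (2 + h) s t → Frame i j (3 + W) (2 + h) s t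
peelRight {i} {j} {W} {h} 1≤i 1≤j (frame l< tp< bt< rt< rb< <rb P) =
  frame l< (≤-trans tp< (m≤n+m _ 2)) (≤-trans bt< (m≤n+m _ 2)) 1≤i ≤-refl (≤-trans (≤-reflexive (+-comm 1 (1 + h))) (+-monoʳ-≤ (1 + h) 1≤j))
    (keep (λ { (_ ∷ _ ∷ l ∷ t ∷ b ∷ rt ∷ rb ∷ _) → l ∷ t ∷ b ∷ rt ∷ rb ∷ [] })
      (resp (≈-sym (splitX (2 + W)) ⨾ subst (λ z → rect 0 z 0 (3 + h) ≈ rect 0 (4 + W) 0 (3 + h)) (+-comm 2 (2 + W)) ≈-refl)
        (insert (keep (λ { (l ∷ t ∷ b ∷ rt ∷ _) → rt ∷ l ∷ t ∷ b ∷ [] }) P) (near up same)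
          (shiftX (2 + W) (ring-at (≤-trans rt< (s≤s (s≤s z≤n))))) (near down same)
          (fst (λ ()) (λ ()) ∷ fst (off tp<) (off tp<) ∷ fst (off bt<) (off bt<) ∷ []))))
  where
  off : ∀ {x y z} → x < suc W → (x , y) ≢ (suc W , z)
  off p = ≢-by proj₁ (<⇒≢ p)

-- The short sides of the transposed cycle become the left edge and the first right edge. Therefore
-- the smaller frame needs only depth 2 at the top, while the depth at the bottom is passed on.
peelTop : ∀ {i j w H x y x′ y′} → 1 ≤ i → Frame 2 j (2 + w) (suc H) (x , y) (x′ , y′) →
          Frame i j (2 + w) (3 + H) (x , 2 + y) (x′ , 2 + y′)
peelTop {w = w} {H} 1≤i (frame l< tp< bt< rt< rb< <rb P) =
  frame (s≤s z≤n) (s≤s z≤n) bt< 1≤i (s≤s (s≤s rb<)) (s≤s (s≤s <rb))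
    (keep (λ { (_ ∷ _ ∷ b ∷ rb ∷ t ∷ _ ∷ l ∷ rt ∷ _) → Edge-sym l ∷ t ∷ b ∷ rt ∷ rb ∷ [] })
      (resp (∪-comm ⨾ ≈-sym (splitY 2))
        (insert (keep (λ { (l ∷ t ∷ b ∷ rt ∷ rb ∷ _) → t ∷ b ∷ rb ∷ [] }) (pushY 2 P)) (near same down)
          (transpose (flipX 2 refl (ring-at tp<))) (near same up)
          (fst (λ ()) (λ ()) ∷ snd (λ ()) (λ ()) ∷ []))))

suc-∸-suc : ∀ {m n} → n < m → suc (m ∸ suc n) ≡ m ∸ n
suc-∸-suc {suc m} {n} (s≤s p) = sym (+-∸-assoc 1 p)

flipFrame : ∀ {i j W H s t} → i ≤ H → Frame i j W H s t →
            Frame j i W H (s ₓ , H ∸ s ᵧ) (t ₓ , H ∸ t ᵧ)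
flipFrame {i} {j} {W} {H} i≤H (frame {l} {tp} {bt} {rt} {rb} l< tp< bt< rt< rb< <rb P) =
  frame (flip< l<) bt< tp<
    (subst (_≤ j) (sym (suc-∸-suc rb<)) (m≤n+o⇒m∸n≤o H rb <rb)) (flip< rt<H)
    (≤-trans (m≤n+m∸n H (suc rt)) (≤-trans (≤-reflexive (+-comm (suc rt) _)) (+-monoʳ-≤ _ rt<)))
    (keep (λ { (l ∷ t ∷ b ∷ rt ∷ rb ∷ []) → turn l< l ∷ level b
                 ∷ t ∷ turn rb< rb ∷ turn rt<H rt ∷ [] })
      (flipY (suc H) (+-identityʳ (suc H)) P))
  where
  rt<H = ≤-trans rt< i≤H
  flip< : ∀ {k} → k < H → H ∸ suc k < H
  flip< {k} p = subst (_≤ H) (sym (suc-∸-suc p)) (m∸n≤m H k)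
  turn : ∀ {x k ps} → k < H → Edge ((x , H ∸ k) , (x , H ∸ suc k)) ps → Edge ((x , H ∸ suc k) , (x , suc (H ∸ suc k))) ps
  turn {x} {k} {ps} p e = subst (λ z → Edge ((x , H ∸ suc k) , (x , z)) ps) (sym (suc-∸-suc p)) (Edge-sym e)
  level : ∀ {x x′ ps} → Edge ((x , H ∸ H) , (x′ , H ∸ H)) ps → Edge ((x , 0) , (x′ , 0)) ps
  level {x} {x′} {ps} = subst (λ z → Edge ((x , z) , (x′ , z)) ps) (n∸n≡0 H)

sum-suc : ∀ m n → m + suc n ≡ n + suc m
sum-suc m n = trans (+-suc m n) (trans (cong suc (+-comm m n)) (sym (+-suc n m)))

joinX : ∀ {i j W₁ W₂ H s y x′ y′} → Frame 2 2 W₁ H s (W₁ , y) → Frame i j W₂ H (0 , y) (x′ , y′) →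
        Frame i j (W₂ + suc W₁) H s (x′ + suc W₁ , y′)
joinX {W₁ = W₁} {W₂} {H} (frame l< tp< bt< _ _ _ P) (frame _ _ _ rt< rb< <rb Q) =
  frame l< (≤-trans tp< (≤-trans (n≤1+n W₁) (m≤n+m (suc W₁) W₂))) (≤-trans bt< (≤-trans (n≤1+n W₁) (m≤n+m (suc W₁) W₂))) rt< rb< <rb
    (keep (λ { (_ ∷ l ∷ t ∷ b ∷ _ ∷ _ ∷ _ ∷ _ ∷ _ ∷ rt ∷ rb ∷ []) → l ∷ t ∷ b ∷ rt ∷ rb ∷ [] })
      (resp (≈-sym (splitX (suc W₁)) ⨾ subst (λ z → rect 0 (suc z) 0 (suc H) ≈ rect 0 (suc (W₂ + suc W₁)) 0 (suc H)) (sum-suc W₂ W₁) ≈-refl)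
        (P ⟨ near up same ⟩ shiftX (suc W₁) Q)))

joinY : ∀ {i j W H₁ H₂ s x x′ y′} → Frame i 2 W H₁ s (x , H₁) → Frame 2 j W H₂ (x , 0) (x′ , y′) →
        Frame i j W (H₂ + suc H₁) s (x′ , y′ + suc H₁)
joinY {j = j} {W} {H₁} {H₂} (frame {l} l< tp< _ rt< _ _ P) (frame _ _ bt< _ rb< <rb Q) =
  frame (≤-trans l< (≤-trans (n≤1+n H₁) (m≤n+m (suc H₁) H₂))) tp< bt< rt< (+-monoˡ-< (suc H₁) rb<)
    (≤-trans (+-monoˡ-≤ (suc H₁) <rb) (≤-reflexive (lem _ j (suc H₁))))
    (keep (λ { (_ ∷ l ∷ t ∷ _ ∷ rt ∷ _ ∷ _ ∷ _ ∷ b ∷ _ ∷ rb ∷ []) → l ∷ t ∷ b ∷ rt ∷ rb ∷ [] })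
      (resp (≈-sym (splitY (suc H₁)) ⨾ subst (λ z → rect 0 (suc W) 0 (suc z) ≈ rect 0 (suc W) 0 (suc (H₂ + suc H₁))) (sum-suc H₂ H₁) ≈-refl)
        (P ⟨ near same up ⟩ shiftY (suc H₁) Q)))
  where
  lem : ∀ a b c → a + b + c ≡ a + c + b
  lem a b c = trans (+-assoc a b c) (trans (cong (a +_) (+-comm b c)) (sym (+-assoc a c b)))

revFrame : ∀ {i j W H s t} → Frame i j W H s t → Frame i j W H t s
revFrame (frame l< tp< bt< rt< rb< <rb P) = frame l< tp< bt< rt< rb< <rb (rev P)

∉pair : ∀ {s t u v} → s ≢ u → s ≢ v → ¬ SameSet s t u v
∉pair a b (inj₁ (e , _)) = a e
∉pair a b (inj₂ (e , _)) = b e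

SameSet-swap : ∀ {s t u v} → SameSet t s u v → SameSet s t u v
SameSet-swap (inj₁ (a , b)) = inj₂ (b , a)
SameSet-swap (inj₂ (a , b)) = inj₁ (b , a)

Fine-sym : ∀ {i j W H s t} → Fine i j W H s t → Fine i j W H t s
Fine-sym (f , g , h) = (λ i → f i ∘ SameSet-swap) , (λ j → g j ∘ SameSet-swap) ,
  (λ i j H → let a , b , c = h i j H in b , a , c ∘ SameSet-swap)

record Inside (W H : ℕ) (s : Point) : Set where
  constructor inside
  field
    ≤W : s ₓ ≤ W
    ≤H : s ᵧ ≤ H

data Depth : ℕ → Set where
  d₁ : Depth 1
  d₂ : Depth 2

depth≥ : ∀ {i} → Depth i → 1 ≤ i
depth≥ d₁ = s≤s z≤n
depth≥ d₂ = s≤s z≤n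

depth≤ : ∀ {i} → Depth i → i ≤ 2
depth≤ d₁ = s≤s z≤n
depth≤ d₂ = s≤s (s≤s z≤n)

1≢2 : ∀ {A : Set} → 2 ≡ 1 → A
1≢2 ()

Fine-22 : ∀ {W H s t} → Fine 2 2 W H s t
Fine-22 = 1≢2 , 1≢2 , 1≢2

small-frame : ∀ {i j W H s t} → Depth i → Depth j → 2 ≤ W → W ≤ 4 → 2 ≤ H → H ≤ 4 → Inside W H s → Inside W H t →
              s ≢ t → Fine i j W H s t →
              (W ≡ 4 → Spread (s ₓ) (t ₓ)) → (H ≡ 4 → Spread (s ᵧ) (t ᵧ)) → Frame i j W H s t
small-frame {s = s} {t} i j W≥ W≤ H≥ H≤ (inside sx sy) (inside tx ty) s≢t fine spx spy with before-cmp s t s≢t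
... | inj₁ p = before-frame (depth≥ i) (depth≤ i) (depth≥ j) (depth≤ j) W≥ W≤ H≥ H≤ sx sy tx ty p (fine , spx , spy)
... | inj₂ p = revFrame (before-frame (depth≥ i) (depth≤ i) (depth≥ j) (depth≤ j) W≥ W≤ H≥ H≤ tx ty sx sy p
                 (Fine-sym fine , flipS ∘ spx , flipS ∘ spy))
  where
  flipS : ∀ {x x′} → Spread x x′ → Spread x′ x
  flipS (p , q) = Sum.swap p , Sum.swap q

-- `lowFree` and `highFree` leave two outer lines without ends. `apart` is a cut behind the third
-- line: at least three lines lie on either side, and the far end is not on the first line behind
-- the cut, where the path enters.
data Layout (x x′ : ℕ) : ℕ → Set where
  lowFree  : ∀ {V y y′} → x ≡ 2 + y → x′ ≡ 2 + y′ → Layout x x′ (4 + V)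
  highFree : ∀ {V} → x ≤ 2 + V → x′ ≤ 2 + V → Layout x x′ (4 + V)
  apart    : ∀ {V y} → x < 2 → x′ ≡ suc y + 3 → suc y ≤ 2 + V → Layout x x′ (5 + V)
  apart′   : ∀ {V y} → x′ < 2 → x ≡ suc y + 3 → suc y ≤ 2 + V → Layout x x′ (5 + V)
  few      : ∀ {W} → W ≤ 4 → (W ≡ 4 → Spread x x′) → Layout x x′ W

layout : ∀ {x x′} W → x ≤ W → x′ ≤ W → Layout x x′ W
layout 0 _ _ = few z≤n (λ ())
layout 1 _ _ = few (s≤s z≤n) (λ ())
layout 2 _ _ = few (s≤s (s≤s z≤n)) (λ ())
layout 3 _ _ = few (s≤s (s≤s (s≤s z≤n))) (λ ())
layout {x} {x′} (suc (suc (suc (suc V)))) p p′ with 2 ≤? x ×-dec 2 ≤? x′ | x ≤? 2 + V ×-dec x′ ≤? 2 + V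
... | yes (a , b) | _ = lowFree (sym (proj₂ (m≤n⇒∃[o]m+o≡n a))) (sym (proj₂ (m≤n⇒∃[o]m+o≡n b)))
... | no _        | yes (c , d) = highFree c d
... | no ¬low     | no ¬high = go V p p′ (one-< ¬low) (one-< ¬high)
  where
  one-< : ∀ {a b c d} → ¬ (a ≤ b × c ≤ d) → b < a ⊎ d < c
  one-< {a} {b} {c} {d} ¬p with a ≤? b
  ... | yes a≤b = inj₂ (≰⇒> (λ c≤d → ¬p (a≤b , c≤d)))
  ... | no a≰b  = inj₁ (≰⇒> a≰b)
  far : ∀ {V x} → 3 + V < x → x ≤ 5 + V → ∃ λ y → x ≡ suc y + 3 × suc y ≤ 2 + V
  far {V} q r with m≤n⇒∃[o]m+o≡n (≤-trans (s≤s (m≤m+n 3 V)) q)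
  ... | o , refl = o , cong suc (+-comm 3 o) , s≤s⁻¹ (s≤s⁻¹ (s≤s⁻¹ r))
  low-high : ∀ {V x} {A : Set} → x < 2 → 2 + V < x → A
  low-high q r = ⊥-elim (<⇒≱ q (≤-trans (s≤s (s≤s z≤n)) r))
  go : ∀ V → x ≤ 4 + V → x′ ≤ 4 + V → x < 2 ⊎ x′ < 2 → 2 + V < x ⊎ 2 + V < x′ → Layout x x′ (4 + V)
  go zero    _ _  low      high     = few ≤-refl (λ _ → low , high)
  go (suc V) p p′ (inj₁ q) (inj₁ r) = low-high q r
  go (suc V) p p′ (inj₁ q) (inj₂ r) = let _ , e , b = far r p′ in apart q e b
  go (suc V) p p′ (inj₂ q) (inj₁ r) = let _ , e , b = far r p in apart′ q e b
  go (suc V) p p′ (inj₂ q) (inj₂ r) = low-high q r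

Claim : ℕ → Set
Claim n = ∀ {i j W H s t} → Depth i → Depth j → 2 ≤ W → 2 ≤ H → W + H < n → Inside W H s → Inside W H t → s ≢ t →
  Fine i j W H s t → Frame i j W H s t

swapClaim : ∀ {i j W H s t} → (Inside W H t → Inside W H s → t ≢ s → Fine i j W H t s → Frame i j W H t s) →
            Inside W H s → Inside W H t → s ≢ t → Fine i j W H s t → Frame i j W H s t
swapClaim f is it s≢t fine = revFrame (f it is (s≢t ∘ sym) (Fine-sym fine))

-- The cut is crossed in the top row, from column 2 to column 3, and neither of these cells is an
-- end. The new end of the right part is off its last column, so of the exceptions in `Fine` only
-- the one forbidding the middle cell as the other end remains, and that is inherited.
apartX : ∀ {n i j V H x y x′ y′} → Claim n → Depth i → Depth j → 2 ≤ H → 5 + V + H < suc n → x < 2 → suc x′ ≤ 2 + V →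
         Inside (5 + V) H (x , y) → Inside (5 + V) H (suc x′ + 3 , y′) →
         Fine i j (5 + V) H (x , y) (suc x′ + 3 , y′) → Frame i j (5 + V) H (x , y) (suc x′ + 3 , y′)
apartX {n} {i} {j} {V} {H} {x} {y} {x′} {y′} rec di dj H≥ (s≤s b) x<2 x′≤ is it (f₁ , f₂ , f₃) =
  subst (λ z → Frame i j z H (x , y) (suc x′ + 3 , y′)) (cong (2 +_) (+-comm V 3))
    (joinX (rec d₂ d₂ ≤-refl H≥ (≤-trans (s≤s (s≤s (s≤s (m≤n+m H (2 + V))))) b)
             (inside (s≤s⁻¹ (≤-trans x<2 (s≤s (s≤s z≤n)))) (Inside.≤H is)) (inside ≤-refl z≤n)
             (≢-by proj₁ (<⇒≢ x<2)) Fine-22)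
           (rec di dj (s≤s (s≤s z≤n)) H≥ (≤-trans (m≤n+m _ 2) b) (inside z≤n z≤n) (inside x′≤ (Inside.≤H it)) (λ ())
             ( (λ _ → ∉pair (λ ()) (λ ())) , (λ _ → ∉pair (λ ()) (λ ()))
             , (λ i j H → (λ ()) , (λ { refl → proj₁ (proj₂ (f₃ i j H)) (cong (λ z → 2 + z , 1) (+-comm V 3)) })
                        , ∉pair (λ ()) (λ ())) )))

-- The cut is crossed in column 0, far from the right side. Each part keeps one of the two depths
-- and gets depth 2 at the cut, so the exception for three rows disappears.
apartY : ∀ {n i j W V x y x′ y′} → Claim n → Depth i → Depth j → 2 ≤ W → W + (5 + V) < suc n → y < 2 → suc y′ ≤ 2 + V →
         Inside W (5 + V) (x , y) → Inside W (5 + V) (x′ , suc y′ + 3) →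
         Fine i j W (5 + V) (x , y) (x′ , suc y′ + 3) → Frame i j W (5 + V) (x , y) (x′ , suc y′ + 3)
apartY {n} {i} {j} {suc W} {V} {x} {y} {x′} {y′} rec di dj W≥ (s≤s b) y<2 y′≤ is it (f₁ , f₂ , f₃) =
  subst (λ z → Frame i j (suc W) z (x , y) (x′ , suc y′ + 3)) (cong (2 +_) (+-comm V 3))
    (joinY {x = 0} (rec di d₂ W≥ ≤-refl (below (s≤s (s≤s (s≤s z≤n))))
             (inside (Inside.≤W is) (s≤s⁻¹ (≤-trans y<2 (s≤s (s≤s z≤n))))) (inside z≤n ≤-refl)
             (≢-by proj₂ (<⇒≢ y<2)) ((λ _ → ∉pair (λ ()) (λ ()) ∘ SameSet-swap) , 1≢2 , λ _ → 1≢2))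
           (rec d₂ dj W≥ (s≤s (s≤s z≤n)) (below (m≤n+m _ 2)) (inside z≤n z≤n) (inside (Inside.≤W it) y′≤) (λ ())
             (1≢2 , (λ _ → ∉pair (λ ()) (λ ())) , 1≢2)))
  where
  below : ∀ {k} → k < 5 + V → suc W + k < n
  below p = <-≤-trans (+-monoʳ-< (suc W) p) b

SameSet-map : ∀ (f : Point → Point) {s t u v} → SameSet s t u v → SameSet (f s) (f t) (f u) (f v)
SameSet-map f (inj₁ (refl , refl)) = inj₁ (refl , refl)
SameSet-map f (inj₂ (refl , refl)) = inj₂ (refl , refl)

peelBottom : ∀ {i j w H s t} → Depth i → Depth j → s ᵧ ≤ suc H → t ᵧ ≤ suc H → 1 ≤ H →
             Frame i 2 (2 + w) (suc H) s t → Frame i j (2 + w) (3 + H) s t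
peelBottom {i} {j} {w} {H} {s} {t} di dj s≤ t≤ 1≤H F =
  subst₂ (λ y y′ → Frame i j (2 + w) (3 + H) (s ₓ , y) (t ₓ , y′)) (m∸[m∸n]≡n s≤) (m∸[m∸n]≡n t≤)
    (flipFrame (≤-trans (depth≤ dj) (s≤s (s≤s z≤n))) (peelTop (depth≥ dj) (flipFrame (≤-trans (depth≤ di) (s≤s 1≤H)) F)))

frames : ∀ n → Claim n
frames (suc n) {W = suc (suc w)} {suc (suc h)} {x , y} {x′ , y′} di dj W≥@(s≤s (s≤s _)) H≥@(s≤s (s≤s _)) b
       is@(inside sx sy) it@(inside tx ty) s≢t fine@(f₁ , f₂ , f₃) with layout (2 + w) sx tx
... | lowFree refl refl = peelLeft (frames n di dj (s≤s (s≤s z≤n)) H≥ (≤-trans (n≤1+n _) (s≤s⁻¹ b))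
  (inside (s≤s⁻¹ (s≤s⁻¹ sx)) sy) (inside (s≤s⁻¹ (s≤s⁻¹ tx)) ty) (s≢t ∘ cong right2)
  ( (λ i → f₁ i ∘ SameSet-map right2) , (λ j → f₂ j ∘ SameSet-map right2)
  , (λ i j H → let p , q , r = f₃ i j H in p ∘ cong right2 , q ∘ cong right2 , r ∘ SameSet-map right2)))
  where
  right2 : Point → Point
  right2 (x , y) = 2 + x , y
... | highFree p q = peelRight (depth≥ di) (depth≥ dj) (frames n d₂ d₂ (s≤s (s≤s z≤n)) H≥ (≤-trans (n≤1+n _) (s≤s⁻¹ b))
  (inside p sy) (inside q ty) s≢t Fine-22)
... | apart p refl q = apartX (frames n) di dj H≥ b p q is it fine
... | apart′ p refl q = swapClaim (λ is it _ fine → apartX (frames n) di dj H≥ b p q is it fine) is it s≢t fine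
... | few W≤ spx with layout (2 + h) sy ty
...   | lowFree refl refl = peelTop (depth≥ di) (frames n d₂ dj W≥ (s≤s (s≤s z≤n)) (below-2 b)
  (inside sx (s≤s⁻¹ (s≤s⁻¹ sy))) (inside tx (s≤s⁻¹ (s≤s⁻¹ ty))) (s≢t ∘ cong down2)
  (1≢2 , (λ j → f₂ j ∘ SameSet-map down2) , 1≢2))
  where
  down2 : Point → Point
  down2 (x , y) = x , 2 + y
  below-2 : ∀ {V} → 2 + w + (4 + V) < suc n → 2 + w + (2 + V) < n
  below-2 (s≤s b) = <-≤-trans (+-monoʳ-< (2 + w) (n≤1+n _)) b
...   | highFree p q = peelBottom di dj p q (s≤s z≤n) (frames n di d₂ W≥ (s≤s (s≤s z≤n))
  (<-≤-trans (+-monoʳ-< (2 + w) (n≤1+n _)) (s≤s⁻¹ b)) (inside sx p) (inside tx q) s≢t (f₁ , 1≢2 , λ _ → 1≢2))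
...   | apart p refl q = apartY (frames n) di dj W≥ b p q is it fine
...   | apart′ p refl q = swapClaim (λ is it _ fine → apartY (frames n) di dj W≥ b p q is it fine) is it s≢t fine
...   | few H≤ spy = small-frame di dj W≥ W≤ H≥ H≤ is it s≢t fine spx spy

frame-exists : ∀ {i j W H s t} → Depth i → Depth j → 2 ≤ W → 2 ≤ H → Inside W H s → Inside W H t → s ≢ t →
               Fine i j W H s t → Frame i j W H s t
frame-exists di dj W≥ H≥ = frames _ di dj W≥ H≥ ≤-refl

Edges : Set
Edges = List (Point × Point)

-- Paths on two rows

lineX⁺ : ∀ q {y} → Path (rect 0 (2 + q) y 1) (0 , y) (suc q , y)
         (((0 , y) , (1 , y)) ∷ ((q , y) , (suc q , y)) ∷ [])
lineX⁺ zero    = keep (λ { (e ∷ []) → e ∷ e ∷ [] }) (resp (≈-sym (splitX 1)) (single ⟨ near up same ⟩ single))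
lineX⁺ (suc q) {y} = keep (λ { (e ∷ f ∷ _) → e ∷ f ∷ [] })
  (resp (∪-cong ≈-refl (≈-sym (splitX (suc q)) ⨾ width (+-comm (suc q) 1)) ⨾ ≈-sym (splitX 1))
    (single ⟨ near up same ⟩ lineX q ⟨ near up same ⟩ single))

line₂ : ∀ p → rect 0 p 0 1 ∪ rect 0 p 1 1 ≈ rect 0 p 0 2
line₂ p = ≈-sym (splitY 1)

L₀ : Point × Point
L₀ = (0 , 0) , (0 , 1)

leftTurn : ∀ p → Path (rect 0 (suc p) 0 2) (p , 0) (p , 1) (L₀ ∷ [])
leftTurn p = resp (line₂ (suc p)) (rev (lineX p) ⟨ near same up ⟩ lineX p)

rightTurn : ∀ q → Path (rect 0 (suc q) 0 2) (0 , 0) (0 , 1) (((q , 0) , (q , 1)) ∷ [])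
rightTurn q = resp (line₂ (suc q)) (lineX q ⟨ near same up ⟩ rev (lineX q))

slots : ℕ → Edges
slots q = ((0 , 0) , (1 , 0)) ∷ ((0 , 1) , (1 , 1)) ∷ ((q , 0) , (suc q , 0)) ∷ ((q , 1) , (suc q , 1)) ∷ []

leftTurn⁺ : ∀ q → Path (rect 0 (2 + q) 0 2) (suc q , 0) (suc q , 1) (L₀ ∷ slots q)
leftTurn⁺ q = keep (λ { (l ∷ t ∷ t′ ∷ b ∷ b′ ∷ []) → l ∷ t ∷ b ∷ t′ ∷ b′ ∷ [] })
  (resp (line₂ (2 + q)) (rev (lineX⁺ q) ⟨ near same up ⟩ lineX⁺ q))

rightTurn⁺ : ∀ q → Path (rect 0 (2 + q) 0 2) (0 , 0) (0 , 1) (((suc q , 0) , (suc q , 1)) ∷ slots q)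
rightTurn⁺ q = keep (λ { (l ∷ t ∷ t′ ∷ b ∷ b′ ∷ []) → l ∷ t ∷ b ∷ t′ ∷ b′ ∷ [] })
  (resp (line₂ (2 + q)) (lineX⁺ q ⟨ near same up ⟩ rev (lineX⁺ q)))

column : ∀ x → Path (rect x 1 0 2) (x , 0) (x , 1) []
column x = forget (resp (line₂′ x) (single ⟨ near same up ⟩ single))
  where
  line₂′ : ∀ x → rect x 1 0 1 ∪ rect x 1 1 1 ≈ rect x 1 0 2
  line₂′ x = ≈-sym (splitY 1)

crossed : ∀ r → r ≤ 1 → ∃ λ r′ → r′ ≤ 1 × Path (rect 0 2 0 2) (0 , r) (1 , r′) (slots 0)
crossed 0 _ = 1 , ≤-refl , keep (λ { (_ ∷ t ∷ b ∷ []) → t ∷ b ∷ t ∷ b ∷ [] })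
  (resp (line₂ 2) (lineX₂ ⟨ near down up ⟩ lineX₂))
  where
  lineX₂ : ∀ {y} → Path (rect 0 2 y 1) (0 , y) (1 , y) (((0 , y) , (1 , y)) ∷ [])
  lineX₂ = keep (λ { (e ∷ _) → e ∷ [] }) (lineX⁺ 0)
crossed (suc zero) _ = 0 , z≤n , keep (λ { (_ ∷ t ∷ b ∷ []) → b ∷ t ∷ b ∷ t ∷ [] })
  (resp (∪-comm ⨾ line₂ 2) (lineX₂ ⟨ near down down ⟩ lineX₂))
  where
  lineX₂ : ∀ {y} → Path (rect 0 2 y 1) (0 , y) (1 , y) (((0 , y) , (1 , y)) ∷ [])
  lineX₂ = keep (λ { (e ∷ _) → e ∷ [] }) (lineX⁺ 0)
crossed (suc (suc _)) (s≤s ())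

-- On two rows, consecutive columns are completely joined. So it does not matter in which row a part
-- ends at the cut.
LeftPart RightPart : ℕ → Point → Edges → Set
LeftPart  p s E = ∃ λ r → r ≤ 1 × Path (rect 0 (suc p) 0 2) s (p , r) E
RightPart q t E = ∃ λ r → r ≤ 1 × Path (rect 0 (suc q) 0 2) (0 , r) t E

turn-part : ∀ {R p E} → Path R (p , 0) (p , 1) E → ∀ {r} → r ≤ 1 → ∃ λ r′ → r′ ≤ 1 × Path R (p , r) (p , r′) E
turn-part P {zero}  _ = 1 , ≤-refl , P
turn-part P {suc zero} _ = 0 , z≤n , rev P
turn-part P {suc (suc _)} (s≤s ())

rev-part : ∀ {R p r E} → (∃ λ r′ → r′ ≤ 1 × Path R (p , r) (p , r′) E) → ∃ λ r′ → r′ ≤ 1 × Path R (p , r′) (p , r) E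
rev-part (r′ , b , P) = r′ , b , rev P

close-≤1 : ∀ {r r′} → r ≤ 1 → r′ ≤ 1 → Close r r′
close-≤1 p q = close (≤-trans p (s≤s z≤n)) (≤-trans q (s≤s z≤n))

extend : ∀ {p s E} n → LeftPart p s E → LeftPart (n + p) s E
extend zero    P = P
extend {p} (suc n) P with extend n P
... | r , b , Q = 1 , ≤-refl , keep (λ { (_ ∷ es) → lemma es })
  (resp (≈-sym (splitX (suc (n + p))) ⨾ width (+-comm (suc (n + p)) 1))
    (Q ⟨ near up (close-≤1 b z≤n) ⟩ column (suc (n + p))))
  where
  lemma : ∀ {E ps} → All (λ e → Edge e ps) (E ++ []) → All (λ e → Edge e ps) E
  lemma {[]}    _        = []
  lemma {_ ∷ _} (e ∷ es) = e ∷ lemma es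

shiftE : ℕ → Edges → Edges
shiftE a = map (mapEdge (λ (x , y) → x + a , y))

combine : ∀ {p q s x r E E′} n → LeftPart p s E → RightPart q (x , r) E′ →
          Path (rect 0 (suc q + (n + suc p)) 0 2) s (x + (n + suc p) , r) (E ++ shiftE (n + suc p) E′)
combine {p} {q} {s} {x} {t} {E} {E′} n L (r′ , b′ , Q) with extend n L
... | r , b , P = subst (λ z → Path (rect 0 (suc q + z) 0 2) s (x + z , t) (E ++ shiftE z E′)) (sym (+-suc n p))
  (keep (λ { (_ ∷ es) → es })
    (resp (≈-sym (splitX (suc (n + p))) ⨾ width (+-comm (suc (n + p)) (suc q)))
    (P ⟨ near up (close-≤1 b b′) ⟩ shiftX (suc (n + p)) Q)))

left-turn : ∀ x {r} → r ≤ 1 → LeftPart x (x , r) (L₀ ∷ [])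
left-turn x b = turn-part (leftTurn x) b

left-turn⁺ : ∀ q {r} → r ≤ 1 → LeftPart (suc q) (suc q , r) (L₀ ∷ slots q)
left-turn⁺ q b = turn-part (leftTurn⁺ q) b

right-turn : ∀ q {r} → r ≤ 1 → RightPart q (0 , r) (((q , 0) , (q , 1)) ∷ [])
right-turn q b = rev-part (turn-part (rightTurn q) b)

right-turn⁺ : ∀ q {r} → r ≤ 1 → RightPart (suc q) (0 , r) (((suc q , 0) , (suc q , 1)) ∷ slots q)
right-turn⁺ q b = rev-part (turn-part (rightTurn⁺ q) b)

left-crossed : ∀ {r} → r ≤ 1 → LeftPart 1 (0 , r) (slots 0)
left-crossed b = crossed _ b

right-crossed : ∀ {r} → r ≤ 1 → RightPart 1 (1 , r) (slots 0)
right-crossed {r} b with crossed r b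
... | r′ , b′ , P = r′ , b′ , keep (λ { (t ∷ b ∷ t′ ∷ b′ ∷ []) → Edge-sym t ∷ Edge-sym b ∷ Edge-sym t′ ∷ Edge-sym b′ ∷ [] })
   (rev (flipX 2 refl P))

T₀ B₀ : Point × Point
T₀ = (0 , 0) , (1 , 0)
B₀ = (0 , 1) , (1 , 1)

-- From an end in column 0, both horizontal edges are obtained by covering the first two columns
-- crosswise; from any other end the turn at the left margin contains them. `p` is the last column
-- covered, and the bound says when the other end lies beyond it.
left-slots : ∀ x {r} → r ≤ 1 →
             ∃ λ p → (∀ {z} → 1 < z → x < z → p < z) × LeftPart p (x , r) (T₀ ∷ B₀ ∷ [])
left-slots zero    b = 1 , (λ p _ → p) , map₂ (map₂ (keep λ { (t ∷ u ∷ _) → t ∷ u ∷ [] })) (left-crossed b)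
left-slots (suc x) b = suc x , (λ _ p → p) , map₂ (map₂ (keep λ { (_ ∷ t ∷ u ∷ _) → t ∷ u ∷ [] })) (left-turn⁺ x b)

gap : ∀ {x y} → x < y → ∃ λ n → y ≡ n + suc x
gap {x} p with m≤n⇒∃[o]m+o≡n p
... | n , refl = n , +-comm (suc x) n

rest : ∀ {x y} → x ≤ y → ∃ λ n → y ≡ n + x
rest {x} p with m≤n⇒∃[o]m+o≡n p
... | n , refl = n , +-comm x n

Two : ℕ → Point → Point → Edges → Set
Two W = Path (rect 0 (suc W) 0 2)

T⟨_⟩ B⟨_⟩ : ℕ → Point × Point
T⟨ k ⟩ = (k , 0) , (suc k , 0)
B⟨ k ⟩ = (k , 1) , (suc k , 1)

end : ℕ → Point × Point
end W = (W , 0) , (W , 1)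

ends-< : ∀ {W x x′ r r′} → x < x′ → x′ ≤ W → r ≤ 1 → r′ ≤ 1 → Two W (x , r) (x′ , r′) (end 0 ∷ end W ∷ [])
ends-< {x = x} p p′ b b′ with gap p
... | n , refl with rest p′
...   | q , refl = combine n (left-turn x b) (right-turn q b′)

TB₀-end-< : ∀ {W x x′ r r′} → 1 < x′ → x < x′ → x′ ≤ W → r ≤ 1 → r′ ≤ 1 →
            Two W (x , r) (x′ , r′) (T⟨ 0 ⟩ ∷ B⟨ 0 ⟩ ∷ end W ∷ [])
TB₀-end-< {x = x} 1<x′ p p′ b b′ with left-slots x b
... | _ , bound , L with gap (bound 1<x′ p)
...   | n , refl with rest p′
...     | q , refl = combine n L (right-turn q b′)

-- The last slots of the right part are those between columns V and V+1 once it is moved by o columns.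
record LastSlots (V x′ r′ : ℕ) : Set where
  constructor lastSlots
  field
    {q o y} : ℕ
    V≡     : V ≡ q + o
    x′≡    : x′ ≡ y + o
    o>     : ∀ {z} → z < V → z < x′ → z < o
    part   : RightPart (suc q) (y , r′) (T⟨ q ⟩ ∷ B⟨ q ⟩ ∷ [])

right-slots : ∀ {V x′ r′} → x′ ≤ suc V → r′ ≤ 1 → LastSlots V x′ r′
right-slots {V} {x′} p b with m≤n⇒m<n∨m≡n p
... | inj₂ refl = lastSlots {q = 0} {V} {1} refl refl (λ p _ → p) (map₂ (map₂ (keep λ { (t ∷ u ∷ _) → t ∷ u ∷ [] })) (right-crossed b))
... | inj₁ (s≤s x′≤V) with rest x′≤V
...   | q , refl = lastSlots {q = q} {x′} {0} refl refl (λ _ p → p) (map₂ (map₂ (keep λ { (_ ∷ _ ∷ _ ∷ t ∷ u ∷ []) → t ∷ u ∷ [] })) (right-turn⁺ q b))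

end-TB-< : ∀ {V x x′ r r′} → x < V → x < x′ → x′ ≤ suc V → r ≤ 1 → r′ ≤ 1 →
           Two (suc V) (x , r) (x′ , r′) (T⟨ V ⟩ ∷ B⟨ V ⟩ ∷ end 0 ∷ [])
end-TB-< {x = x} x<V p p′ b b′ with right-slots p′ b′
... | lastSlots refl refl o> R with gap (o> x<V p)
...   | n , refl = keep (λ { (l ∷ t ∷ u ∷ []) → t ∷ u ∷ l ∷ [] }) (combine n (left-turn x b) R)

TB-TB-< : ∀ {V x x′ r r′} → 1 < V → 1 < x′ → x < V → x < x′ → x′ ≤ suc V → r ≤ 1 → r′ ≤ 1 →
          Two (suc V) (x , r) (x′ , r′) (T⟨ 0 ⟩ ∷ B⟨ 0 ⟩ ∷ T⟨ V ⟩ ∷ B⟨ V ⟩ ∷ [])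
TB-TB-< {x = x} 1<V 1<x′ x<V p p′ b b′ with left-slots x b | right-slots p′ b′
... | _ , bound , L | lastSlots refl refl o> R with gap (bound (o> 1<V 1<x′) (o> x<V p))
...   | n , refl = combine n L R

-- Column 0 is left by a step that may be diagonal; the first horizontal edges that are certain lie
-- between columns 1 and 2.
start-< : ∀ {q r r′} → r ≤ 1 → r′ ≤ 1 →
          Two (2 + q) (0 , r) (1 , r′) (end 0 ∷ end (2 + q) ∷ T⟨ 1 ⟩ ∷ B⟨ 1 ⟩ ∷ T⟨ suc q ⟩ ∷ B⟨ suc q ⟩ ∷ [])
start-< {q} {r} {r′} b b′ = subst (λ z → Two (suc z) (0 , r) (1 , r′) (end 0 ∷ end (suc z) ∷ T⟨ 1 ⟩ ∷ B⟨ 1 ⟩ ∷ T⟨ z ⟩ ∷ B⟨ z ⟩ ∷ [])) (+-comm q 1)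
  (combine 0 (left-turn 0 b) (right-turn⁺ q b′))

-- With both ends in the top row of the first two columns, the path goes out along the bottom row
-- and returns along the top row.
loop : ∀ V → Two (suc V) (0 , 0) (1 , 0) (B⟨ 0 ⟩ ∷ B⟨ V ⟩ ∷ end (suc V) ∷ [])
loop V = keep (λ { (_ ∷ r ∷ b ∷ b′ ∷ []) → b ∷ b′ ∷ Edge-sym r ∷ [] })
  (resp (solve 3 (λ a b c → a ⊕ b ⊕ c ⊜ (a ⊕ c) ⊕ b) ≈-refl _ _ _ ⨾ ∪-cong (≈-sym (splitX 1)) ≈-refl ⨾ line₂ (2 + V))
    (single ⟨ near same up ⟩ lineX⁺ V ⟨ near same down ⟩ rev (lineX V)))

end₀ : ∀ {V r r′} → r ≤ 1 → r′ ≤ 1 → r ≢ r′ → Two (suc V) (0 , r) (0 , r′) (end (suc V) ∷ slots V)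
end₀ z≤n       z≤n       ne = ⊥-elim (ne refl)
end₀ z≤n       (s≤s z≤n) ne = rightTurn⁺ _
end₀ (s≤s z≤n) z≤n       ne = rev (rightTurn⁺ _)
end₀ (s≤s z≤n) (s≤s z≤n) ne = ⊥-elim (ne refl)

endₗ : ∀ {V r r′} → r ≤ 1 → r′ ≤ 1 → r ≢ r′ → Two (suc V) (suc V , r) (suc V , r′) (end 0 ∷ slots V)
endₗ z≤n       z≤n       ne = ⊥-elim (ne refl)
endₗ z≤n       (s≤s z≤n) ne = leftTurn⁺ _
endₗ (s≤s z≤n) z≤n       ne = rev (leftTurn⁺ _)
endₗ (s≤s z≤n) (s≤s z≤n) ne = ⊥-elim (ne refl)

loopₗ : ∀ V → Two (suc V) (V , 0) (suc V , 0) (B⟨ 0 ⟩ ∷ B⟨ V ⟩ ∷ [])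
loopₗ V = keep (λ { (_ ∷ _ ∷ b ∷ b′ ∷ []) → b ∷ b′ ∷ [] })
  (resp (solve 3 (λ a b c → a ⊕ b ⊕ c ⊜ (a ⊕ c) ⊕ b) ≈-refl _ _ _ ⨾
      ∪-cong (≈-sym (splitX (suc V)) ⨾ width (+-comm (suc V) 1)) ≈-refl ⨾ line₂ (2 + V))
    (rev (lineX V) ⟨ near same up ⟩ lineX⁺ V ⟨ near same down ⟩ single))

finish-< : ∀ {q r r′} → r ≤ 1 → r′ ≤ 1 →
           Two (2 + q) (suc q , r) (2 + q , r′) (T⟨ 0 ⟩ ∷ B⟨ 0 ⟩ ∷ T⟨ q ⟩ ∷ B⟨ q ⟩ ∷ [])
finish-< b b′ = keep (λ { (_ ∷ t ∷ u ∷ v ∷ w ∷ _) → t ∷ u ∷ v ∷ w ∷ [] }) (combine 0 (left-turn⁺ _ b) (right-turn 0 b′))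

symmetricₓ : (P : Point → Point → Set) → (∀ {s t} → P s t → P t s) →
             (∀ {s t} → s ₓ < t ₓ → P s t) → (∀ {x y y′} → P (x , y) (x , y′)) → ∀ {s t} → P s t
symmetricₓ P P-sym lt eq {s} {t} with <-cmp (s ₓ) (t ₓ)
... | tri< p _ _    = lt p
... | tri≈ _ refl _ = eq
... | tri> _ _ p    = P-sym (lt p)

SameColumn SameRow : Point → Point → Set
SameColumn s t = s ₓ ≡ t ₓ
SameRow    s t = s ᵧ ≡ t ᵧ

rows-ends : ∀ {W s t} → Inside W 1 s → Inside W 1 t → ¬ SameColumn s t → Two W s t (end 0 ∷ end W ∷ [])
rows-ends {W} = symmetricₓ (λ s t → Inside W 1 s → Inside W 1 t → ¬ SameColumn s t → Two W s t (end 0 ∷ end W ∷ []))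
  (λ f is it ne → rev (f it is (ne ∘ sym)))
  (λ p is it ne → ends-< p (Inside.≤W it) (Inside.≤H is) (Inside.≤H it))
  (λ is it ne → ⊥-elim (ne refl))

same-ends : ∀ {V E s t} → Inside (suc V) 1 s → Inside (suc V) 1 t → s ≢ t → SameColumn s t → s ₓ ≡ 0 ⊎ s ₓ ≡ suc V →
            (∀ {ps} → All (λ e → Edge e ps) (slots V) → All (λ e → Edge e ps) E) → Two (suc V) s t E
same-ends {s = x , y} {t = .x , y′} is it ne refl (inj₁ refl) f =
  keep (λ { (_ ∷ es) → f es }) (end₀ (Inside.≤H is) (Inside.≤H it) (ne ∘ cong (0 ,_)))
same-ends {V} {s = x , y} {t = .x , y′} is it ne refl (inj₂ refl) f =
  keep (λ { (_ ∷ es) → f es }) (endₗ (Inside.≤H is) (Inside.≤H it) (ne ∘ cong (suc V ,_)))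

rows-TB : ∀ {V s t} → Inside (2 + V) 1 s → Inside (2 + V) 1 t → s ≢ t →
          (SameColumn s t → s ₓ ≡ 0 ⊎ s ₓ ≡ 2 + V) →
          ∃ λ k → k < 2 + V × Two (2 + V) s t (T⟨ k ⟩ ∷ B⟨ k ⟩ ∷ [])
rows-TB {V} = symmetricₓ (λ s t → Inside (2 + V) 1 s → Inside (2 + V) 1 t → s ≢ t →
          (SameColumn s t → s ₓ ≡ 0 ⊎ s ₓ ≡ 2 + V) → ∃ λ k → k < 2 + V × Two (2 + V) s t (T⟨ k ⟩ ∷ B⟨ k ⟩ ∷ []))
  (λ f is it ne c → map₂ (map₂ rev) (f it is (ne ∘ sym) (λ e → subst (λ z → z ≡ 0 ⊎ z ≡ 2 + V) (sym e) (c (sym e)))))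
  lt
  (λ is it ne c → 0 , s≤s z≤n , same-ends is it ne refl (c refl) (λ { (t ∷ u ∷ _) → t ∷ u ∷ [] }))
  where
  lt : ∀ {s t} → s ₓ < t ₓ → Inside (2 + V) 1 s → Inside (2 + V) 1 t → s ≢ t → _ →
       ∃ λ k → k < 2 + V × Two (2 + V) s t (T⟨ k ⟩ ∷ B⟨ k ⟩ ∷ [])
  lt {s} {t} p is it _ _ with 1 <? t ₓ
  ... | yes q = 0 , s≤s z≤n , keep (λ { (t ∷ u ∷ _) → t ∷ u ∷ [] }) (TB₀-end-< q p (Inside.≤W it) (Inside.≤H is) (Inside.≤H it))
  ... | no ¬q = suc V , ≤-refl , keep (λ { (t ∷ u ∷ _) → t ∷ u ∷ [] })
    (end-TB-< (≤-trans p (≤-trans (≮⇒≥ ¬q) (s≤s z≤n))) p (Inside.≤W it) (Inside.≤H is) (Inside.≤H it))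

rows-B-end : ∀ {V s t} → Inside (2 + V) 1 s → Inside (2 + V) 1 t → s ≢ t → (SameColumn s t → s ₓ ≡ 0) →
             ∃ λ k → k < 2 + V × Two (2 + V) s t (B⟨ k ⟩ ∷ end (2 + V) ∷ [])
rows-B-end {V} = symmetricₓ (λ s t → Inside (2 + V) 1 s → Inside (2 + V) 1 t → s ≢ t → (SameColumn s t → s ₓ ≡ 0) →
             ∃ λ k → k < 2 + V × Two (2 + V) s t (B⟨ k ⟩ ∷ end (2 + V) ∷ []))
  (λ f is it ne c → map₂ (map₂ rev) (f it is (ne ∘ sym) (λ e → trans e (c (sym e)))))
  lt
  (λ is it ne c → 0 , s≤s z≤n , zero-column is it ne (c refl))
  where
  zero-column : ∀ {x y y′} → Inside (2 + V) 1 (x , y) → Inside (2 + V) 1 (x , y′) → (x , y) ≢ (x , y′) → x ≡ 0 →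
                Two (2 + V) (x , y) (x , y′) (B⟨ 0 ⟩ ∷ end (2 + V) ∷ [])
  zero-column is it ne refl = keep (λ { (r ∷ t ∷ u ∷ _) → u ∷ r ∷ [] }) (end₀ (Inside.≤H is) (Inside.≤H it) (ne ∘ cong (0 ,_)))
  lt : ∀ {s t} → s ₓ < t ₓ → Inside (2 + V) 1 s → Inside (2 + V) 1 t → s ≢ t → _ →
       ∃ λ k → k < 2 + V × Two (2 + V) s t (B⟨ k ⟩ ∷ end (2 + V) ∷ [])
  lt {s} {t} p is it _ _ with 1 <? t ₓ
  ... | yes q = 0 , s≤s z≤n , keep (λ { (t ∷ u ∷ r ∷ []) → u ∷ r ∷ [] }) (TB₀-end-< q p (Inside.≤W it) (Inside.≤H is) (Inside.≤H it))
  lt {.0 , _} {suc zero , _} (s≤s z≤n) is it _ _ | no _ = 1 , s≤s (s≤s z≤n) ,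
    keep (λ { (_ ∷ r ∷ _ ∷ u ∷ _) → u ∷ r ∷ [] }) (start-< (Inside.≤H is) (Inside.≤H it))
  lt {_} {suc (suc _) , _} p is it _ _ | no ¬q = ⊥-elim (¬q (s≤s (s≤s z≤n)))

-- Ends in the first two columns block the edge B⟨ 0 ⟩ unless both are in the top row.
Unblocked : Point → Point → Set
Unblocked s t = (s ₓ ≡ 0 → t ₓ ≡ 1 → s ᵧ ≡ 0 × t ᵧ ≡ 0) × (t ₓ ≡ 0 → s ₓ ≡ 1 → t ᵧ ≡ 0 × s ᵧ ≡ 0)

B₀-end-< : ∀ {V s t} → s ₓ < t ₓ → Inside (suc V) 1 s → Inside (suc V) 1 t → Unblocked s t →
           Two (suc V) s t (B⟨ 0 ⟩ ∷ end (suc V) ∷ [])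
B₀-end-< {s = s} {t} p is it (c , _) with 1 <? t ₓ
... | yes q = keep (λ { (t ∷ u ∷ r ∷ []) → u ∷ r ∷ [] }) (TB₀-end-< q p (Inside.≤W it) (Inside.≤H is) (Inside.≤H it))
B₀-end-< {s = .0 , _} {suc zero , _} (s≤s z≤n) is it (c , _) | no _ with c refl refl
... | refl , refl = keep (λ { (b ∷ _ ∷ r ∷ []) → b ∷ r ∷ [] }) (loop _)
B₀-end-< {t = suc (suc _) , _} p is it _ | no ¬q = ⊥-elim (¬q (s≤s (s≤s z≤n)))

rows-B₀-end : ∀ {V s t} → Inside (suc V) 1 s → Inside (suc V) 1 t → s ≢ t → (SameColumn s t → s ₓ ≡ 0) → Unblocked s t →
              Two (suc V) s t (B⟨ 0 ⟩ ∷ end (suc V) ∷ [])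
rows-B₀-end {V} = symmetricₓ (λ s t → Inside (suc V) 1 s → Inside (suc V) 1 t → s ≢ t → (SameColumn s t → s ₓ ≡ 0) →
              Unblocked s t → Two (suc V) s t (B⟨ 0 ⟩ ∷ end (suc V) ∷ []))
  (λ f is it ne c (u , v) → rev (f it is (ne ∘ sym) (λ e → trans e (c (sym e))) (v , u)))
  (λ p is it ne c u → B₀-end-< p is it u)
  (λ is it ne c _ → zero-column is it ne (c refl))
  where
  zero-column : ∀ {x y y′} → Inside (suc V) 1 (x , y) → Inside (suc V) 1 (x , y′) → (x , y) ≢ (x , y′) → x ≡ 0 →
                Two (suc V) (x , y) (x , y′) (B⟨ 0 ⟩ ∷ end (suc V) ∷ [])
  zero-column is it ne refl = keep (λ { (r ∷ t ∷ u ∷ _) → u ∷ r ∷ [] }) (end₀ (Inside.≤H is) (Inside.≤H it) (ne ∘ cong (0 ,_)))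

rows-B₀ : ∀ {V s t} → Inside (suc V) 1 s → Inside (suc V) 1 t → s ≢ t → (SameColumn s t → s ₓ ≡ 0 ⊎ s ₓ ≡ suc V) →
          Unblocked s t → Two (suc V) s t (B⟨ 0 ⟩ ∷ [])
rows-B₀ {V} {s} {t} is it ne c u with s ₓ ≟ t ₓ
... | yes e = same-ends is it ne e (c e) (λ { (_ ∷ b ∷ _) → b ∷ [] })
... | no ¬e = keep (λ { (b ∷ _) → b ∷ [] }) (rows-B₀-end is it ne (⊥-elim ∘ ¬e) u)

rows-BB₂ : ∀ {V s t} → Inside (4 + V) 1 s → Inside (4 + V) 1 t → s ≢ t → (SameColumn s t → s ₓ ≡ 0 ⊎ s ₓ ≡ 4 + V) →
           ∃₂ λ k k′ → k < 2 × k′ < 4 + V × 2 + V ≤ k′ × Two (4 + V) s t (B⟨ k ⟩ ∷ B⟨ k′ ⟩ ∷ [])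
rows-BB₂ {V} = symmetricₓ (λ s t → Inside (4 + V) 1 s → Inside (4 + V) 1 t → s ≢ t → (SameColumn s t → s ₓ ≡ 0 ⊎ s ₓ ≡ 4 + V) →
           ∃₂ λ k k′ → k < 2 × k′ < 4 + V × 2 + V ≤ k′ × Two (4 + V) s t (B⟨ k ⟩ ∷ B⟨ k′ ⟩ ∷ []))
  (λ f is it ne c → map₂ (map₂ (map₂ (map₂ (map₂ rev))))
     (f it is (ne ∘ sym) (λ e → subst (λ z → z ≡ 0 ⊎ z ≡ 4 + V) (sym e) (c (sym e)))))
  lt
  (λ is it ne c → 0 , 3 + V , s≤s z≤n , ≤-refl , n≤1+n _ , same-ends is it ne refl (c refl) (λ { (_ ∷ b ∷ _ ∷ b′ ∷ []) → b ∷ b′ ∷ [] }))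
  where
  lt : ∀ {s t} → s ₓ < t ₓ → Inside (4 + V) 1 s → Inside (4 + V) 1 t → s ≢ t → _ →
       ∃₂ λ k k′ → k < 2 × k′ < 4 + V × 2 + V ≤ k′ × Two (4 + V) s t (B⟨ k ⟩ ∷ B⟨ k′ ⟩ ∷ [])
  lt {s} {t} p is it _ _ with 1 <? t ₓ | s ₓ <? 3 + V
  ... | yes q | yes q′ = 0 , 3 + V , s≤s z≤n , ≤-refl , n≤1+n _ ,
    keep (λ { (_ ∷ b ∷ _ ∷ b′ ∷ []) → b ∷ b′ ∷ [] }) (TB-TB-< (s≤s (s≤s z≤n)) q q′ p (Inside.≤W it) (Inside.≤H is) (Inside.≤H it))
  lt {.0 , _} {suc zero , _} (s≤s z≤n) is it _ _ | no _ | _ = 1 , 3 + V , ≤-refl , ≤-refl , n≤1+n _ ,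
    keep (λ { (_ ∷ _ ∷ _ ∷ b ∷ _ ∷ b′ ∷ []) → b ∷ b′ ∷ [] }) (start-< (Inside.≤H is) (Inside.≤H it))
  lt {_} {suc (suc _) , _} p is it _ _ | no ¬q | _ = ⊥-elim (¬q (s≤s (s≤s z≤n)))
  lt {x , _} {x′ , _} p is it _ _ | yes _ | no ¬q
    with refl ← ≤-antisym (≤-trans p (Inside.≤W it)) (s≤s (≮⇒≥ ¬q)) with refl ← ≤-antisym (Inside.≤W it) p =
    0 , 2 + V , s≤s z≤n , n≤1+n _ , ≤-refl , keep (λ { (_ ∷ b ∷ _ ∷ b′ ∷ []) → b ∷ b′ ∷ [] }) (finish-< (Inside.≤H is) (Inside.≤H it))

-- These conditions allow the first and the last edge of the bottom row at once. On three columns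
-- the two edges meet, the bottom row is traversed in one go, and ends in the outer columns both
-- have to be in the top row.
record Free₁ (W : ℕ) (s t : Point) : Set where
  field
    inLine  : SameColumn s t → s ₓ ≡ 0 ⊎ s ₓ ≡ W
    start   : Unblocked s t
    finish  : (suc (s ₓ) ≡ W → t ₓ ≡ W → s ᵧ ≡ 0 × t ᵧ ≡ 0) × (suc (t ₓ) ≡ W → s ₓ ≡ W → t ᵧ ≡ 0 × s ᵧ ≡ 0)
    three   : W ≡ 2 → (s ₓ ≡ 0 → t ₓ ≡ 2 → s ᵧ ≡ 0 × t ᵧ ≡ 0) × (t ₓ ≡ 0 → s ₓ ≡ 2 → t ᵧ ≡ 0 × s ᵧ ≡ 0)

Free₁-sym : ∀ {W s t} → Free₁ W s t → Free₁ W t s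
Free₁-sym {W} f = record
  { inLine = λ e → subst (λ z → z ≡ 0 ⊎ z ≡ W) (sym e) (Free₁.inLine f (sym e))
  ; start  = swap (Free₁.start f) ; finish = swap (Free₁.finish f) ; three = swap ∘ Free₁.three f }

zigzag : Two 2 (0 , 0) (2 , 0) (B⟨ 0 ⟩ ∷ B⟨ 1 ⟩ ∷ [])
zigzag = keep (λ { (e ∷ _ ∷ b ∷ _) → b ∷ e ∷ [] }) (resp (≈-sym (splitX 2)) (proj₂ (proj₂ (crossed 0 z≤n)) ⟨ near up same ⟩ rev (column 2)))

rows-BB₁ : ∀ {V s t} → Inside (2 + V) 1 s → Inside (2 + V) 1 t → s ≢ t → Free₁ (2 + V) s t →
           Two (2 + V) s t (B⟨ 0 ⟩ ∷ B⟨ suc V ⟩ ∷ [])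
rows-BB₁ {V} = symmetricₓ (λ s t → Inside (2 + V) 1 s → Inside (2 + V) 1 t → s ≢ t → Free₁ (2 + V) s t →
           Two (2 + V) s t (B⟨ 0 ⟩ ∷ B⟨ suc V ⟩ ∷ []))
  (λ f is it ne c → rev (f it is (ne ∘ sym) (Free₁-sym c)))
  (λ p is it _ c → lt p is it c)
  (λ is it ne c → same-ends is it ne refl (Free₁.inLine c refl) (λ { (_ ∷ b ∷ _ ∷ b′ ∷ []) → b ∷ b′ ∷ [] }))
  where
  lt : ∀ {V s t} → s ₓ < t ₓ → Inside (2 + V) 1 s → Inside (2 + V) 1 t → Free₁ (2 + V) s t →
       Two (2 + V) s t (B⟨ 0 ⟩ ∷ B⟨ suc V ⟩ ∷ [])
  lt {s = .0 , _} {suc zero , _} (s≤s z≤n) is it c with proj₁ (Free₁.start c) refl refl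
  ... | refl , refl = keep (λ { (b ∷ b′ ∷ _) → b ∷ b′ ∷ [] }) (loop _)
  lt {V} {x , _} {suc (suc _) , _} p is it c with x <? suc V
  lt {V} {x , _} {suc (suc _) , _} p is it c | no ¬q
    with refl ← ≤-antisym (≤-trans p (Inside.≤W it)) (s≤s (≮⇒≥ ¬q)) with refl ← ≤-antisym (Inside.≤W it) p
    with refl , refl ← proj₁ (Free₁.finish c) refl refl = loopₗ _
  lt {suc V} {x , _} {suc (suc _) , _} p is it c | yes q =
    keep (λ { (_ ∷ b ∷ _ ∷ b′ ∷ []) → b ∷ b′ ∷ [] }) (TB-TB-< (s≤s (s≤s z≤n)) (s≤s (s≤s z≤n)) q p (Inside.≤W it) (Inside.≤H is) (Inside.≤H it))
  lt {zero} {zero , _} {suc (suc zero) , _} p is it c | yes q with refl , refl ← proj₁ (Free₁.three c refl) refl refl = zigzag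
  lt {zero} {suc _ , _} p is it c | yes (s≤s ())
  lt {zero} {zero , _} {suc (suc (suc _)) , _} p is (inside (s≤s (s≤s ())) _) c | yes q

-- Paths with prescribed edges in rectangles

Grid : ℕ → ℕ → Point → Point → Edges → Set
Grid W H = Path (rect 0 (suc W) 0 (suc H))

Inside-swap : ∀ {W H s} → Inside W H s → Inside H W (swap s)
Inside-swap (inside p q) = inside q p

∼-swap : ∀ {s t : Point} → s ≢ t → swap s ≢ swap t
∼-swap ne e = ne (cong swap e)

2≤2+ : ∀ {n} → 2 ≤ 2 + n
2≤2+ = s≤s (s≤s z≤n)

-- Only on two rows or two columns are the ends restricted: filling an inner line, they would
-- separate the rectangle.
anyPath : ∀ {W H s t} → Inside (suc W) (suc H) s → Inside (suc W) (suc H) t → s ≢ t →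
          (H ≡ 0 → SameColumn s t → s ₓ ≡ 0 ⊎ s ₓ ≡ suc W) → (W ≡ 0 → SameRow s t → s ᵧ ≡ 0 ⊎ s ᵧ ≡ suc H) →
          Grid (suc W) (suc H) s t []
anyPath {W} {zero} {s} {t} is it ne c r with s ₓ ≟ t ₓ
... | yes e = same-ends is it ne e (c refl e) (λ _ → [])
... | no ¬e = forget (rows-ends is it ¬e)
anyPath {zero} {suc H} {s} {t} is it ne c r with s ᵧ ≟ t ᵧ
... | yes e = transpose (same-ends (Inside-swap is) (Inside-swap it) (∼-swap ne) e (r refl e) (λ _ → []))
... | no ¬e = transpose (forget (rows-ends (Inside-swap is) (Inside-swap it) ¬e))
anyPath {suc W} {suc H} is it ne c r = forget (Frame.thePath (frame-exists d₂ d₂ 2≤2+ 2≤2+ is it ne Fine-22))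

bottomPath : ∀ {W H s t} → Inside (suc W) (suc H) s → Inside (suc W) (suc H) t → s ≢ t →
             (H ≡ 0 → SameColumn s t → s ₓ ≡ 0 ⊎ s ₓ ≡ suc W) → (W ≡ 0 → SameRow s t → s ᵧ ≡ 0) →
             ∃ λ k → k < suc W × Grid (suc W) (suc H) s t (((k , suc H) , (suc k , suc H)) ∷ [])
bottomPath {zero} {H} {s} {t} is it ne c r with s ᵧ ≟ t ᵧ
... | no ¬e = 0 , ≤-refl , transpose (keep (λ { (_ ∷ e ∷ []) → e ∷ [] }) (rows-ends (Inside-swap is) (Inside-swap it) ¬e))
bottomPath {zero} {H} {x , y} {x′ , .y} is it ne c r | yes refl with r refl refl
... | refl = 0 , ≤-refl , transpose (keep (λ { (e ∷ _) → e ∷ [] }) (end₀ (Inside.≤W is) (Inside.≤W it) (ne ∘ cong (_, 0))))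
bottomPath {suc W} {zero} is it ne c r =
  map₂ (map₂ (keep λ { (_ ∷ b ∷ []) → b ∷ [] })) (rows-TB is it ne (c refl))
bottomPath {suc W} {suc H} is it ne c r with frame-exists d₂ d₂ 2≤2+ 2≤2+ is it ne Fine-22
... | frame _ _ bt< _ _ _ P = _ , bt< , keep (λ { (_ ∷ _ ∷ b ∷ _) → b ∷ [] }) P

topBottomPath : ∀ {W H s t} → Inside (suc W) (suc H) s → Inside (suc W) (suc H) t → s ≢ t →
                (H ≡ 0 → SameColumn s t → s ₓ ≡ 0 ⊎ s ₓ ≡ suc W) → (W ≡ 0 → ¬ SameRow s t) →
                ∃₂ λ k k′ → k < suc W × k′ < suc W ×
                Grid (suc W) (suc H) s t (((k , 0) , (suc k , 0)) ∷ ((k′ , suc H) , (suc k′ , suc H)) ∷ [])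
topBottomPath {zero} {H} is it ne c r = 0 , 0 , ≤-refl , ≤-refl , transpose (rows-ends (Inside-swap is) (Inside-swap it) (r refl))
topBottomPath {suc W} {zero} is it ne c r with rows-TB is it ne (c refl)
... | k , k< , P = k , k , k< , k< , P
topBottomPath {suc W} {suc H} is it ne c r with frame-exists d₂ d₂ 2≤2+ 2≤2+ is it ne Fine-22
... | frame _ tp< bt< _ _ _ P = _ , _ , tp< , bt< , keep (λ { (_ ∷ t ∷ b ∷ _) → t ∷ b ∷ [] }) P

Fine-12 : ∀ {W H s t} → ¬ SameSet s t (W , 0) (W , 1) → Fine 1 2 W H s t
Fine-12 f = (λ _ → f) , 1≢2 , λ _ → 1≢2

rightPath : ∀ {W H s t} → Inside (suc W) (suc H) s → Inside (suc W) (suc H) t → s ≢ t →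
            (H ≡ 0 → SameColumn s t → s ₓ ≡ 0) →
            (W ≡ 0 → 1 ≤ H → (SameRow s t → s ᵧ ≡ 0 ⊎ s ᵧ ≡ suc H) × Unblocked (swap s) (swap t)) →
            ¬ SameSet s t (suc W , 0) (suc W , 1) →
            Grid (suc W) (suc H) s t (((suc W , 0) , (suc W , 1)) ∷ [])
rightPath {W} {zero} {s} {t} is it ne c r f with s ₓ ≟ t ₓ
... | no ¬e = keep (λ { (_ ∷ e ∷ []) → e ∷ [] }) (rows-ends is it ¬e)
rightPath {W} {zero} {x , y} {.x , y′} is it ne c r f | yes refl with c refl refl
... | refl = keep (λ { (e ∷ _) → e ∷ [] }) (end₀ (Inside.≤H is) (Inside.≤H it) (ne ∘ cong (0 ,_)))
rightPath {zero} {suc H} is it ne c r f =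
  transpose (rows-B₀ (Inside-swap is) (Inside-swap it) (∼-swap ne) (proj₁ (r refl (s≤s z≤n))) (proj₂ (r refl (s≤s z≤n))))
rightPath {suc W} {suc H} is it ne c r f with frame-exists d₁ d₂ 2≤2+ 2≤2+ is it ne (Fine-12 f)
... | frame _ _ _ (s≤s z≤n) _ _ P = keep (λ { (_ ∷ _ ∷ _ ∷ e ∷ _) → e ∷ [] }) P

rightBottomPath : ∀ {W H s t} → Inside (suc W) (suc H) s → Inside (suc W) (suc H) t → s ≢ t →
            (1 ≤ W → H ≡ 0 → SameColumn s t → s ₓ ≡ 0) →
            (W ≡ 0 → (SameRow s t → s ᵧ ≡ 0) × Unblocked (swap s) (swap t)) →
            ¬ SameSet s t (suc W , 0) (suc W , 1) →
            ∃ λ k → k < suc W ×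
            Grid (suc W) (suc H) s t (((suc W , 0) , (suc W , 1)) ∷ ((k , suc H) , (suc k , suc H)) ∷ [])
rightBottomPath {zero} {H} is it ne c r f = 0 , ≤-refl ,
  transpose (rows-B₀-end (Inside-swap is) (Inside-swap it) (∼-swap ne) (proj₁ (r refl)) (proj₂ (r refl)))
rightBottomPath {suc W} {zero} is it ne c r f =
  map₂ (map₂ (keep λ { (b ∷ e ∷ []) → e ∷ b ∷ [] })) (rows-B-end is it ne (c (s≤s z≤n) refl))
rightBottomPath {suc W} {suc H} is it ne c r f with frame-exists d₁ d₂ 2≤2+ 2≤2+ is it ne (Fine-12 f)
... | frame _ _ bt< (s≤s z≤n) _ _ P = _ , bt< , keep (λ { (_ ∷ _ ∷ b ∷ e ∷ _) → e ∷ b ∷ [] }) P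

twoRightPath₂ : ∀ {W H s t} → Inside (suc W) (4 + H) s → Inside (suc W) (4 + H) t → s ≢ t →
                (W ≡ 0 → SameRow s t → s ᵧ ≡ 0 ⊎ s ᵧ ≡ 4 + H) →
                ∃₂ λ k k′ → k < 2 × k′ < 4 + H × 2 + H ≤ k′ ×
                Grid (suc W) (4 + H) s t (((suc W , k) , (suc W , suc k)) ∷ ((suc W , k′) , (suc W , suc k′)) ∷ [])
twoRightPath₂ {zero} is it ne r with rows-BB₂ (Inside-swap is) (Inside-swap it) (∼-swap ne) (r refl)
... | k , k′ , k< , k′< , <k′ , P = k , k′ , k< , k′< , <k′ , transpose P
twoRightPath₂ {suc W} {H} is it ne r with frame-exists d₂ d₂ 2≤2+ 2≤2+ is it ne Fine-22
... | frame {rb = rb} _ _ _ rt< rb< <rb P = _ , _ , rt< , rb< , s≤s⁻¹ (s≤s⁻¹ (≤-trans <rb (≤-reflexive (+-comm rb 2)))) ,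
  keep (λ { (_ ∷ _ ∷ _ ∷ e ∷ f ∷ []) → e ∷ f ∷ [] }) P

twoRightPath₁ : ∀ {W H s t} → Inside (suc W) (2 + H) s → Inside (suc W) (2 + H) t → s ≢ t →
                (W ≡ 0 → Free₁ (2 + H) (swap s) (swap t)) → (1 ≤ W → Fine 1 1 (suc W) (2 + H) s t) →
                Grid (suc W) (2 + H) s t (((suc W , 0) , (suc W , 1)) ∷ ((suc W , suc H) , (suc W , 2 + H)) ∷ [])
twoRightPath₁ {zero} is it ne r f = transpose (rows-BB₁ (Inside-swap is) (Inside-swap it) (∼-swap ne) (r refl))
twoRightPath₁ {suc W} {H} is it ne r f with frame-exists d₁ d₁ 2≤2+ 2≤2+ is it ne (f (s≤s z≤n))
... | frame {rb = rb} _ _ _ (s≤s z≤n) rb< <rb P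
    with refl ← ≤-antisym (s≤s⁻¹ rb<) (s≤s⁻¹ (≤-trans <rb (≤-reflexive (+-comm rb 1)))) =
  keep (λ { (_ ∷ _ ∷ _ ∷ e ∷ f ∷ []) → e ∷ f ∷ [] }) P

-- Reflections

flipH : ∀ {W H s t E} → Grid W H s t E → Grid W H (W ∸ s ₓ , s ᵧ) (W ∸ t ₓ , t ᵧ) (map (mapEdge (λ (x , y) → W ∸ x , y)) E)
flipH {W} = flipX (suc W) (+-identityʳ (suc W))

flipV : ∀ {W H s t E} → Grid W H s t E → Grid W H (s ₓ , H ∸ s ᵧ) (t ₓ , H ∸ t ᵧ) (map (mapEdge (λ (x , y) → x , H ∸ y)) E)
flipV {H = H} = flipY (suc H) (+-identityʳ (suc H))

-- The C-shaped region, with the origin moved to (0 , 0); its height is n = d + (c + l).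
C : (a k c l d : ℕ) → Region
C a k c l d = rect 0 a 0 (d + (c + l)) ∪ rect a k 0 c ∪ rect a k (c + l) d

body-split : ∀ a c l d → rect 0 a 0 (d + (c + l)) ≈ rect 0 a 0 (c + l) ∪ rect 0 a (c + l) d
body-split a c l d = height (+-comm d (c + l)) ⨾ splitY (c + l)

-- Gluing the arms to the body

two-bands : ∀ a k c l d → (rect 0 a 0 (c + l) ∪ rect a k 0 c) ∪ rect 0 (a + k) (c + l) d ≈ C a k c l d
two-bands a k c l d = ∪-cong ≈-refl (splitX a) ⨾
  solve 4 (λ u v w z → (u ⊕ v) ⊕ (w ⊕ z) ⊜ (u ⊕ w) ⊕ (v ⊕ z)) ≈-refl _ _ _ _ ⨾
  ∪-cong (≈-sym (body-split a c l d)) ≈-refl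

three-bands : ∀ a k c l d → rect 0 (a + k) 0 c ∪ rect 0 a c l ∪ rect 0 (a + k) (c + l) d ≈ C a k c l d
three-bands a k c l d =
  ∪-cong (splitX a) ≈-refl ⨾
  solve 4 (λ u v w z → (u ⊕ v) ⊕ (w ⊕ z) ⊜ ((u ⊕ w) ⊕ v) ⊕ z) ≈-refl _ _ _ _ ⨾
  ∪-cong (∪-cong (≈-sym (splitY c)) ≈-refl) ≈-refl ⨾ two-bands a k c l d

-- The path leaves the arm from one of the first two cells of its first column, and each of these is
-- adjacent to both of the first two cells of the last column of the body.
Exit : (w h : ℕ) → Point → Set
Exit w h s = ∃ λ r → r ≤ 1 × Path (rect 0 w 0 h) s (0 , r) []

block-exit : ∀ {W H s} → Inside (suc W) (suc H) s → Exit (2 + W) (2 + H) s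
block-exit {s = s} is with s ≟ᵖ (0 , 0)
... | yes refl = 1 , ≤-refl , anyPath is (inside z≤n (s≤s z≤n)) (λ ()) (λ _ _ → inj₁ refl) (λ _ → λ ())
... | no ne    = 0 , z≤n , anyPath is (inside z≤n z≤n) ne (λ _ → inj₁) (λ _ → inj₁)

line-exit : ∀ W → Exit (suc W) 1 (W , 0)
line-exit W = 0 , z≤n , rev (lineX W)

-- The path can take the place of the edge u – v of a path outside R.
record Plug (R : Region) (u v : Point) : Set where
  constructor plug
  field
    {u′ v′} : Point
    enter : u ~ u′
    inner : Path R u′ v′ []
    leave : v′ ~ v

plugIn : ∀ {R R′ s t u v E} → Path R s t ((u , v) ∷ E) → Plug R′ u v → All (λ e → Differ e (u , v)) E → Path (R ∪ R′) s t E
plugIn {E = E} P (plug n Q n′) ds = keep (λ { (_ ∷ _ ∷ es) → drop es }) (insert P n Q n′ ds)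
  where
  drop : ∀ {E ps} → All (λ e → Edge e ps) (E ++ []) → All (λ e → Edge e ps) E
  drop {[]}    _        = []
  drop {_ ∷ _} (e ∷ es) = e ∷ drop es

-- Arms without ends are entered from consecutive cells of the last column of the body.
topPlug : ∀ {W K c i} → i ≤ 1 → Plug (rect (suc W) (2 + K) 0 (2 + c)) (W , i) (W , suc i)
topPlug {W} i≤ = plug (near up (close-≤1 i≤ z≤n))
  (shiftX (suc W) (anyPath (inside z≤n z≤n) (inside z≤n (s≤s z≤n)) (λ ()) (λ _ _ → inj₁ refl) (λ _ → λ ())))
  (near down (close (s≤s z≤n) (s≤s i≤)))

Close-suc : ∀ {x y} → Close x y → Close (suc x) (suc y)
Close-suc (close p q) = close (s≤s p) (s≤s q)

-- The path inside the arm joins the last two cells of its first column; `Close i (d + b)` admits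
-- the last edge of the right side and the one before it.
bottomPlug : ∀ {W K b d i} → Close i (d + b) → Plug (rect (suc W) (2 + K) b (2 + d)) (W , i) (W , suc i)
bottomPlug {W} {b = b} {d} cl = plug (near up cl)
  (shiftY b (shiftX (suc W) (anyPath (inside z≤n (n≤1+n d)) (inside z≤n ≤-refl) (λ e → n≢1+n (cong proj₂ e)) (λ _ _ → inj₁ refl)
    (λ _ e → ⊥-elim (n≢1+n e)))))
  (near down (Close-sym (Close-suc cl)))
  where
  n≢1+n : ∀ {n} → n ≢ suc n
  n≢1+n ()

topPlug₁ : ∀ {W} → Plug (rect (suc W) 1 0 1) (W , 0) (W , 1)
topPlug₁ = plug (near up same) single (near down up)

bottomPlug₁ : ∀ {W b i} → Close i b → Close b (suc i) → Plug (rect (suc W) 1 b 1) (W , i) (W , suc i)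
bottomPlug₁ p q = plug (near up p) single (near down q)

corner-right : ∀ {W H t} → Inside (suc W) (2 + H) t → t ≢ (suc W , 2 + H) →
               Grid (suc W) (2 + H) (suc W , 2 + H) t (((suc W , 0) , (suc W , 1)) ∷ [])
corner-right it ne = rightPath (inside ≤-refl ≤-refl) it (ne ∘ sym) (λ ())
  (λ _ _ → (λ _ → inj₂ refl) , (λ ()) , (λ _ ())) (∉pair (λ ()) (λ ()))

unflip : ∀ {W H s t} → s ᵧ ≤ H → t ᵧ ≤ H → Grid W H (s ₓ , H ∸ s ᵧ) (t ₓ , H ∸ t ᵧ) (((W , 0) , (W , 1)) ∷ []) →
         Grid W H s t (((W , H ∸ 1) , (W , H)) ∷ [])
unflip {W} {H} {s} {t} p q P = subst₂ (λ y y′ → Grid W H (s ₓ , y) (t ₓ , y′) (((W , H ∸ 1) , (W , H)) ∷ []))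
  (m∸[m∸n]≡n p) (m∸[m∸n]≡n q) (keep (λ { (e ∷ []) → Edge-sym e ∷ [] }) (flipV P))

-- The body is entered at the first cell of its last column, or at the second if `t` is the first.
-- The last right edge is secured for the bottom arm.
body-path : ∀ {W H t} → Inside (suc W) (2 + H) t →
            ∃ λ r → r ≤ 1 × Grid (suc W) (2 + H) (suc W , r) t (((suc W , 1 + H) , (suc W , 2 + H)) ∷ [])
body-path {W} {H} {t} it with t ≟ᵖ (suc W , 0)
... | yes refl = 1 , ≤-refl , unflip (s≤s z≤n) z≤n
  (rev (corner-right {t = suc W , 1 + H} (inside ≤-refl (n≤1+n _)) (λ ())))
... | no ne = 0 , z≤n , unflip z≤n (Inside.≤H it)
  (corner-right (inside (Inside.≤W it) (m∸n≤m _ (t ᵧ))) (λ e → ne (cong₂ _,_ (cong proj₁ e)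
    (trans (sym (m∸[m∸n]≡n (Inside.≤H it))) (trans (cong (2 + H ∸_) (cong proj₂ e)) (n∸n≡0 (2 + H)))))))

TBD : ∀ {W h k c l d} → d + (c + l) ≡ h →
      (rect (suc W) k 0 c ∪ rect 0 (suc W) 0 h) ∪ rect (suc W) k (c + l) d ≈ C (suc W) k c l d
TBD refl = solve 3 (λ t b d → (t ⊕ b) ⊕ d ⊜ b ⊕ (t ⊕ d)) ≈-refl _ _ _

pathTB : ∀ {W H k c l d s t} → d + (c + l) ≡ 3 + H → Exit k c s → Inside (suc W) (2 + H) t →
         Plug (rect (2 + W) k (c + l) d) (suc W , 1 + H) (suc W , 2 + H) →
         Path (C (2 + W) k c l d) (s ₓ + (2 + W) , s ᵧ) t []
pathTB {W} eq (r , r≤ , X) it D with body-path it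
... | r′ , r′≤ , P = resp (TBD eq)
  (plugIn (keep (λ { (_ ∷ e ∷ []) → e ∷ [] }) (shiftX (2 + W) X ⟨ near down (close-≤1 r≤ r′≤) ⟩ P)) D [])

unflip-exit : ∀ {k d x y} → y ≤ d → Exit k (suc d) (x , d ∸ y) → ∃ λ r → r ≤ 1 × Path (rect 0 k 0 (suc d)) (0 , d ∸ r) (x , y) []
unflip-exit {k} {d} {x} {y} p (r , r≤ , P) = r , r≤ , subst (λ z → Path (rect 0 k 0 (suc d)) (0 , d ∸ r) (x , z) []) (m∸[m∸n]≡n p)
  (rev (flipY (suc d) (+-identityʳ (suc d)) P))

-- Between the arms the body is traversed from its upper right to its lower right corner. The bottom
-- arm is a reflected top arm, whence the ordinate `d ∸ y`.
pathTD : ∀ {W k c l d s x y} → 2 ≤ d + (c + l) → y ≤ d → Exit k c s → Exit k (suc d) (x , d ∸ y) →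
         Path (C (2 + W) k c l (suc d)) (s ₓ + (2 + W) , s ᵧ) (x + (2 + W) , y + (c + l)) []
pathTD {W} {k} {c} {l} {d} {s} p y≤ (r , r≤ , X) Y with unflip-exit y≤ Y | m≤n⇒∃[o]m+o≡n p
... | r′ , r′≤ , Y′ | H , eq = forget (resp (TBD {W = suc W} refl)
  (keep (λ _ → []) (resp ∪-assoc
    (shiftX (2 + W) X ⟨ near down (close-≤1 r≤ z≤n) ⟩ body ⟨ near up (close (≤-trans (+-monoˡ-≤ (c + l) (lem d r′≤)) ≤-refl)
        (≤-trans (+-monoˡ-≤ (c + l) (m∸n≤m d r′)) (n≤1+n _))) ⟩ shiftY (c + l) (shiftX (2 + W) Y′)))))
  where
  ∪-assoc : ∀ {R S T} → R ∪ S ∪ T ≈ (R ∪ S) ∪ T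
  ∪-assoc = solve 3 (λ a b c → a ⊕ b ⊕ c ⊜ (a ⊕ b) ⊕ c) ≈-refl _ _ _
  lem : ∀ d {r} → r ≤ 1 → d ≤ suc (d ∸ r)
  lem d z≤n = n≤1+n d
  lem zero (s≤s z≤n) = z≤n
  lem (suc d) (s≤s z≤n) = ≤-refl
  body : Path (rect 0 (2 + W) 0 (suc d + (c + l))) (suc W , 0) (suc W , d + (c + l)) []
  body = subst (λ z → Path (rect 0 (2 + W) 0 (suc z)) (suc W , 0) (suc W , z) []) eq
    (anyPath (inside ≤-refl z≤n) (inside ≤-refl ≤-refl) (λ ()) (λ ()) (λ _ ()))

move : ∀ (f : ℕ → Point × Point) {z z′ ps} → z ≡ z′ → Edge (f z) ps → Edge (f z′) ps
move f refl e = e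

leftPath : ∀ {W H s t} → Inside (suc W) (suc H) s → Inside (suc W) (suc H) t → s ≢ t →
           (W ≡ 0 → SameRow s t → s ᵧ ≡ 0 ⊎ s ᵧ ≡ suc H) → (H ≡ 0 → SameColumn s t → s ₓ ≡ suc W) →
           ∃ λ k → k < suc H × Grid (suc W) (suc H) s t (((0 , k) , (0 , suc k)) ∷ [])
leftPath {W} {H} {s} {t} is it ne r c with bottomPath {H} {W} {s ᵧ , suc W ∸ s ₓ} {t ᵧ , suc W ∸ t ₓ}
    (inside (Inside.≤H is) (m∸n≤m _ (s ₓ))) (inside (Inside.≤H it) (m∸n≤m _ (t ₓ)))
    (λ e → ne (cong₂ _,_ (∸-injective (Inside.≤W is) (Inside.≤W it) (cong proj₂ e)) (cong proj₁ e))) r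
    (λ e e′ → trans (cong (suc W ∸_) (c e (∸-injective (Inside.≤W is) (Inside.≤W it) e′))) (n∸n≡0 (suc W)))
  where
  ∸-injective : ∀ {n x y} → x ≤ n → y ≤ n → n ∸ x ≡ n ∸ y → x ≡ y
  ∸-injective {n} p q e = trans (sym (m∸[m∸n]≡n p)) (trans (cong (n ∸_) e) (m∸[m∸n]≡n q))
... | k , k< , P = k , k< , subst₂ (λ x x′ → Grid (suc W) (suc H) (x , s ᵧ) (x′ , t ᵧ) (((0 , k) , (0 , suc k)) ∷ []))
  (m∸[m∸n]≡n (Inside.≤W is)) (m∸[m∸n]≡n (Inside.≤W it))
  (keep (λ { (e ∷ []) → move (λ z → (z , k) , (z , suc k)) (n∸n≡0 (suc W)) e ∷ [] }) (transpose (flipV P)))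

bodyPath₂ : ∀ {W H s t} → 3 ≤ H → Inside (suc W) (suc H) s → Inside (suc W) (suc H) t → s ≢ t →
            (W ≡ 0 → SameRow s t → s ᵧ ≡ 0 ⊎ s ᵧ ≡ suc H) →
            ∃₂ λ k k′ → k ≤ 1 × k < k′ × Close k′ H ×
            Grid (suc W) (suc H) s t (((suc W , k) , (suc W , suc k)) ∷ ((suc W , k′) , (suc W , suc k′)) ∷ [])
bodyPath₂ {W} {H} 3≤H is it ne c with m≤n⇒∃[o]m+o≡n 3≤H
... | h , refl with twoRightPath₂ is it ne c
...   | k , k′ , k< , k′< , <k′ , P = k , k′ , s≤s⁻¹ k< , ≤-trans k< (≤-trans (m≤m+n 2 h) <k′) , close (≤-trans (s≤s⁻¹ k′<) (n≤1+n _)) (s≤s <k′) , P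

Differ-below : ∀ {x k k′} → k < k′ → Differ ((x , k′) , (x , suc k′)) ((x , k) , (x , suc k))
Differ-below p = snd (≢-by proj₂ (<⇒≢ (≤-trans p (n≤1+n _)) ∘ sym)) (≢-by proj₂ (<⇒≢ (s≤s p) ∘ sym))

3≤body : ∀ {l} c d → 1 ≤ l → 3 ≤ d + (2 + c + l)
3≤body c d l≥1 = ≤-trans (s≤s (s≤s (≤-trans l≥1 (m≤n+m _ c)))) (m≤n+m _ d)

pathBB : ∀ {W K c l d s t} → 1 ≤ l → Inside (suc W) (suc (d + (2 + c + l))) s → Inside (suc W) (suc (d + (2 + c + l))) t →
         s ≢ t → (W ≡ 0 → SameRow s t → s ᵧ ≡ 0 ⊎ s ᵧ ≡ suc (d + (2 + c + l))) →
         Path (C (2 + W) (2 + K) (2 + c) l (2 + d)) s t []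
pathBB {c = c} {l} {d} l≥1 is it ne r with bodyPath₂ (3≤body c d l≥1) is it ne r
... | k , k′ , k≤ , k<k′ , cl , P = resp (solve 3 (λ b t d → (b ⊕ t) ⊕ d ⊜ b ⊕ (t ⊕ d)) ≈-refl _ _ _)
  (plugIn (plugIn P (topPlug k≤) (Differ-below k<k′ ∷ [])) (bottomPlug cl) [])

module _ {W K c l d : ℕ} (l≥1 : 1 ≤ l) where

  -- A tour of the body between two consecutive cells of its last column, which replaces the edge
  -- `j` of the left side of the top arm. The edge at `k′` remains for the bottom arm.
  Back : ℕ → Set
  Back j = ∃ λ k′ → Close k′ (d + (2 + c + l)) × Grid (suc W) (suc (d + (2 + c + l))) (suc W , j) (suc W , suc j)
             (((suc W , k′) , (suc W , suc k′)) ∷ [])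

  back : ∀ {j} → j < suc (d + (2 + c + l)) → Back j
  back p with bodyPath₂ (3≤body c d l≥1) (inside ≤-refl (<⇒≤ p)) (inside ≤-refl p) (λ ()) (λ _ ())
  ... | k , k′ , _ , _ , cl , P = k′ , cl , keep (λ { (_ ∷ e ∷ []) → e ∷ [] }) P

  pathTT : ∀ {s t j} → j < suc c → Path (rect 0 (2 + K) 0 (2 + c)) s t (((0 , j) , (0 , suc j)) ∷ []) →
           Path (C (2 + W) (2 + K) (2 + c) l (2 + d)) (s ₓ + (2 + W) , s ᵧ) (t ₓ + (2 + W) , t ᵧ) []
  pathTT {j = j} j< P with back (≤-trans j< (s≤s (≤-trans (≤-trans (n≤1+n _) (n≤1+n _)) (≤-trans (m≤m+n _ l) (m≤n+m _ d)))))
  ... | k′ , cl , Q = resp (TBD {W = suc W} refl)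
    (plugIn (keep (λ { (_ ∷ _ ∷ e ∷ []) → e ∷ [] }) (insert (shiftX (2 + W) P) (near down same) Q (near up same) [])) (bottomPlug cl) [])

rows-split : ∀ y e {x w} → rect x w 0 (suc y) ∪ rect x w (suc y) 1 ∪ rect x w (2 + y) (suc e) ≈ rect x w 0 (3 + y + e)
rows-split y e = ∪-cong ≈-refl (≈-sym splitY₁) ⨾ ≈-sym (splitY (suc y)) ⨾
  height (trans (+-suc (suc y) (suc e)) (cong (2 +_) (+-suc y e)))

-- The ends are the two cells of a row of an arm of width two: the rows below are covered from one of them, the
-- rows above from the other.
pathTT′ : ∀ {W y e l d} → 1 ≤ l → Path (C (2 + W) 2 (3 + y + e) l (2 + d)) (2 + W , suc y) (3 + W , suc y) []
pathTT′ {W} {y} {e} {l} {d} l≥1 with back {W} {0} {suc (y + e)} {l} {d} l≥1 {suc y}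
  (s≤s (≤-trans (s≤s (≤-trans (m≤m+n y e) (≤-trans (n≤1+n _) (≤-trans (n≤1+n _) (m≤m+n _ l))))) (m≤n+m _ d)))
... | k′ , cl , Q = resp (solve 6 (λ s lo b up t d → (s ⊕ lo ⊕ b ⊕ up ⊕ t) ⊕ d ⊜ ((up ⊕ (s ⊕ t) ⊕ lo) ⊕ b) ⊕ d) ≈-refl _ _ _ _ _ _ ⨾
      ∪-cong (∪-cong (∪-cong ≈-refl (∪-cong (≈-sym splitX₁) ≈-refl) ⨾ rows-split y e) ≈-refl) ≈-refl ⨾ TBD {W = suc W} refl)
  (plugIn (keep (λ { (_ ∷ _ ∷ _ ∷ _ ∷ x ∷ _) → x ∷ [] })
    (single ⟨ near up up ⟩ shiftX (2 + W) (shiftY (2 + y) (rev (transpose (rightTurn e)))) ⟨ near down same ⟩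
     rev Q ⟨ near up down ⟩ shiftX (2 + W) (transpose (leftTurn y)) ⟨ near same up ⟩ single)) (bottomPlug cl) [])

-- The same for the body: the rows above and the top arm are covered from one end, the rest from the other.
pathBB′ : ∀ {y e K l d} → 1 ≤ l → Path (C 2 (2 + K) (2 + y + e) l (2 + d)) (0 , suc y) (1 , suc y) []
pathBB′ {y} {e} {K} {l} {d} l≥1 with m≤n⇒∃[o]m+o≡n l≥1
... | o , refl = resp (solve 6 (λ s up arm lo t d → (s ⊕ up ⊕ arm ⊕ lo ⊕ t) ⊕ d ⊜ (arm ⊕ up ⊕ (s ⊕ t) ⊕ lo) ⊕ d) ≈-refl _ _ _ _ _ _ ⨾
      ∪-cong (∪-cong ≈-refl (∪-cong ≈-refl (∪-cong (≈-sym splitX₁) ≈-refl) ⨾ rows-split y (suc q) ⨾ height total)) ≈-refl ⨾ TBD {W = 1} refl)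
  (plugIn (keep (λ { (_ ∷ _ ∷ _ ∷ _ ∷ _ ∷ _ ∷ _ ∷ _ ∷ _ ∷ x ∷ _) → move (λ z → (1 , z) , (1 , suc z)) lowest x ∷ [] })
    (single ⟨ near same down ⟩ transpose (leftTurn y) ⟨ near up same ⟩ arm ⟨ near down up ⟩
     shiftY (2 + y) (rev (transpose (rightTurn⁺ q))) ⟨ near up down ⟩ single)) (bottomPlug same) [])
  where
  open +-*-Solver using (_:=_; _:+_; con) renaming (solve to solveℕ)
  q = suc (e + o + d)
  arm : Path (rect 2 (2 + K) 0 (2 + y + e)) (2 , y) (2 , suc y) []
  arm = shiftX 2 (anyPath {K} {y + e} (inside z≤n (≤-trans (m≤m+n y e) (n≤1+n _))) (inside z≤n (s≤s (m≤m+n y e))) (λ ()) (λ _ _ → inj₁ refl) (λ _ ()))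
  total : 3 + y + suc q ≡ 2 + d + (2 + y + e + suc o)
  total = solveℕ 4 (λ y e o d → con 3 :+ (y :+ (con 2 :+ (e :+ o :+ d))) := con 2 :+ (d :+ (con 2 :+ (y :+ e :+ (con 1 :+ o))))) refl y e o d
  lowest : q + (2 + y) ≡ d + (2 + y + e + suc o)
  lowest = solveℕ 4 (λ y e o d → (con 1 :+ (e :+ o :+ d)) :+ (con 2 :+ y) := d :+ (con 2 :+ (y :+ e :+ (con 1 :+ o)))) refl y e o d

pathBB₁ : ∀ {W l s t} → 1 ≤ l → Inside (suc W) (1 + l) s → Inside (suc W) (1 + l) t → s ≢ t →
          (W ≡ 0 → Free₁ (1 + l) (swap s) (swap t)) → (1 ≤ W → Fine 1 1 (suc W) (1 + l) s t) →
          Path (C (2 + W) 1 1 l 1) s t []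
pathBB₁ {l = suc l} _ is it ne free fine = resp (solve 3 (λ b t d → (b ⊕ t) ⊕ d ⊜ b ⊕ (t ⊕ d)) ≈-refl _ _ _)
  (plugIn (plugIn (twoRightPath₁ is it ne free fine) topPlug₁ (snd (λ ()) (λ ()) ∷ []))
    (bottomPlug₁ up (close (n≤1+n _) (n≤1+n _))) [])

-- Arms of width one

bands₂ : ∀ W l d → (rect 0 (2 + W) 0 (1 + l) ∪ rect (2 + W) 1 0 1) ∪ rect 0 (3 + W) (1 + l) d ≈ C (2 + W) 1 1 l d
bands₂ W l d = ∪-cong ≈-refl (width (+-comm 1 (2 + W))) ⨾ two-bands (2 + W) 1 1 l d

bands₃ : ∀ W c l d → rect 0 (3 + W) 0 c ∪ rect 0 (2 + W) c l ∪ rect 0 (3 + W) (c + l) d ≈ C (2 + W) 1 c l d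
bands₃ W c l d = ∪-cong (width (+-comm 1 (2 + W))) (∪-cong ≈-refl (width (+-comm 1 (2 + W)))) ⨾ three-bands (2 + W) 1 c l d

rowPath : ∀ {W H k y} → k < 2 + W → y ≤ suc H → Path (rect 0 (3 + W) 0 (2 + H)) (k , y) (suc k , y) []
rowPath p q = anyPath (inside (<⇒≤ p) q) (inside p q) (λ ()) (λ _ ()) (λ ())

lowerPlug : ∀ {W d k y b} → k < 2 + W → Close y b → Plug (rect 0 (3 + W) b (2 + d)) (k , y) (suc k , y)
lowerPlug {b = b} p cl = plug (near same cl) (shiftY b (rowPath p z≤n)) (near same (Close-sym cl))

upperPlug : ∀ {W c k} → k < 2 + W → Plug (rect 0 (3 + W) 0 (2 + c)) (k , 2 + c) (suc k , 2 + c)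
upperPlug p = plug (near same down) (rowPath p ≤-refl) (near same up)

topExit : ∀ {W H s} → Inside (suc W) (suc H) s → ∃ λ r → r ≤ 1 × Path (rect 0 (2 + W) 0 (2 + H)) s (r , 0) []
topExit is with block-exit (Inside-swap is)
... | r , r≤ , P = r , r≤ , transpose P

bottomExit : ∀ {W H s} → Inside (suc W) (suc H) s → ∃ λ r → r ≤ 1 × Path (rect 0 (2 + W) 0 (2 + H)) s (r , suc H) []
bottomExit {W} {H} {s} is = let r , r≤ , P = topExit {W} {H} {s ₓ , suc H ∸ s ᵧ} (inside (Inside.≤W is) (m∸n≤m _ (s ᵧ))) in
  r , r≤ , subst (λ y → Path (rect 0 (2 + W) 0 (2 + H)) (s ₓ , y) (r , suc H) []) (m∸[m∸n]≡n (Inside.≤H is)) (flipV P)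

rightExit : ∀ {W H s} → Inside (suc W) (suc H) s → ∃ λ r → r ≤ 1 × Path (rect 0 (2 + W) 0 (2 + H)) s (suc W ∸ r , 0) []
rightExit {W} {H} {s} is = let r , r≤ , P = topExit {W} {H} {suc W ∸ s ₓ , s ᵧ} (inside (m∸n≤m _ (s ₓ)) (Inside.≤H is)) in
  r , r≤ , subst (λ x → Path (rect 0 (2 + W) 0 (2 + H)) (x , s ᵧ) (suc W ∸ r , 0) []) (m∸[m∸n]≡n (Inside.≤W is)) (flipH P)

module _ {W l d : ℕ} where

  private
    -- `V` is the one-cell arm, `U` the rows of the body down to the end of the gap, `L` the band
    -- below of full width, which has at least two rows and can be glued under an edge of `U`.
    U L : Region
    U = rect 0 (2 + W) 0 (2 + l)
    L = rect 0 (3 + W) (2 + l) (2 + d)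
    V = rect (2 + W) 1 0 1
    R = C (2 + W) 1 1 (suc l) (2 + d)

  pathVU : ∀ {t} → Inside (suc W) (suc l) t → Path R (2 + W , 0) t []
  pathVU {t} it with t ≟ᵖ (suc W , 0)
  ... | yes refl with bottomPath {W} {l} {suc W , 1} {suc W , 0} (inside ≤-refl (s≤s z≤n)) it (λ ()) (λ _ _ → inj₂ refl) (λ _ ())
  ...   | k , k< , P = resp (solve 3 (λ v u l → (v ⊕ u) ⊕ l ⊜ (u ⊕ v) ⊕ l) ≈-refl _ _ _ ⨾ bands₂ W (suc l) (2 + d))
    (plugIn (keep (λ { (_ ∷ b ∷ []) → b ∷ [] }) (single {2 + W} {0} ⟨ near down up ⟩ P)) (lowerPlug (≤-trans k< (n≤1+n _)) up) [])
  pathVU {t} it | no ne with bottomPath {W} {l} {suc W , 0} {t} (inside ≤-refl z≤n) it (ne ∘ sym) (λ _ _ → inj₂ refl) (λ _ _ → refl)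
  ...   | k , k< , P = resp (solve 3 (λ v u l → (v ⊕ u) ⊕ l ⊜ (u ⊕ v) ⊕ l) ≈-refl _ _ _ ⨾ bands₂ W (suc l) (2 + d))
    (plugIn (keep (λ { (_ ∷ b ∷ []) → b ∷ [] }) (single {2 + W} {0} ⟨ near down same ⟩ P)) (lowerPlug (≤-trans k< (n≤1+n _)) up) [])

  pathVL : ∀ {t} → Inside (2 + W) (suc d) t → Path R (2 + W , 0) (t ₓ , t ᵧ + (2 + l)) []
  pathVL it = let r , r≤ , Q = topExit it in resp (solve 3 (λ v u l → v ⊕ u ⊕ l ⊜ (u ⊕ v) ⊕ l) ≈-refl _ _ _ ⨾ bands₂ W (suc l) (2 + d)) (forget
    (single {2 + W} {0} ⟨ near down same ⟩
     anyPath {W} {l} {suc W , 0} {0 , suc l} (inside ≤-refl z≤n) (inside z≤n ≤-refl) (λ ()) (λ _ ()) (λ _ ())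
     ⟨ near (close-≤1 z≤n r≤) up ⟩ shiftY (2 + l) (rev Q)))

  pathUU : ∀ {s t} → Inside (suc W) (suc l) s → Inside (suc W) (suc l) t → s ≢ t →
           (1 ≤ W → l ≡ 0 → SameColumn s t → s ₓ ≡ 0) →
           (W ≡ 0 → (SameRow s t → s ᵧ ≡ 0) × Unblocked (swap s) (swap t)) →
           ¬ SameSet s t (suc W , 0) (suc W , 1) → Path R s t []
  pathUU is it ne p q r with rightBottomPath is it ne p q r
  ... | k , k< , P = resp (bands₂ W (suc l) (2 + d))
    (plugIn (plugIn P topPlug₁ (fst (≢-by proj₁ (<⇒≢ k<)) (≢-by proj₁ (<⇒≢ k<)) ∷ [])) (lowerPlug (≤-trans k< (n≤1+n _)) up) [])

  pathUL : ∀ {s t} → Inside (suc W) (suc l) s → Inside (2 + W) (suc d) t → Path R s (t ₓ , t ᵧ + (2 + l)) []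
  pathUL {s} {t} is it = case s ≟ᵖ (0 , suc l) of λ
    { (yes refl) → finish (s≤s z≤n) (rightPath is (inside (s≤s z≤n) ≤-refl) (λ ()) (λ _ ())
      (λ _ l≥ → (λ _ → inj₂ refl) , (λ ()) , (λ ())) (∉pair (λ ()) (λ ())))
    ; (no ne) → finish z≤n (rightPath is (inside z≤n ≤-refl) ne (λ _ e → e)
      (λ _ l≥ → inj₂ , (λ _ e → ⊥-elim (<⇒≢ (s≤s l≥) (sym e))) , (λ ())) (∉pair (λ ()) (λ ()) ∘ SameSet-swap)) }
    where
    finish : ∀ {x} → x ≤ 1 → Grid (suc W) (suc l) s (x , suc l) (((suc W , 0) , (suc W , 1)) ∷ []) → Path R s (t ₓ , t ᵧ + (2 + l)) []
    finish x≤ P = let r , r≤ , Q = topExit it in resp (bands₂ W (suc l) (2 + d)) (forget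
      (plugIn P topPlug₁ [] ⟨ near (close-≤1 x≤ r≤) up ⟩ shiftY (2 + l) (rev Q)))

-- Turned upside down, this is what gets glued under the top band when the bottom arm is one cell.
above : ∀ {W l k} → k < suc W → Path (rect 0 (2 + W) 0 (2 + l) ∪ rect (2 + W) 1 0 1) (k , suc l) (suc k , suc l) []
above {W} {l} {k} p = plugIn (rightPath {W} {l} (inside (<⇒≤ p) ≤-refl) (inside p ≤-refl) (λ ()) (λ _ ())
  (λ _ l≥ → (λ _ → inj₂ refl) , (λ ()) , (λ ())) (∉pair (≢-by proj₁ (<⇒≢ p)) (≢-by proj₁ (<⇒≢ p)))) topPlug₁ []

below : ∀ {W c l d k} → 1 ≤ l → k < suc W → Path (rect 0 (2 + W) c l ∪ rect 0 (3 + W) (c + l) (2 + d)) (k , c) (suc k , c) []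
below {W} {c} {suc (suc l)} {d} {k} l≥1 p with bottomPath {W} {l} {k , 0} {suc k , 0} (inside (<⇒≤ p) z≤n) (inside p z≤n) (λ ()) (λ _ ()) (λ _ _ → refl)
... | k′ , k′< , P = plugIn (shiftY c P) (lowerPlug (≤-trans k′< (n≤1+n _)) (subst (Close (suc l + c)) (+-comm (2 + l) c) up)) []
-- A gap of one row leaves a single line: it is followed to its left end, the lower band is crossed
-- from left to right, and the other piece of the line leads back to column `suc k`.
below {W} {c} {suc zero} {d} {k} l≥1 p with m≤n⇒∃[o]m+o≡n (s≤s⁻¹ p)
... | o , refl = forget (resp (solve 3 (λ a b e → a ⊕ b ⊕ e ⊜ (a ⊕ e) ⊕ b) ≈-refl _ _ _ ⨾ ∪-cong (≈-sym (splitX (suc k)) ⨾ width (cong suc (+-suc k o))) ≈-refl)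
  (rev (lineX k) ⟨ near same cl ⟩ shiftY (c + 1) bottom ⟨ near down (Close-sym cl) ⟩ rev (lineX o)))
  where
  cl : Close c (c + 1)
  cl = subst (Close c) (+-comm 1 c) up
  bottom : Path (rect 0 (3 + (k + o)) 0 (2 + d)) (0 , 0) (2 + (k + o) , 0) []
  bottom = anyPath (inside z≤n z≤n) (inside ≤-refl z≤n) (λ ()) (λ _ ()) (λ ())

-- The ends fill an inner column of a two-row strip. The pieces on its two sides are connected only
-- through the region `O` below.
stripPath : ∀ {p q O} → Path O (suc p , 2) (p , 2) [] →
            Path (rect 0 (3 + (p + q)) 0 2 ∪ O) (suc p , 0) (suc p , 1) (((2 + (p + q) , 0) , (2 + (p + q) , 1)) ∷ [])
stripPath {p} {q} P = keep (λ { (_ ∷ _ ∷ e ∷ _) → e′ e ∷ [] })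
  (resp (solve 5 (λ s r o l t → s ⊕ r ⊕ o ⊕ l ⊕ t ⊜ (l ⊕ (s ⊕ t) ⊕ r) ⊕ o) ≈-refl _ _ _ _ _ ⨾
      ∪-cong (∪-cong ≈-refl (∪-cong (≈-sym splitY₁) ≈-refl ⨾ ≈-sym splitX₁) ⨾ ≈-sym (splitX (suc p)) ⨾ width (trans (+-suc (suc p) (suc q)) (cong (2 +_) (+-suc p q)))) ≈-refl)
    (single ⟨ near up same ⟩ shiftX (2 + p) (rightTurn q) ⟨ near down up ⟩ P ⟨ near same down ⟩ rev (leftTurn p) ⟨ near up up ⟩ single))
  where
  e′ : ∀ {ps} → Edge ((q + (2 + p) , 0) , (q + (2 + p) , 1)) ps → Edge ((2 + (p + q) , 0) , (2 + (p + q) , 1)) ps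
  e′ {ps} = subst (λ z → Edge ((z , 0) , (z , 1)) ps) (+-comm q (2 + p))

module _ {W c l d : ℕ} {O : Region} (split : rect 0 (3 + W) 0 (2 + c) ∪ O ≈ C (2 + W) 1 (2 + c) l d)
         (inO : ∀ {k} → k < suc W → Path O (k , 2 + c) (suc k , 2 + c) []) where

  pathTop : ∀ {s t} → Inside (2 + W) (suc c) s → Inside (2 + W) (suc c) t → s ≢ t →
            (c ≡ 0 → SameColumn s t → s ₓ ≡ 0 ⊎ s ₓ ≡ 2 + W) → Path (C (2 + W) 1 (2 + c) l d) s t []
  pathTop is it ne e with bottomPath is it ne e (λ ())
  ... | k , k< , P with m≤n⇒m<n∨m≡n k<
  ...   | inj₁ (s≤s k<′) = resp split (plugIn P (plug (near same up) (inO k<′) (near same down)) [])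
  -- The right cell of the last edge lies over the gap, and its only neighbour below is diagonal. So
  -- both connections are shifted one column to the left.
  ...   | inj₂ refl      = resp split (plugIn P (plug (near down up) (inO ≤-refl) (near up down)) [])

pathTop₂ : ∀ {W l d O x} → rect 0 (3 + W) 0 2 ∪ O ≈ C (2 + W) 1 2 l d →
           (∀ {k} → k < suc W → Path O (k , 2) (suc k , 2) []) → x < suc W → Path (C (2 + W) 1 2 l d) (suc x , 0) (suc x , 1) []
pathTop₂ {x = x} split inO p with m≤n⇒∃[o]m+o≡n (s≤s⁻¹ p)
... | o , refl = forget (resp split (stripPath (rev (inO p))))

pathUU₂ : ∀ {W d x} → x < W → Path (C (2 + W) 1 1 1 (2 + d)) (suc x , 0) (suc x , 1) []
pathUU₂ {suc W} {d} {x} p with m≤n⇒∃[o]m+o≡n (s≤s⁻¹ p)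
... | o , refl = resp (solve 3 (λ u l v → (u ⊕ l) ⊕ v ⊜ (u ⊕ v) ⊕ l) ≈-refl _ _ _ ⨾ bands₂ (suc (x + o)) 1 (2 + d))
  (plugIn (stripPath {x} {o} (shiftY 2 (rev (rowPath {suc (x + o)} (≤-trans p (s≤s (≤-trans (n≤1+n _) (n≤1+n _)))) z≤n)))) topPlug₁ [])

∪-assoc : ∀ {R S T} → (R ∪ S) ∪ T ≈ R ∪ S ∪ T
∪-assoc = solve 3 (λ a b c → (a ⊕ b) ⊕ c ⊜ a ⊕ b ⊕ c) ≈-refl _ _ _

seam : ∀ c l → Close (l + c) (c + suc l)
seam c l = subst (Close (l + c)) (+-comm (suc l) c) up

module _ {W c d : ℕ} where

  private
    R : ℕ → Region
    R l = C (2 + W) 1 (2 + c) l (2 + d)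

  pathTopMid : ∀ {l s t} → Inside (2 + W) (suc c) s → Inside (suc W) (suc l) t → Path (R (2 + l)) s (t ₓ , t ᵧ + (2 + c)) []
  pathTopMid {l} {s} {t} is it = case t ≟ᵖ (0 , 0) of λ
    { (yes refl) → finish ≤-refl (bottomPath {W} {l} {1 , 0} (inside (s≤s z≤n) z≤n) it (λ ()) (λ _ ()) (λ _ _ → refl))
    ; (no ne)    → finish z≤n (bottomPath {W} {l} {0 , 0} (inside z≤n z≤n) it (ne ∘ sym) (λ _ _ → inj₁ refl) (λ _ _ → refl)) }
    where
    finish : ∀ {x} → x ≤ 1 → (∃ λ k → k < suc W × Grid (suc W) (suc l) (x , 0) t (((k , suc l) , (suc k , suc l)) ∷ [])) →
             Path (R (2 + l)) s (t ₓ , t ᵧ + (2 + c)) []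
    finish x≤ (k , k< , P) = let r , r≤ , Q = bottomExit is in resp (∪-assoc ⨾ bands₃ W (2 + c) (2 + l) (2 + d))
      (plugIn (keep (λ { (_ ∷ e ∷ []) → e ∷ [] }) (forget Q ⟨ near (close-≤1 r≤ x≤) up ⟩ shiftY (2 + c) P))
        (lowerPlug (≤-trans k< (n≤1+n _)) (seam (2 + c) (suc l))) [])

  -- In a line of one row the end `t` separates two pieces: the piece not containing `t` comes
  -- before the lower band, the other one is run backwards from the far side until `t`.
  pathTopMid₁ : ∀ {s x} → Inside (2 + W) (suc c) s → x ≤ suc W → Path (R 1) s (x , 2 + c) []
  pathTopMid₁ {s} {zero} is p = let r , r≤ , Q = bottomExit is in forget (resp (solve 4 (λ q m b e → q ⊕ m ⊕ b ⊕ e ⊜ q ⊕ (e ⊕ m) ⊕ b) ≈-refl _ _ _ _ ⨾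
      ∪-cong ≈-refl (∪-cong (≈-sym splitX₁) ≈-refl) ⨾ bands₃ W (2 + c) 1 (2 + d))
    (Q ⟨ near (close-≤1 r≤ ≤-refl) up ⟩ lineX W ⟨ near up (seam (2 + c) 0) ⟩
     shiftY (2 + c + 1) bottom ⟨ near same (Close-sym (seam (2 + c) 0)) ⟩ single))
    where
    bottom : Path (rect 0 (3 + W) 0 (2 + d)) (2 + W , 0) (0 , 0) []
    bottom = anyPath (inside ≤-refl z≤n) (inside z≤n z≤n) (λ ()) (λ _ ()) (λ ())
  pathTopMid₁ {s} {suc x} is p with m≤n⇒∃[o]m+o≡n (s≤s⁻¹ p)
  ... | o , refl = let r , r≤ , Q = bottomExit is in forget (resp (solve 4 (λ q m b e → q ⊕ m ⊕ b ⊕ e ⊜ q ⊕ (m ⊕ e) ⊕ b) ≈-refl _ _ _ _ ⨾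
      ∪-cong ≈-refl (∪-cong (≈-sym (splitX (suc x)) ⨾ width (cong suc (+-suc x o))) ≈-refl) ⨾ bands₃ (x + o) (2 + c) 1 (2 + d))
    (Q ⟨ near (close-≤1 r≤ z≤n) up ⟩ lineX x ⟨ near same (seam (2 + c) 0) ⟩
     shiftY (2 + c + 1) bottom ⟨ near down (Close-sym (seam (2 + c) 0)) ⟩ rev (lineX o)))
    where
    bottom : Path (rect 0 (3 + (x + o)) 0 (2 + d)) (x , 0) (2 + (x + o) , 0) []
    bottom = anyPath (inside (≤-trans (m≤m+n x o) (m≤n+m _ 2)) z≤n) (inside ≤-refl z≤n)
      (≢-by proj₁ (<⇒≢ (s≤s (≤-trans (m≤m+n x o) (n≤1+n _))))) (λ _ e → ⊥-elim (<⇒≢ (s≤s (≤-trans (m≤m+n x o) (n≤1+n _))) e)) (λ ())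

  pathTopBottom : ∀ {l s t} → 1 ≤ l → Inside (2 + W) (suc c) s → Inside (2 + W) (suc d) t →
                  Path (R l) s (t ₓ , t ᵧ + (2 + c + l)) []
  pathTopBottom {suc l} {s} {t} _ is it = let r , r≤ , P = bottomExit is ; r′ , r′≤ , Q = rightExit it in forget (resp (bands₃ W (2 + c) (suc l) (2 + d))
    (P ⟨ near (close-≤1 r≤ z≤n) up ⟩ shiftY (2 + c) (middle l) ⟨ near (close (∸-bound r′≤) (m∸n≤m (2 + W) r′)) (seam (2 + c) l) ⟩
     shiftY (2 + c + suc l) (rev Q)))
    where
    ∸-bound : ∀ {r} → r ≤ 1 → suc W ≤ suc (2 + W ∸ r)
    ∸-bound z≤n = m≤n+m _ 2
    ∸-bound (s≤s z≤n) = n≤1+n _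
    middle : ∀ l → Path (rect 0 (2 + W) 0 (suc l)) (0 , 0) (suc W , l) []
    middle zero    = lineX (suc W)
    middle (suc l) = anyPath (inside z≤n z≤n) (inside ≤-refl ≤-refl) (λ ()) (λ _ ()) (λ _ ())

  pathMidMid : ∀ {l s t} → Inside (suc W) (suc l) s → Inside (suc W) (suc l) t → s ≢ t →
               (l ≡ 0 → SameColumn s t → s ₓ ≡ 0 ⊎ s ₓ ≡ suc W) → (W ≡ 0 → ¬ SameRow s t) →
               Path (R (2 + l)) (s ₓ , s ᵧ + (2 + c)) (t ₓ , t ᵧ + (2 + c)) []
  pathMidMid {l} is it ne p q with topBottomPath is it ne p q
  ... | k , k′ , k< , k′< , P = resp (solve 3 (λ m t b → (m ⊕ t) ⊕ b ⊜ t ⊕ m ⊕ b) ≈-refl _ _ _ ⨾ bands₃ W (2 + c) (2 + l) (2 + d))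
    (plugIn (plugIn (shiftY (2 + c) P) (upperPlug (≤-trans k< (n≤1+n _))) (snd off off ∷ []))
      (lowerPlug (≤-trans k′< (n≤1+n _)) (seam (2 + c) (suc l))) [])
    where
    off : ∀ {x x′} → (x , suc l + (2 + c)) ≢ (x′ , 2 + c)
    off e = m≢1+n+m (2 + c) (sym (cong proj₂ e))

  -- The column filled by the ends separates the two rows beside the gap; the left piece is reached
  -- through the top band, the right piece through the bottom band.
  pathMidMid₂ : ∀ {x} → x < W → Path (R 2) (suc x , 2 + c) (suc x , 3 + c) []
  pathMidMid₂ {x} p with m≤n⇒∃[o]m+o≡n p
  ... | o , refl = forget (resp (solve 6 (λ s u l b r t → s ⊕ u ⊕ l ⊕ b ⊕ r ⊕ t ⊜ u ⊕ (l ⊕ (s ⊕ t) ⊕ r) ⊕ b) ≈-refl _ _ _ _ _ _ ⨾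
      ∪-cong ≈-refl (∪-cong (∪-cong ≈-refl (∪-cong (≈-sym splitY₁) ≈-refl ⨾ ≈-sym splitX₁) ⨾ ≈-sym (splitX (suc x)) ⨾
        width (trans (+-suc (suc x) (suc o)) (cong (2 +_) (+-suc x o)))) ≈-refl) ⨾
      bands₃ (suc (x + o)) (2 + c) 2 (2 + d))
    (single ⟨ near same down ⟩ rev (rowPath (≤-trans x< (n≤1+n _)) ≤-refl) ⟨ near same up ⟩ shiftY (2 + c) (leftTurn x) ⟨ near up (seam (2 + c) 1) ⟩
     shiftY (2 + c + 2) (rowPath (s≤s x<) z≤n) ⟨ near same (Close-sym (seam (2 + c) 1)) ⟩
     shiftY (2 + c) (shiftX (2 + x) (rev (rightTurn o))) ⟨ near down up ⟩ single))
    where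
    x< : x < 2 + (x + o)
    x< = s≤s (≤-trans (m≤m+n x o) (n≤1+n _))

mid-between : ∀ {x m q c d} → Path (C (3 + (x + m + q)) 1 (2 + c) 1 (2 + d)) (x , 2 + c) (2 + x + m , 2 + c) []
mid-between {x} {m} {q} {c} {d} = forget (resp (solve 5 (λ l u m b r → l ⊕ u ⊕ m ⊕ b ⊕ r ⊜ u ⊕ (l ⊕ m ⊕ r) ⊕ b) ≈-refl _ _ _ _ _ ⨾
    ∪-cong ≈-refl (∪-cong (∪-cong ≈-refl (subst (λ z → rect (suc x) (suc m) (2 + c) 1 ∪ rect z (suc q) (2 + c) 1 ≈ rect (suc x) (suc m + suc q) (2 + c) 1)
      (+-suc (suc x) m) (≈-sym (splitX (suc m)))) ⨾ ≈-sym (splitX (suc x)) ⨾ width total) ≈-refl) ⨾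
    bands₃ (suc (x + m + q)) (2 + c) 1 (2 + d))
  (rev (lineX x) ⟨ near same down ⟩ top ⟨ near same up ⟩ lineX m ⟨ near same (seam (2 + c) 0) ⟩ shiftY (2 + c + 1) bottom
   ⟨ near down (Close-sym (seam (2 + c) 0)) ⟩ rev (lineX q)))
  where
  open +-*-Solver using (_:=_; _:+_; con) renaming (solve to solveℕ)
  total : suc x + (suc m + suc q) ≡ 3 + (x + m + q)
  total = solveℕ 3 (λ x m q → con 1 :+ x :+ (con 1 :+ m :+ (con 1 :+ q)) := con 3 :+ (x :+ m :+ q)) refl x m q
  x+m< : suc x + m < 2 + suc (x + m + q)
  x+m< = s≤s (s≤s (≤-trans (m≤m+n (x + m) q) (n≤1+n _)))
  top : Path (rect 0 (3 + suc (x + m + q)) 0 (2 + c)) (0 , suc c) (suc x , suc c) []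
  top = anyPath (inside z≤n ≤-refl) (inside (≤-trans (m≤m+n (suc x) m) (<⇒≤ x+m<)) ≤-refl) (λ ()) (λ _ ()) (λ ())
  bottom : Path (rect 0 (3 + suc (x + m + q)) 0 (2 + d)) (suc x + m , 0) (2 + suc (x + m + q) , 0) []
  bottom = anyPath (inside (<⇒≤ x+m<) z≤n) (inside ≤-refl z≤n) (≢-by proj₁ (<⇒≢ x+m<)) (λ _ e → ⊥-elim (<⇒≢ x+m< e)) (λ ())

mid-right : ∀ {x q c d} → Path (C (3 + (x + q)) 1 (2 + c) 1 (2 + d)) (x , 2 + c) (suc x , 2 + c) []
mid-right {x} {q} {c} {d} = forget (resp (solve 5 (λ l u r b t → l ⊕ u ⊕ r ⊕ b ⊕ t ⊜ u ⊕ (l ⊕ t ⊕ r) ⊕ b) ≈-refl _ _ _ _ _ ⨾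
    ∪-cong ≈-refl (∪-cong (∪-cong ≈-refl (≈-sym splitX₁) ⨾ ≈-sym (splitX (suc x)) ⨾ width (trans (+-suc (suc x) (suc q)) (cong (2 +_) (+-suc x q)))) ≈-refl) ⨾
    bands₃ (suc (x + q)) (2 + c) 1 (2 + d))
  (rev (lineX x) ⟨ near same down ⟩ top ⟨ near down up ⟩ rev (lineX q) ⟨ near same (seam (2 + c) 0) ⟩ shiftY (2 + c + 1) bottom
   ⟨ near same (Close-sym (seam (2 + c) 0)) ⟩ single))
  where
  top : Path (rect 0 (3 + suc (x + q)) 0 (2 + c)) (0 , suc c) (2 + suc (x + q) , suc c) []
  top = anyPath (inside z≤n ≤-refl) (inside ≤-refl ≤-refl) (λ ()) (λ _ ()) (λ ())
  bottom : Path (rect 0 (3 + suc (x + q)) 0 (2 + d)) (2 + x , 0) (suc x , 0) []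
  bottom = rev (rowPath (s≤s (s≤s (≤-trans (m≤m+n x q) (n≤1+n _)))) z≤n)

mid-left : ∀ {p c d} → Path (C (3 + p) 1 (2 + c) 1 (2 + d)) (suc p , 2 + c) (2 + p , 2 + c) []
mid-left {p} {c} {d} = forget (resp (solve 5 (λ t u l b s → t ⊕ u ⊕ l ⊕ b ⊕ s ⊜ u ⊕ (l ⊕ s ⊕ t) ⊕ b) ≈-refl _ _ _ _ _ ⨾
    ∪-cong ≈-refl (∪-cong (∪-cong ≈-refl (≈-sym splitX₁) ⨾ ≈-sym (splitX (suc p)) ⨾ width (+-comm (suc p) 2)) ≈-refl) ⨾
    bands₃ (suc p) (2 + c) 1 (2 + d))
  (rev (single ⟨ near up down ⟩ top ⟨ near same up ⟩ lineX p ⟨ near same (seam (2 + c) 0) ⟩ shiftY (2 + c + 1) (rowPath (s≤s (≤-trans (n≤1+n _) (n≤1+n _))) z≤n)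
   ⟨ near same (Close-sym (seam (2 + c) 0)) ⟩ single)))
  where
  top : Path (rect 0 (3 + suc p) 0 (2 + c)) (2 + suc p , suc c) (0 , suc c) []
  top = anyPath (inside ≤-refl ≤-refl) (inside z≤n ≤-refl) (λ ()) (λ _ ()) (λ ())

-- The ends split the line into a piece to the left, one between them and one to the right. Two
-- bands connect three successive pieces, an end alone serving as a piece where necessary; this
-- leads to three arrangements according to which pieces are empty. For `W` = 0 two ends would fill
-- the line.
pathMidMid₁ : ∀ {W c d x x′} → x < x′ → x′ ≤ suc W → W ≢ 0 → Path (C (2 + W) 1 (2 + c) 1 (2 + d)) (x , 2 + c) (x′ , 2 + c) []
pathMidMid₁ {W} {c} {d} {x} p p′ W≢0 with gap p
... | zero , refl with rest p′
...   | zero , refl = last-two x W≢0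
  where
  last-two : ∀ x → x ≢ 0 → Path (C (2 + x) 1 (2 + c) 1 (2 + d)) (x , 2 + c) (suc x , 2 + c) []
  last-two zero    ne = ⊥-elim (ne refl)
  last-two (suc x) ne = mid-left
...   | suc q , refl = subst (λ z → Path (C (2 + z) 1 (2 + c) 1 (2 + d)) (x , 2 + c) (suc x , 2 + c) [])
  (trans (cong suc (+-comm x q)) (sym (+-suc q x))) mid-right
pathMidMid₁ {W} {c} {d} {x} p p′ W≢0 | suc m , refl with rest p′
...   | q , eq = subst₂ (λ z x′ → Path (C z 1 (2 + c) 1 (2 + d)) (x , 2 + c) (x′ , 2 + c) [])
  (cong suc (trans (solveℕ 3 (λ x m q → con 2 :+ (x :+ m :+ q) := q :+ (con 1 :+ (m :+ (con 1 :+ x)))) refl x m q) (sym eq)))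
  (cong suc (trans (cong suc (+-comm x m)) (sym (+-suc m x)))) mid-between
  where open +-*-Solver using (_:=_; _:+_; con) renaming (solve to solveℕ)

-- Obstructions

data In (a k c l d : ℕ) : Point → Set where
  body   : ∀ {x y} → x < a → y < d + (c + l) → In a k c l d (x , y)
  top    : ∀ {x y} → x < k → y < c → In a k c l d (x + a , y)
  bottom : ∀ {x y} → x < k → y < d → In a k c l d (x + a , y + (c + l))

-- Removing the cells in X separates u from v: the set σ contains u, not v, and no edge leaves it.
record Cut (a k c l d : ℕ) (X : Point → Set) : Set₁ where
  field
    {u v}  : Point
    σ      : Point → Set
    u∈     : In a k c l d u
    v∈     : In a k c l d v
    u∉     : ¬ X u
    v∉     : ¬ X v
    σu     : σ u
    ¬σv    : ¬ σ v
    closed : ∀ {p q} → In a k c l d p → ¬ X p → In a k c l d q → ¬ X q → p ~ q → σ p → σ q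

record Pendant (a k c l d : ℕ) (s t : Point) : Set where
  field
    {w z} : Point
    w∈    : In a k c l d w
    z∈    : In a k c l d z
    w~z   : w ~ z
    w≢z   : w ≢ z
    only  : ∀ {q} → In a k c l d q → w ~ q → q ≡ w ⊎ q ≡ z
    w≢s   : w ≢ s
    w≢t   : w ≢ t

F7-top F7-bottom : ℕ → Point → Point → Set
F7-top    n s t = SameSet s t (0 , 0) (1 , 1) ⊎ SameSet s t (0 , 1) (1 , 0)
F7-bottom n s t = SameSet s t (0 , n ∸ 1) (1 , n ∸ 2) ⊎ SameSet s t (0 , n ∸ 2) (1 , n ∸ 1)

-- (F8) and (F9) are missing on purpose: they occur only for two arms of one cell and for a body of
-- one column, and are added in `Result`.
data Obstruction (a k c l d : ℕ) (s t : Point) : Set₁ where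
  cut₁      : Cut a k c l d (_≡ s) → Obstruction a k c l d s t
  cut₂      : Cut a k c l d (_≡ t) → Obstruction a k c l d s t
  cut₁₂     : Cut a k c l d (λ p → p ≡ s ⊎ p ≡ t) → Obstruction a k c l d s t
  pendant   : Pendant a k c l d s t → Obstruction a k c l d s t
  f7-top    : a ≡ 2 → k ≡ 1 → c ≡ 1 → F7-top (d + (c + l)) s t → Obstruction a k c l d s t
  f7-bottom : a ≡ 2 → k ≡ 1 → d ≡ 1 → F7-bottom (d + (c + l)) s t → Obstruction a k c l d s t

Outcome : (a k c l d : ℕ) → Point → Point → Set₁
Outcome a k c l d s t = Path (C a k c l d) s t [] ⊎ Obstruction a k c l d s t

Cut-resp : ∀ {a k c l d X Y} → (∀ {p} → In a k c l d p → X p → Y p) → (∀ {p} → In a k c l d p → Y p → X p) →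
           Cut a k c l d X → Cut a k c l d Y
Cut-resp f g K = record
  { σ = Cut.σ K ; u∈ = Cut.u∈ K ; v∈ = Cut.v∈ K ; u∉ = Cut.u∉ K ∘ g (Cut.u∈ K) ; v∉ = Cut.v∉ K ∘ g (Cut.v∈ K)
  ; σu = Cut.σu K ; ¬σv = Cut.¬σv K ; closed = λ p p∉ q q∉ → Cut.closed K p (p∉ ∘ f p) q (q∉ ∘ f q) }

swapOutcome : ∀ {a k c l d s t} → Outcome a k c l d s t → Outcome a k c l d t s
swapOutcome (inj₁ P) = inj₁ (rev P)
swapOutcome (inj₂ (cut₁ K)) = inj₂ (cut₂ K)
swapOutcome (inj₂ (cut₂ K)) = inj₂ (cut₁ K)
swapOutcome (inj₂ (cut₁₂ K)) = inj₂ (cut₁₂ (Cut-resp (λ _ → Sum.swap) (λ _ → Sum.swap) K))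
swapOutcome (inj₂ (pendant P)) = inj₂ (pendant (record { Pendant P ; w≢s = Pendant.w≢t P ; w≢t = Pendant.w≢s P }))
swapOutcome (inj₂ (f7-top p q r x)) = inj₂ (f7-top p q r (Sum.map SameSet-swap SameSet-swap x))
swapOutcome (inj₂ (f7-bottom p q r x)) = inj₂ (f7-bottom p q r (Sum.map SameSet-swap SameSet-swap x))

-- Turning the region upside down

height-flip : ∀ c l d → c + (d + l) ≡ d + (c + l)
height-flip = solveℕ 3 (λ c l d → c :+ (d :+ l) := d :+ (c :+ l)) refl
  where open +-*-Solver using (_:=_; _:+_; con) renaming (solve to solveℕ)

upside : ℕ → Point → Point
upside n (x , y) = x , n ∸ suc y

flipC : ∀ {a k c l d s t} → Path (C a k c l d) s t [] → Path (C a k d l c) (upside (d + (c + l)) s) (upside (d + (c + l)) t) []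
flipC {a} {k} {c} {l} {d} = mapᵖ (upside n) (λ (near p q) → near p (Close-flip n q))
  (↭-trans (↭-reflexive (trans (List.map-++ _ ⟦ rect 0 a 0 n ⟧ _) (cong (map (upside n) ⟦ rect 0 a 0 n ⟧ ++_) (List.map-++ _ ⟦ rect a k 0 c ⟧ _))))
    (↭-trans (Perm.++⁺ (rect-flipY n {0} {a} 0 n 0 (+-identityʳ n)) (Perm.++⁺ (rect-flipY n {a} {k} 0 c (d + l) (height-flip c l d)) (rect-flipY n {a} {k} (c + l) d 0 (trans (+-identityʳ _) (+-comm (c + l) d)))))
      (_≈_.perms (∪-cong {rect 0 a 0 n} (height (sym (height-flip c l d))) (∪-comm {rect a k (d + l) c} {rect a k 0 d})))))
  where
  n = d + (c + l)

upside-upside : ∀ {n y} → y < n → n ∸ suc (n ∸ suc y) ≡ y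
upside-upside {suc n} (s≤s p) = m∸[m∸n]≡n p

upside-< : ∀ {n} y → 0 < n → n ∸ suc y < n
upside-< {suc n} y _ = s≤s (m∸n≤m n y)

In-height : ∀ {a k c l d x y} → In a k c l d (x , y) → y < d + (c + l)
In-height (body _ q)   = q
In-height {c = c} {l} {d} (top _ q) = ≤-trans q (≤-trans (m≤m+n c l) (m≤n+m _ d))
In-height {c = c} {l} (bottom _ q) = +-monoˡ-< (c + l) q

upside-In : ∀ {a k c l d p} → In a k c l d p → In a k d l c (upside (d + (c + l)) p)
upside-In {a} {k} {c} {l} {d} (body {y = y} p q) = body p (subst (d + (c + l) ∸ suc y <_) (sym (height-flip c l d)) (upside-< y (≤-trans (s≤s z≤n) q)))
upside-In {a} {k} {c} {l} {d} (top {x} {y} p q) = subst (λ z → In a k d l c (x + a , z)) eq (bottom p (upside-< y (≤-trans (s≤s z≤n) q)))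
  where
  eq : c ∸ suc y + (d + l) ≡ d + (c + l) ∸ suc y
  eq = trans (sym (+-∸-comm (d + l) q)) (cong (_∸ suc y) (height-flip c l d))
upside-In {a} {k} {c} {l} {d} (bottom {x} {y} p q) = subst (λ z → In a k d l c (x + a , z)) eq (top p (upside-< y (≤-trans (s≤s z≤n) q)))
  where
  eq : d ∸ suc y ≡ d + (c + l) ∸ suc (y + (c + l))
  eq = sym (trans (cong (λ z → d + (c + l) ∸ suc z) (+-comm y (c + l))) (trans (cong (_∸ suc (c + l + y)) (+-comm d (c + l)))
    (trans (cong (c + l + d ∸_) (sym (+-suc (c + l) y))) ([m+n]∸[m+o]≡n∸o (c + l) d (suc y)))))

~-upside : ∀ {n p q} → p ~ q → upside n p ~ upside n q
~-upside {n} (near p q) = near p (Close-flip n q)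

module _ {a k c l d : ℕ} where

  private
    n n′ : ℕ
    n  = d + (c + l)
    n′ = c + (d + l)

  -- The turned region has the height `n′`, which equals `n` only propositionally; hence the two
  -- names.
  involutive : ∀ {p} → In a k c l d p → upside n′ (upside n p) ≡ p
  involutive {x , y} p = cong (x ,_) (trans (cong (λ z → z ∸ suc (n ∸ suc y)) (height-flip c l d)) (upside-upside (In-height p)))

  In-back : ∀ {p} → In a k d l c p → In a k c l d (upside n p)
  In-back {x , y} p = subst (λ z → In a k c l d (x , z ∸ suc y)) (height-flip c l d) (upside-In p)

  involutive′ : ∀ {p} → In a k d l c p → upside n (upside n p) ≡ p
  involutive′ {x , y} p = cong (x ,_) (upside-upside (subst (y <_) (height-flip c l d) (In-height p)))

  flipCut : ∀ {X : Point → Set} → Cut a k d l c (X ∘ upside n) → Cut a k c l d X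
  flipCut {X} K = record
    { u = upside n (Cut.u K) ; v = upside n (Cut.v K) ; σ = Cut.σ K ∘ upside n
    ; u∈ = In-back (Cut.u∈ K) ; v∈ = In-back (Cut.v∈ K) ; u∉ = Cut.u∉ K ; v∉ = Cut.v∉ K
    ; σu = subst (Cut.σ K) (sym (involutive′ (Cut.u∈ K))) (Cut.σu K)
    ; ¬σv = Cut.¬σv K ∘ subst (Cut.σ K) (involutive′ (Cut.v∈ K))
    ; closed = λ p p∉ q q∉ p~q → Cut.closed K (upside-In p) (p∉ ∘ twice p) (upside-In q) (q∉ ∘ twice q) (~-upside {n} p~q) }
    where
    twice : ∀ {p} → In a k c l d p → X (upside n (upside n p)) → X p
    twice {x , y} p = subst (λ z → X (x , z)) (upside-upside (In-height p))

  flipPendant : ∀ {s t} → In a k c l d s → In a k c l d t → Pendant a k d l c (upside n s) (upside n t) → Pendant a k c l d s t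
  flipPendant {s} {t} s∈ t∈ P = record
    { w = upside n w ; z = upside n z ; w∈ = In-back w∈ ; z∈ = In-back z∈ ; w~z = ~-upside {n} w~z
    ; w≢z = λ e → w≢z (trans (sym (involutive′ w∈)) (trans (cong (upside n) e) (involutive′ z∈)))
    ; only = λ {q} q∈ r → Sum.map (returns q∈) (returns q∈) (only (upside-In q∈) (subst (_~ upside n q) (involutive′ w∈) (~-upside {n} r)))
    ; w≢s = λ e → w≢s (trans (sym (involutive′ w∈)) (cong (upside n) e))
    ; w≢t = λ e → w≢t (trans (sym (involutive′ w∈)) (cong (upside n) e)) }
    where
    open Pendant P
    returns : ∀ {q p} → In a k c l d q → upside n q ≡ p → q ≡ upside n p
    returns {x , y} q∈ refl = cong (x ,_) (sym (upside-upside (In-height q∈)))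

  flipSet : ∀ {s t u v} → In a k c l d s → In a k c l d t → SameSet (upside n s) (upside n t) u v → SameSet s t (upside n u) (upside n v)
  flipSet {xs , ys} {xt , yt} s∈ t∈ e = subst₂ (λ z z′ → SameSet (xs , z) (xt , z′) _ _)
    (upside-upside (In-height s∈)) (upside-upside (In-height t∈)) (SameSet-map (upside n) e)

  to : ∀ {s} → In a k c l d s → ∀ {p} → In a k d l c p → p ≡ upside n s → upside n p ≡ s
  to {x , y} s∈ _ refl = cong (x ,_) (upside-upside (In-height s∈))

  from : ∀ {s} → In a k c l d s → ∀ {p} → In a k d l c p → upside n p ≡ s → p ≡ upside n s
  from s∈ p∈ refl = sym (involutive′ p∈)

  flipOutcome : ∀ {s t} → 3 ≤ n → In a k c l d s → In a k c l d t → Outcome a k d l c (upside n s) (upside n t) → Outcome a k c l d s t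
  flipOutcome {s} {t} _ s∈ t∈ (inj₁ P) = inj₁ (subst₂ (λ s t → Path (C a k c l d) s t []) (involutive s∈) (involutive t∈) (flipC P))
  flipOutcome _ s∈ t∈ (inj₂ (cut₁ K)) = inj₂ (cut₁ (flipCut (Cut-resp (to s∈) (from s∈) K)))
  flipOutcome _ s∈ t∈ (inj₂ (cut₂ K)) = inj₂ (cut₂ (flipCut (Cut-resp (to t∈) (from t∈) K)))
  flipOutcome _ s∈ t∈ (inj₂ (cut₁₂ K)) = inj₂ (cut₁₂ (flipCut
    (Cut-resp (λ p → Sum.map (to s∈ p) (to t∈ p)) (λ p → Sum.map (from s∈ p) (from t∈ p)) K)))
  flipOutcome _ s∈ t∈ (inj₂ (pendant P)) = inj₂ (pendant (flipPendant s∈ t∈ P))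
  flipOutcome _ s∈ t∈ (inj₂ (f7-top p q r x)) = inj₂ (f7-bottom p q r (Sum.map (flipSet s∈ t∈) (flipSet s∈ t∈) x))
  flipOutcome {s} {t} n≥3 s∈ t∈ (inj₂ (f7-bottom p q r x)) = inj₂ (f7-top p q r
    (Sum.map (subst₂ (λ y y′ → SameSet s t (0 , y) (1 , y′)) zero′ one′ ∘ flipSet s∈ t∈)
                  (subst₂ (λ y y′ → SameSet s t (0 , y) (1 , y′)) one′ zero′ ∘ flipSet s∈ t∈) x))
    where
    zero′ : n ∸ suc (n′ ∸ 1) ≡ 0
    zero′ = trans (cong (λ z → n ∸ suc (z ∸ 1)) (height-flip c l d)) (upside-upside (≤-trans (s≤s z≤n) n≥3))
    one′ : n ∸ suc (n′ ∸ 2) ≡ 1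
    one′ = trans (cong (λ z → n ∸ suc (z ∸ 2)) (height-flip c l d)) (upside-upside (≤-trans (s≤s (s≤s z≤n)) n≥3))

low-row : ∀ {c l y} → 1 ≤ l → ¬ (y + (c + l) ≤ c)
low-row {c} {l} {y} 1≤l p = <⇒≱ (≤-trans (subst (_≤ c + l) (+-comm c 1) (+-monoʳ-≤ c 1≤l)) (m≤n+m (c + l) y)) p

-- Removing column `x` within the top rows cuts off the part of the arm to its right. If `x` is the
-- last column of the body, the cell in row `c` has to go too, since it touches the arm diagonally.
cutTop : ∀ {a k c l d X x} → 1 ≤ a → 1 ≤ k → 1 ≤ c → 1 ≤ l → 1 ≤ d → a ≤ suc x → suc x < a + k →
         (∀ {y} → y < c → X (x , y)) → (x < a → X (x , c)) → (∀ {p} → X p → p ₓ ≡ x × p ᵧ ≤ c) → Cut a k c l d X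
cutTop {a@(suc _)} {suc k} {c} {l} {suc d} {X} {x} 1≤a _ 1≤c 1≤l _ a≤ <k all corner bound = record
  { u = k + a , 0 ; v = 0 , d + (c + l) ; σ = λ p → x < p ₓ × p ᵧ < c
  ; u∈ = top ≤-refl 1≤c ; v∈ = body (s≤s z≤n) ≤-refl
  ; u∉ = λ u → <⇒≢ x<u (sym (proj₁ (bound u)))
  ; v∉ = λ v → low-row {c} {l} {d} 1≤l (proj₂ (bound v))
  ; σu = x<u , 1≤c ; ¬σv = λ { (() , _) } ; closed = closed′ }
  where
  x<u : x < k + a
  x<u = s≤s⁻¹ (≤-trans <k (≤-reflexive (trans (+-suc a k) (cong suc (+-comm a k)))))
  blocked : ∀ {q} → In a (suc k) c l (suc d) q → ¬ X q → q ₓ ≡ x → ¬ (q ᵧ ≤ c)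
  blocked (body {y = y} p _) q∉ refl q≤ with m≤n⇒m<n∨m≡n q≤
  ... | inj₁ y<c  = q∉ (all y<c)
  ... | inj₂ refl = q∉ (corner p)
  blocked (top _ y<c) q∉ refl _ = q∉ (all y<c)
  blocked (bottom {y = y} _ _) q∉ refl q≤ = low-row {c} {l} {y} 1≤l q≤
  closed′ : ∀ {p q} → In a (suc k) c l (suc d) p → ¬ X p → In a (suc k) c l (suc d) q → ¬ X q → p ~ q →
            x < p ₓ × p ᵧ < c → x < q ₓ × q ᵧ < c
  closed′ {p} {q} p∈ p∉ q∈ q∉ (near (close px≤ _) (close _ qy≤)) (x<p , py<c) with x <? q ₓ
  ... | no ¬x<q = ⊥-elim (blocked q∈ q∉ (≤-antisym (≮⇒≥ ¬x<q) (s≤s⁻¹ (≤-trans x<p px≤))) (≤-trans qy≤ py<c))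
  ... | yes x<q with q∈
  ...   | body q<a _ = ⊥-elim (<⇒≱ q<a (≤-trans a≤ x<q))
  ...   | top _ y<c = x<q , y<c
  ...   | bottom {y = y} _ _ = ⊥-elim (low-row {c} {l} {y} 1≤l (≤-trans qy≤ py<c))

cutMid : ∀ {a k c l d X y} → 1 ≤ a → 1 ≤ c → 1 ≤ d → c ≤ y → y < c + l →
         (∀ {x} → x < a → X (x , y)) → (∀ {p} → X p → p ᵧ ≡ y) → Cut a k c l d X
cutMid {a} {k} {c} {l} {suc d} {X} {y} 1≤a 1≤c _ c≤y y< all bound = record
  { u = 0 , 0 ; v = 0 , d + (c + l) ; σ = λ p → p ᵧ < y
  ; u∈ = body 1≤a (s≤s z≤n) ; v∈ = body 1≤a ≤-refl
  ; u∉ = λ u → <⇒≢ (≤-trans 1≤c c≤y) (bound u)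
  ; v∉ = λ v → <⇒≢ (≤-trans y< (m≤n+m _ d)) (sym (bound v))
  ; σu = ≤-trans 1≤c c≤y ; ¬σv = λ p → <⇒≱ p (≤-trans (<⇒≤ y<) (m≤n+m _ d)) ; closed = closed′ }
  where
  blocked : ∀ {q} → In a k c l (suc d) q → ¬ X q → q ᵧ ≢ y
  blocked (body p _) q∉ refl = q∉ (all p)
  blocked (top _ p) q∉ refl = <⇒≱ p c≤y
  blocked (bottom {y = z} _ _) q∉ refl = <⇒≱ y< (m≤n+m (c + l) z)
  closed′ : ∀ {p q} → In a k c l (suc d) p → ¬ X p → In a k c l (suc d) q → ¬ X q → p ~ q → p ᵧ < y → q ᵧ < y
  closed′ {p} {q} p∈ p∉ q∈ q∉ (near _ (close _ qy≤)) py< with q ᵧ <? y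
  ... | yes r = r
  ... | no ¬r = ⊥-elim (blocked q∈ q∉ (≤-antisym (≤-trans qy≤ py<) (≮⇒≥ ¬r)))

pendantTop : ∀ {a k l d s t} → 1 ≤ l → (suc k + a , 0) ≢ s → (suc k + a , 0) ≢ t → Pendant a (2 + k) 1 l d s t
pendantTop {a} {k} {l} {d} 1≤l w≢s w≢t = record
  { w∈ = top ≤-refl ≤-refl ; z∈ = top {x = k} (n≤1+n _) ≤-refl ; w~z = near down same ; w≢z = 1+n≢n ∘ cong proj₁
  ; only = only′ ; w≢s = w≢s ; w≢t = w≢t }
  where
  only′ : ∀ {q} → In a (2 + k) 1 l d q → (suc k + a , 0) ~ q → q ≡ (suc k + a , 0) ⊎ q ≡ (k + a , 0)
  only′ (body {x} q<a _) (near (close p _) _) = ⊥-elim (<⇒≱ q<a (≤-trans (m≤n+m a k) (s≤s⁻¹ p)))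
  only′ (top {x} {zero} x< _) (near (close p _) _) with m≤n⇒m<n∨m≡n (+-cancelʳ-≤ a k x (s≤s⁻¹ p))
  ... | inj₁ k<x  = inj₁ (cong (λ z → z + a , 0) (≤-antisym (s≤s⁻¹ x<) k<x))
  ... | inj₂ refl = inj₂ refl
  only′ (top {y = suc _} _ (s≤s ())) _
  only′ (bottom {y = y} _ _) (near _ (close _ p)) = ⊥-elim (low-row {1} {l} {y} 1≤l p)

pendantBottom : ∀ {a k c l s t} → 1 ≤ l → In a (2 + k) c l 1 s → In a (2 + k) c l 1 t →
                s ≢ (suc k + a , c + l) → t ≢ (suc k + a , c + l) → Pendant a (2 + k) c l 1 s t
pendantBottom {a} {k} {c} {l} 1≤l s∈ t∈ s≢ t≢ = flipPendant s∈ t∈ (pendantTop 1≤l (off s∈ s≢) (off t∈ t≢))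
  where
  off : ∀ {p} → In a (2 + k) c l 1 p → p ≢ (suc k + a , c + l) → (suc k + a , 0) ≢ upside (1 + (c + l)) p
  off p∈ p≢ e = p≢ (trans (sym (involutive p∈)) (trans (cong (upside (c + (1 + l))) (sym e)) (cong (λ z → suc k + a , z ∸ 1) (+-suc c l))))

cutTop₁ : ∀ {a k l d x} → 1 ≤ a → 1 ≤ l → 1 ≤ d → suc x < k → Cut a k 1 l d (_≡ (x + a , 0))
cutTop₁ {a} {k} {x = x} 1≤a 1≤l 1≤d p = cutTop {x = x + a} 1≤a (≤-trans (s≤s z≤n) p) ≤-refl 1≤l 1≤d (≤-trans (m≤n+m a x) (n≤1+n _))
  (subst (suc (x + a) <_) (+-comm k a) (+-monoˡ-< a p))
  (λ { (s≤s z≤n) → refl }) (λ q → ⊥-elim (<⇒≱ q (m≤n+m a x))) (λ { refl → refl , z≤n })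

cutBottom₁ : ∀ {a k c l x} → 1 ≤ a → 1 ≤ c → 1 ≤ l → suc x < k → Cut a k c l 1 (_≡ (x + a , c + l))
cutBottom₁ {a} {k} {c} {l} {x} 1≤a 1≤c 1≤l p = flipCut (Cut-resp (to′) (from′) (cutTop₁ 1≤a 1≤l 1≤c p))
  where
  s∈ : In a k c l 1 (x + a , c + l)
  s∈ = bottom (≤-trans (n≤1+n _) p) (s≤s z≤n)
  eq : upside (1 + (c + l)) (x + a , c + l) ≡ (x + a , 0)
  eq = cong (x + a ,_) (n∸n≡0 (c + l))
  to′ : ∀ {p} → In a k 1 l c p → p ≡ (x + a , 0) → upside (1 + (c + l)) p ≡ (x + a , c + l)
  to′ p∈ e = to s∈ p∈ (trans e (sym eq))
  from′ : ∀ {p} → In a k 1 l c p → upside (1 + (c + l)) p ≡ (x + a , c + l) → p ≡ (x + a , 0)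
  from′ p∈ e = trans (from s∈ p∈ e) eq

SameSet-⊆ : ∀ {s t u v p : Point} → SameSet s t u v → p ≡ u ⊎ p ≡ v → p ≡ s ⊎ p ≡ t
SameSet-⊆ (inj₁ (refl , refl)) q = q
SameSet-⊆ (inj₂ (refl , refl)) q = Sum.swap q

SameSet-⊇ : ∀ {s t u v p : Point} → SameSet s t u v → p ≡ s ⊎ p ≡ t → p ≡ u ⊎ p ≡ v
SameSet-⊇ (inj₁ (refl , refl)) q = q
SameSet-⊇ (inj₂ (refl , refl)) q = Sum.swap q

cut-pair : ∀ {a k c l d s t u v} → SameSet s t u v → Cut a k c l d (λ p → p ≡ u ⊎ p ≡ v) → Cut a k c l d (λ p → p ≡ s ⊎ p ≡ t)
cut-pair e = Cut-resp (λ _ → SameSet-⊆ e) (λ _ → SameSet-⊇ e)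

cutTop₂ : ∀ {a k l d x s t} → 1 ≤ a → 1 ≤ l → 1 ≤ d → suc x < k → SameSet s t (x + a , 0) (x + a , 1) →
          Cut a k 2 l d (λ p → p ≡ s ⊎ p ≡ t)
cutTop₂ {a} {k} {x = x} 1≤a 1≤l 1≤d p e = cut-pair e
  (cutTop {x = x + a} 1≤a (≤-trans (s≤s z≤n) p) (s≤s z≤n) 1≤l 1≤d (≤-trans (m≤n+m a x) (n≤1+n _))
    (subst (suc (x + a) <_) (+-comm k a) (+-monoˡ-< a p))
    (λ { (s≤s z≤n) → inj₁ refl ; (s≤s (s≤s z≤n)) → inj₂ refl }) (λ q → ⊥-elim (<⇒≱ q (m≤n+m a x)))
    (λ { (inj₁ refl) → refl , z≤n ; (inj₂ refl) → refl , s≤s z≤n }))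

cutCell : ∀ {a l d s t} → 1 ≤ l → 1 ≤ d → SameSet s t (a , 0) (a , 1) → Cut (suc a) 1 1 l d (λ p → p ≡ s ⊎ p ≡ t)
cutCell {a} 1≤l 1≤d e = cut-pair e
  (cutTop {x = a} (s≤s z≤n) ≤-refl ≤-refl 1≤l 1≤d ≤-refl (≤-reflexive (cong suc (+-comm 1 a)))
    (λ { (s≤s z≤n) → inj₁ refl }) (λ _ → inj₂ refl) (λ { (inj₁ refl) → refl , z≤n ; (inj₂ refl) → refl , s≤s z≤n }))

cutMid₁ : ∀ {k c l d y} → 1 ≤ c → 1 ≤ d → c ≤ y → y < c + l → Cut 1 k c l d (_≡ (0 , y))
cutMid₁ 1≤c 1≤d p q = cutMid ≤-refl 1≤c 1≤d p q (λ { (s≤s z≤n) → refl }) (λ { refl → refl })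

cutMid₂ : ∀ {k c l d y s t} → 1 ≤ c → 1 ≤ d → c ≤ y → y < c + l → SameSet s t (0 , y) (1 , y) → Cut 2 k c l d (λ p → p ≡ s ⊎ p ≡ t)
cutMid₂ 1≤c 1≤d p q e = cut-pair e (cutMid (s≤s z≤n) 1≤c 1≤d p q
  (λ { (s≤s z≤n) → inj₁ refl ; (s≤s (s≤s z≤n)) → inj₂ refl }) (λ { (inj₁ refl) → refl ; (inj₂ refl) → refl }))

-- Case analysis on the positions of the ends

armExit : ∀ {k c x y} → x < k → y < c → 2 ≤ k ⊎ c ≡ 1 → Exit k c (x , y) ⊎ c ≡ 1 × y ≡ 0 × suc x < k
armExit {k} {suc zero} {x} {zero} p _ _ with m≤n⇒m<n∨m≡n p
-- In an arm of one row, an end before the last cell cuts off the cells behind it.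
... | inj₁ q    = inj₂ (refl , refl , q)
... | inj₂ refl = inj₁ (line-exit x)
armExit {c = suc zero} {y = suc _} _ (s≤s ()) _
armExit {suc (suc k)} {suc (suc c)} p q (inj₁ (s≤s (s≤s _))) = inj₁ (block-exit (inside (s≤s⁻¹ p) (s≤s⁻¹ q)))

above-bottom : ∀ {c l y} {x x′ : ℕ} → 1 ≤ l → y < c → (x , y) ≢ (x′ , c + l)
above-bottom {c} {l} 1≤l p refl = <⇒≱ p (m≤m+n c l)

left-of : ∀ {W x x′} {y y′ : ℕ} → x < W → (x , y) ≢ (x′ + W , y′)
left-of {W} {x′ = x′} p refl = <⇒≱ p (m≤n+m W x′)

solveTB : ∀ {W K c l d x y x′ y′} → 1 ≤ c → 1 ≤ l → 1 ≤ d → x < 2 + K → y < c → x′ < 2 + W → y′ < d + (c + l) →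
          Outcome (2 + W) (2 + K) c l d (x + (2 + W) , y) (x′ , y′)
solveTB {W} {K} {c} {l} {d} {x} {y} {x′} {y′} 1≤c 1≤l 1≤d p q p′ q′ with armExit p q (inj₁ (s≤s (s≤s z≤n)))
... | inj₂ (refl , refl , r) = inj₂ (cut₁ (cutTop₁ (s≤s z≤n) 1≤l 1≤d r))
... | inj₁ e = go d q′ 1≤d
  where
  go : ∀ d → y′ < d + (c + l) → 1 ≤ d → Outcome (2 + W) (2 + K) c l d (x + (2 + W) , y) (x′ , y′)
  go (suc zero) q′ _ = inj₂ (pendant (pendantBottom 1≤l (top p q) (body p′ q′) (above-bottom 1≤l q) (left-of {x′ = suc K} p′)))
  go (suc (suc d)) q′ _ = let o , eq = m≤n⇒∃[o]m+o≡n {1} {d + (c + l)} (≤-trans (≤-trans 1≤c (m≤m+n c l)) (m≤n+m _ d)) in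
    inj₁ (pathTB (cong (2 +_) (sym eq)) e (inside (s≤s⁻¹ p′) (s≤s⁻¹ (≤-trans q′ (≤-reflexive (cong (2 +_) (sym eq))))))
      (bottomPlug (subst (Close (1 + o)) eq same)))

solveTB₁ : ∀ {W l x′ y′} → 1 ≤ l → x′ < 2 + W → y′ < 2 + l → Outcome (2 + W) 1 1 l 1 (2 + W , 0) (x′ , y′)
solveTB₁ {l = suc l} _ p′ q′ = inj₁ (pathTB refl (line-exit 0) (inside (s≤s⁻¹ p′) (s≤s⁻¹ q′)) (bottomPlug₁ up same))

solveTD : ∀ {W k c l d x y x′ y′} → 1 ≤ c → 1 ≤ l → 1 ≤ d → 2 ≤ k ⊎ c ≡ 1 → 2 ≤ k ⊎ d ≡ 1 → x < k → y < c → x′ < k → y′ < d →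
          Outcome (2 + W) k c l d (x + (2 + W) , y) (x′ + (2 + W) , y′ + (c + l))
solveTD {W} {k} {c} {l} {suc d} {x} {y} {x′} {y′} 1≤c 1≤l 1≤d w w′ p q p′ q′ with armExit p q w
... | inj₂ (refl , refl , r) = inj₂ (cut₁ (cutTop₁ (s≤s z≤n) 1≤l 1≤d r))
... | inj₁ e with armExit p′ (s≤s (m∸n≤m d y′)) w′
...   | inj₁ e′ = inj₁ (pathTD (≤-trans (+-mono-≤ 1≤c 1≤l) (m≤n+m _ d)) (s≤s⁻¹ q′) e e′)
...   | inj₂ (refl , _ , r) with q′
...     | s≤s z≤n = inj₂ (cut₂ (cutBottom₁ (s≤s z≤n) 1≤c 1≤l r))

two-rows : ∀ {x y y′} → y < 2 → y′ < 2 → (x , y) ≢ (x , y′) → SameSet (x , y) (x , y′) (x , 0) (x , 1)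
two-rows (s≤s z≤n)       (s≤s z≤n)       ne = ⊥-elim (ne refl)
two-rows (s≤s z≤n)       (s≤s (s≤s z≤n)) ne = inj₁ (refl , refl)
two-rows (s≤s (s≤s z≤n)) (s≤s z≤n)       ne = inj₂ (refl , refl)
two-rows (s≤s (s≤s z≤n)) (s≤s (s≤s z≤n)) ne = ⊥-elim (ne refl)

two-columns : ∀ {y x x′} → x < 2 → x′ < 2 → (x , y) ≢ (x′ , y) → SameSet (x , y) (x′ , y) (0 , y) (1 , y)
two-columns (s≤s z≤n)       (s≤s z≤n)       ne = ⊥-elim (ne refl)
two-columns (s≤s z≤n)       (s≤s (s≤s z≤n)) ne = inj₁ (refl , refl)
two-columns (s≤s (s≤s z≤n)) (s≤s z≤n)       ne = inj₂ (refl , refl)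
two-columns (s≤s (s≤s z≤n)) (s≤s (s≤s z≤n)) ne = ⊥-elim (ne refl)

end? : ∀ y H → Dec (y ≡ 0 ⊎ y ≡ H)
end? y H = y ≟ 0 ⊎-dec y ≟ H

-- For `n` = 0 the strip is two cells wide, so distinct ends on a common inner line fill that line
-- and separate the strip.
Across : (n x x′ : ℕ) → ℕ → Set
Across n x x′ N = n ≡ 0 × x ≡ x′ × ¬ (x ≡ 0 ⊎ x ≡ N)

across? : ∀ n x x′ N → Dec (Across n x x′ N)
across? n x x′ N = n ≟ 0 ×-dec x ≟ x′ ×-dec ¬? (end? x N)

not-across : ∀ {n x x′ N} → ¬ Across n x x′ N → n ≡ 0 → x ≡ x′ → x ≡ 0 ⊎ x ≡ N
not-across {x = x} {N = N} ¬p e e′ with end? x N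
... | yes q = q
... | no ¬q = ⊥-elim (¬p (e , e′ , ¬q))

inner : ∀ {x N} → x ≤ suc N → ¬ (x ≡ 0 ⊎ x ≡ suc N) → ∃₂ λ y e → x ≡ suc y × N ≡ suc (y + e)
inner {zero}  p ne = ⊥-elim (ne (inj₁ refl))
inner {suc y} p ne with m≤n⇒m<n∨m≡n p
... | inj₂ e = ⊥-elim (ne (inj₂ e))
... | inj₁ q with m≤n⇒∃[o]m+o≡n (s≤s⁻¹ q)
...   | e , refl = y , e , refl , refl

solveTT : ∀ {W K c l d x y x′ y′} → 1 ≤ c → 1 ≤ l → 1 ≤ d → x < 2 + K → y < c → x′ < 2 + K → y′ < c → (x , y) ≢ (x′ , y′) →
          Outcome (2 + W) (2 + K) c l d (x + (2 + W) , y) (x′ + (2 + W) , y′)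
solveTT {W} {K} {suc zero} {l} {d} {x} {zero} {x′} {zero} _ 1≤l 1≤d p _ p′ _ ne
  with suc x <? 2 + K | suc x′ <? 2 + K
... | yes r | _     = inj₂ (cut₁ (cutTop₁ (s≤s z≤n) 1≤l 1≤d r))
... | _     | yes r = inj₂ (cut₂ (cutTop₁ (s≤s z≤n) 1≤l 1≤d r))
... | no r  | no r′ = ⊥-elim (ne (cong (_, 0) (suc-injective (trans (≤-antisym p (≮⇒≥ r)) (≤-antisym (≮⇒≥ r′) p′)))))
solveTT {c = suc zero} {y = suc _} _ _ _ _ (s≤s ()) _ _ _
solveTT {c = suc zero} {y′ = suc _} _ _ _ _ _ _ (s≤s ()) _
solveTT {c = suc (suc c)} {l} {suc zero} 1≤c 1≤l 1≤d p q p′ q′ ne =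
  inj₂ (pendant (pendantBottom 1≤l (top p q) (top p′ q′) (above-bottom 1≤l q) (above-bottom 1≤l q′)))
solveTT {W} {K} {suc (suc c)} {l} {suc (suc d)} {x} {y} {x′} {y′} 1≤c 1≤l 1≤d p q p′ q′ ne
  with c ≟ 0 ×-dec x ≟ x′ ×-dec ¬? (x ≟ suc K) | across? K y y′ (suc c)
... | yes (refl , refl , r) | _ = inj₂ (cut₁₂ (cutTop₂ (s≤s z≤n) 1≤l 1≤d (s≤s (≤∧≢⇒< (s≤s⁻¹ p) r)) (SameSet-map (λ (x , y) → x + (2 + W) , y) (two-rows q q′ ne))))
... | no _ | yes (refl , refl , r) with inner (s≤s⁻¹ q) r
...   | y₀ , e , refl , refl with two-columns p p′ ne
...     | inj₁ (refl , refl) = inj₁ (pathTT′ 1≤l)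
...     | inj₂ (refl , refl) = inj₁ (rev (pathTT′ 1≤l))
solveTT {W} {K} {suc (suc c)} {l} {suc (suc d)} {x} {y} {x′} {y′} 1≤c 1≤l 1≤d p q p′ q′ ne | no ¬A | no ¬B
  with leftPath {K} {c} {x , y} {x′ , y′} (inside (s≤s⁻¹ p) (s≤s⁻¹ q)) (inside (s≤s⁻¹ p′) (s≤s⁻¹ q′)) ne (not-across ¬B) endmost
  where
  endmost : c ≡ 0 → x ≡ x′ → x ≡ suc K
  endmost e e′ with x ≟ suc K
  ... | yes r = r
  ... | no ¬r = ⊥-elim (¬A (e , e′ , ¬r))
... | k , k< , P = inj₁ (pathTT 1≤l k< P)

sameRowTop : ∀ {K c l d x x′ y} → 1 ≤ l → y ≢ 0 → y < 2 + c → x < 2 → x′ < 2 → (x , y) ≢ (x′ , y) →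
             Path (C 2 (2 + K) (2 + c) l (2 + d)) (x , y) (x′ , y) []
sameRowTop {y = zero} _ y≢0 _ _ _ _ = ⊥-elim (y≢0 refl)
sameRowTop {y = suc y} 1≤l _ q p p′ ne with m≤n⇒∃[o]m+o≡n (s≤s⁻¹ (s≤s⁻¹ q))
... | e , refl with two-columns p p′ ne
...   | inj₁ (refl , refl) = pathBB′ 1≤l
...   | inj₂ (refl , refl) = rev (pathBB′ 1≤l)

solveBB : ∀ {W K c l d x y x′ y′} → 1 ≤ c → 1 ≤ l → 1 ≤ d → x < 2 + W → y < d + (c + l) → x′ < 2 + W → y′ < d + (c + l) →
          (x , y) ≢ (x′ , y′) → Outcome (2 + W) (2 + K) c l d (x , y) (x′ , y′)
solveBB {W} {K} {suc zero} _ 1≤l _ p q p′ q′ ne = inj₂ (pendant (pendantTop 1≤l (left-of {x′ = suc K} p ∘ sym) (left-of {x′ = suc K} p′ ∘ sym)))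
solveBB {W} {K} {suc (suc c)} {l} {suc zero} _ 1≤l _ p q p′ q′ ne =
  inj₂ (pendant (pendantBottom 1≤l (body p q) (body p′ q′) (left-of {x′ = suc K} p) (left-of {x′ = suc K} p′)))
solveBB {W} {K} {suc (suc c)} {l} {suc (suc d)} {x} {y} {x′} {y′} _ 1≤l _ p q p′ q′ ne with across? W y y′ (suc (d + (2 + c + l)))
... | no ¬A = inj₁ (pathBB {c = c} {l} {d} 1≤l (inside (s≤s⁻¹ p) (s≤s⁻¹ q)) (inside (s≤s⁻¹ p′) (s≤s⁻¹ q′)) ne (not-across ¬A))
-- The ends fill an inner row of a body of two columns. Beside an arm, the path gets round the row
-- through this arm; beside the gap there is no way round and the ends form a vertex cut.
... | yes (refl , refl , r) with y <? 2 + c | y <? 2 + c + l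
...   | yes y<c | _ = inj₁ (sameRowTop 1≤l (r ∘ inj₁) y<c p p′ ne)
...   | no y≮c | yes y<cl = inj₂ (cut₁₂ (cutMid₂ (s≤s z≤n) (s≤s z≤n) (≮⇒≥ y≮c) y<cl (two-columns p p′ ne)))
...   | no _ | no y≮cl = flipOutcome (s≤s (s≤s (≤-trans (s≤s z≤n) (m≤n+m _ d)))) (body p q) (body p′ q′)
  (inj₁ (sameRowTop 1≤l nonzero (s≤s (m≤n+o⇒m∸n≤o n (suc y)
      (≤-trans (≤-reflexive (trans (sym (+-suc (suc d) X)) (+-comm (suc d) (suc X)))) (+-monoˡ-≤ (suc d) (s≤s (≮⇒≥ y≮cl))))))
    p p′ (λ e → ne (cong (λ z → proj₁ z , y) e))))
  where
  X = 2 + c + l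
  n = 2 + d + X
  nonzero : n ∸ suc y ≢ 0
  nonzero e = r (inj₂ (≤-antisym (s≤s⁻¹ q) (s≤s⁻¹ (m∸n≡0⇒m≤n e))))

unblocked? : ∀ s t → Dec (Unblocked s t)
unblocked? s t = (s ₓ ≟ 0 →-dec (t ₓ ≟ 1 →-dec (s ᵧ ≟ 0 ×-dec t ᵧ ≟ 0))) ×-dec (t ₓ ≟ 0 →-dec (s ₓ ≟ 1 →-dec (t ᵧ ≟ 0 ×-dec s ᵧ ≟ 0)))

-- F8 with the origin moved to (0 , 0), for a body of 2 + W columns.
F8₀ : ℕ → ℕ → Point → Point → Set
F8₀ W l s t = l ≡ 1 ×
  (SameSet s t (1 + W , 0) (1 + W , 2)
   ⊎ W ≡ 0 × (SameSet s t (0 , 0) (1 , 2) ⊎ SameSet s t (0 , 2) (1 , 0))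
   ⊎ 1 ≤ W × (s ₓ < 1 + W × t ≡ (1 + W , 1) ⊎ t ₓ < 1 + W × s ≡ (1 + W , 1)))

-- Both in column 1, the ends are the two neighbours of the arm cell and cut it off; the two
-- diagonal positions are (F7).
blocked-pair : ∀ {l d s t} → 1 ≤ l → 1 ≤ d → s ₓ < 2 → t ₓ < 2 → s ᵧ ≡ 0 → t ᵧ ≡ 1 → ¬ (s ₓ ≡ 0 × t ₓ ≡ 0) → Obstruction 2 1 1 l d s t
blocked-pair 1≤l 1≤d (s≤s z≤n) (s≤s z≤n) refl refl ne = ⊥-elim (ne (refl , refl))
blocked-pair 1≤l 1≤d (s≤s z≤n) (s≤s (s≤s z≤n)) refl refl ne = f7-top refl refl refl (inj₁ (inj₁ (refl , refl)))
blocked-pair 1≤l 1≤d (s≤s (s≤s z≤n)) (s≤s z≤n) refl refl ne = f7-top refl refl refl (inj₂ (inj₂ (refl , refl)))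
blocked-pair 1≤l 1≤d (s≤s (s≤s z≤n)) (s≤s (s≤s z≤n)) refl refl ne = cut₁₂ (cutCell 1≤l 1≤d (inj₁ (refl , refl)))

blocked : ∀ {l d s t} → 1 ≤ l → 1 ≤ d → s ₓ < 2 → t ₓ < 2 → ¬ Unblocked (swap s) (swap t) → Outcome 2 1 1 l d s t
blocked {s = s} {t} 1≤l 1≤d p p′ ¬u with s ᵧ ≟ 0 ×-dec t ᵧ ≟ 1 ×-dec ¬? (s ₓ ≟ 0 ×-dec t ₓ ≟ 0) | t ᵧ ≟ 0 ×-dec s ᵧ ≟ 1 ×-dec ¬? (t ₓ ≟ 0 ×-dec s ₓ ≟ 0)
... | yes (e , e′ , ne) | _ = inj₂ (blocked-pair 1≤l 1≤d p p′ e e′ ne)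
... | no _ | yes (e , e′ , ne) = swapOutcome (inj₂ (blocked-pair 1≤l 1≤d p′ p e e′ ne))
... | no ¬e | no ¬e′ = ⊥-elim (¬u ((λ e e′ → decidable-stable (s ₓ ≟ 0 ×-dec t ₓ ≟ 0) (λ ne → ¬e (e , e′ , ne))) ,
                                    (λ e e′ → decidable-stable (t ₓ ≟ 0 ×-dec s ₓ ≟ 0) (λ ne → ¬e′ (e , e′ , ne)))))

upside-bottom : ∀ c l d y → d + (c + l) ∸ suc (y + (c + l)) ≡ d ∸ suc y
upside-bottom c l d y = trans (cong (λ z → d + (c + l) ∸ suc z) (+-comm y (c + l))) (trans (cong (_∸ suc (c + l + y)) (+-comm d (c + l)))
    (trans (cong (c + l + d ∸_) (sym (+-suc (c + l) y))) ([m+n]∸[m+o]≡n∸o (c + l) d (suc y))))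

solveBB₁ : ∀ {W l x y x′ y′} → 1 ≤ l → x < 2 + W → y < 2 + l → x′ < 2 + W → y′ < 2 + l → (x , y) ≢ (x′ , y′) →
           Outcome (2 + W) 1 1 l 1 (x , y) (x′ , y′) ⊎ F8₀ W l (x , y) (x′ , y′)
solveBB₁ {zero} {l} {x} {y} {x′} {y′} 1≤l p q p′ q′ ne
  with across? 0 y y′ (1 + l) | unblocked? (y , x) (y′ , x′) | unblocked? (1 + l ∸ y , x) (1 + l ∸ y′ , x′)
... | yes (_ , refl , r) | _ | _ = inj₁ (inj₂ (cut₁₂ (cutMid₂ ≤-refl ≤-refl
        (n≢0⇒n>0 (r ∘ inj₁)) (≤∧≢⇒< (s≤s⁻¹ q) (r ∘ inj₂)) (two-columns p p′ ne))))
... | no _ | no ¬u | _ = inj₁ (blocked 1≤l ≤-refl p p′ ¬u)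
... | no _ | yes _ | no ¬u = inj₁ (flipOutcome (s≤s (s≤s 1≤l)) (body p q) (body p′ q′) (blocked 1≤l ≤-refl p p′ ¬u))
-- For three rows the edges reserved for the two arm cells share the cell (1 , 1). Ends in rows 0
-- and 2 that are not both in column 0 then fall under (F8).
... | no ¬A | yes u | yes v = three (l ≟ 1 ×-dec (y ≟ 0 ×-dec y′ ≟ 2 ×-dec ¬? (x ≟ 0 ×-dec x′ ≟ 0) ⊎-dec y′ ≟ 0 ×-dec y ≟ 2 ×-dec ¬? (x′ ≟ 0 ×-dec x ≟ 0)))
  where
  far-pair : ∀ {s t} → s ₓ < 2 → t ₓ < 2 → s ᵧ ≡ 0 → t ᵧ ≡ 2 → ¬ (s ₓ ≡ 0 × t ₓ ≡ 0) →
             SameSet s t (1 , 0) (1 , 2) ⊎ 0 ≡ 0 × (SameSet s t (0 , 0) (1 , 2) ⊎ SameSet s t (0 , 2) (1 , 0))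
  far-pair (s≤s z≤n) (s≤s z≤n) refl refl ne = ⊥-elim (ne (refl , refl))
  far-pair (s≤s z≤n) (s≤s (s≤s z≤n)) refl refl ne = inj₂ (refl , inj₁ (inj₁ (refl , refl)))
  far-pair (s≤s (s≤s z≤n)) (s≤s z≤n) refl refl ne = inj₂ (refl , inj₂ (inj₂ (refl , refl)))
  far-pair (s≤s (s≤s z≤n)) (s≤s (s≤s z≤n)) refl refl ne = inj₁ (inj₁ (refl , refl))
  three : Dec (l ≡ 1 × (y ≡ 0 × y′ ≡ 2 × ¬ (x ≡ 0 × x′ ≡ 0) ⊎ y′ ≡ 0 × y ≡ 2 × ¬ (x′ ≡ 0 × x ≡ 0))) →
          Outcome 2 1 1 l 1 (x , y) (x′ , y′) ⊎ F8₀ 0 l (x , y) (x′ , y′)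
  three (yes (refl , inj₁ (e , e′ , n))) = inj₂ (refl , Sum.map₂ inj₁ (far-pair p p′ e e′ n))
  three (yes (refl , inj₂ (e , e′ , n))) = inj₂ (refl ,
    Sum.map SameSet-swap (λ (z , w) → inj₁ (z , Sum.map SameSet-swap SameSet-swap w)) (far-pair p′ p e e′ n))
  three (no ¬t) = inj₁ (inj₁ (pathBB₁ 1≤l (inside (s≤s⁻¹ p) (s≤s⁻¹ q)) (inside (s≤s⁻¹ p′) (s≤s⁻¹ q′)) ne (λ _ → record
    { inLine = not-across ¬A refl ; start = u
    ; finish = (λ { refl refl → swap (proj₂ v (n∸n≡0 (1 + l)) (m+n∸n≡m 1 l)) }) , (λ { refl refl → swap (proj₁ v (n∸n≡0 (1 + l)) (m+n∸n≡m 1 l)) })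
    ; three = λ e → (λ e′ e″ → decidable-stable (x ≟ 0 ×-dec x′ ≟ 0) (λ n → ¬t (suc-injective e , inj₁ (e′ , e″ , n))))
                  , (λ e′ e″ → decidable-stable (x′ ≟ 0 ×-dec x ≟ 0) (λ n → ¬t (suc-injective e , inj₂ (e′ , e″ , n)))) }) (λ ())))
solveBB₁ {suc W} {l} {x} {y} {x′} {y′} 1≤l p q p′ q′ ne
  with SameSet? (x , y) (x′ , y′) (2 + W , 0) (2 + W , 1) | SameSet? (x , y) (x′ , y′) (2 + W , 1 + l) (2 + W , l)
... | yes e | _ = inj₁ (inj₂ (cut₁₂ (cutCell 1≤l ≤-refl e)))
... | no _ | yes e = inj₁ (flipOutcome (s≤s (s≤s 1≤l)) (body p q) (body p′ q′) (inj₂ (cut₁₂ (cutCell 1≤l ≤-refl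
        (subst₂ (λ z w → SameSet (x , 1 + l ∸ y) (x′ , 1 + l ∸ y′) (2 + W , z) (2 + W , w)) (n∸n≡0 (1 + l)) (m+n∸n≡m 1 l) (SameSet-map (upside (2 + l)) e))))))
... | no ¬t | no ¬b = three (l ≟ 1 ×-dec ((x , y) ≟ᵖ (2 + W , 1) ⊎-dec (x′ , y′) ≟ᵖ (2 + W , 1) ⊎-dec SameSet? (x , y) (x′ , y′) (2 + W , 0) (2 + W , 2)))
  where
  S = x , y
  S′ = x′ , y′
  same-side : ∀ {x y x′ y′} → x′ < 3 + W → y′ < 3 → ¬ SameSet (x , y) (x′ , y′) (2 + W , 0) (2 + W , 1) → ¬ SameSet (x , y) (x′ , y′) (2 + W , 2) (2 + W , 1) →
              (x , y) ≢ (x′ , y′) → (x , y) ≡ (2 + W , 1) → x′ < 2 + W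
  same-side p′ q′ ¬t ¬b ne refl with m≤n⇒m<n∨m≡n (s≤s⁻¹ p′)
  ... | inj₁ r = r
  same-side p′ (s≤s z≤n) ¬t ¬b ne refl | inj₂ refl = ⊥-elim (¬t (inj₂ (refl , refl)))
  same-side p′ (s≤s (s≤s z≤n)) ¬t ¬b ne refl | inj₂ refl = ⊥-elim (ne refl)
  same-side p′ (s≤s (s≤s (s≤s z≤n))) ¬t ¬b ne refl | inj₂ refl = ⊥-elim (¬b (inj₂ (refl , refl)))
  three : Dec (l ≡ 1 × (S ≡ (2 + W , 1) ⊎ S′ ≡ (2 + W , 1) ⊎ SameSet S S′ (2 + W , 0) (2 + W , 2))) →
          Outcome (3 + W) 1 1 l 1 S S′ ⊎ F8₀ (suc W) l S S′
  three (yes (refl , inj₁ e)) = inj₂ (refl , inj₂ (inj₂ (s≤s z≤n , inj₂ (same-side p′ q′ ¬t ¬b ne e , e))))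
  three (yes (refl , inj₂ (inj₁ e))) = inj₂ (refl , inj₂ (inj₂ (s≤s z≤n , inj₁ (same-side p q (¬t ∘ SameSet-swap) (¬b ∘ SameSet-swap) (ne ∘ sym) e , e))))
  three (yes (refl , inj₂ (inj₂ e))) = inj₂ (refl , inj₁ e)
  three (no ¬e) = inj₁ (inj₁ (pathBB₁ 1≤l (inside (s≤s⁻¹ p) (s≤s⁻¹ q)) (inside (s≤s⁻¹ p′) (s≤s⁻¹ q′)) ne (λ ())
    (λ _ → (λ _ → ¬t) , (λ _ → ¬b) , λ _ _ e → (λ r → ¬e (suc-injective e , inj₁ r)) , (λ r → ¬e (suc-injective e , inj₂ (inj₁ r))) , (λ r → ¬e (suc-injective e , inj₂ (inj₂ r))))))

module _ (c l d : ℕ) where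

  private
    n = d + (c + l)

  low⇒top : ∀ {y} → c + l ≤ y → y < n → n ∸ suc y < d
  low⇒top {y} p q with rest p
  ... | y₀ , refl = subst (_< d) (sym (upside-bottom c l d y₀)) (upside-< y₀ (≤-trans (s≤s z≤n) (+-cancelʳ-< (c + l) y₀ d q)))

  mid⇒mid : ∀ {y} → c ≤ y → y < c + l → d ≤ n ∸ suc y × n ∸ suc y < d + l
  mid⇒mid {y} p q = ≤-trans (≤-reflexive (sym (m+n∸n≡m d (c + l)))) (∸-monoʳ-≤ n q) ,
    ≤-trans (s≤s (∸-monoʳ-≤ n (s≤s p))) (≤-reflexive (trans (cong (λ z → suc (z ∸ suc c)) (sym (height-flip c l d)))
      (trans (suc-∸-suc (m<m+n c 1≤d+l)) (m+n∸m≡n c (d + l)))))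
    where
    1≤d+l : 0 < d + l
    1≤d+l = ≤-trans (m<n⇒0<n∸m (≤-<-trans p q)) (≤-trans (≤-reflexive (m+n∸m≡n c l)) (m≤n+m l d))

upside-n : ∀ c l d y → 1 ≤ d + (c + l) → d + (c + l) ∸ suc y < c + (d + l)
upside-n c l d y p = subst (d + (c + l) ∸ suc y <_) (sym (height-flip c l d)) (upside-< y p)

-- What lies below the top band when the bottom arm is one cell.
O₁ : ℕ → ℕ → ℕ → Region
O₁ W c l = rect 0 (2 + W) c (1 + l) ∪ rect (2 + W) 1 (c + l) 1

O₁-split : ∀ W c l → rect 0 (3 + W) 0 c ∪ O₁ W c l ≈ C (2 + W) 1 c l 1
O₁-split W c l = ∪-cong (width (+-comm 1 (2 + W)) ⨾ splitX (2 + W)) ≈-refl ⨾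
  solve 4 (λ a b e f → (a ⊕ b) ⊕ (e ⊕ f) ⊜ (a ⊕ e) ⊕ (b ⊕ f)) ≈-refl _ _ _ _ ⨾
  ∪-cong (≈-sym (splitY c) ⨾ height (+-suc c l)) ≈-refl

O₁-path : ∀ {W c l k} → 1 ≤ l → k < suc W → Path (O₁ W c l) (k , c) (suc k , c) []
O₁-path {W} {c} {suc l} {k} _ p = subst (λ z → Path (O₁ W c (suc l)) (k , z) (suc k , z) []) (m+n∸n≡m c (suc l))
  (mapᵖ (upside n) (~-upside {n}) region (above {W} {l} p))
  where
  n = 1 + (c + suc l)
  region : map (upside n) (⟦ rect 0 (2 + W) 0 (2 + l) ⟧ ++ ⟦ rect (2 + W) 1 0 1 ⟧) ↭ ⟦ O₁ W c (suc l) ⟧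
  region = ↭-trans (↭-reflexive (List.map-++ (upside n) ⟦ rect 0 (2 + W) 0 (2 + l) ⟧ _))
    (Perm.++⁺ (rect-flipY n {0} {2 + W} 0 (2 + l) c (trans (+-comm (2 + l) c) (+-suc c (suc l)))) (rect-flipY n {2 + W} {1} 0 1 (c + suc l) refl))

solveTop : ∀ {W c l d x y x′ y′} → 2 ≤ c → 1 ≤ l → 1 ≤ d → x < 3 + W → y < c → x′ < 3 + W → y′ < c → (x , y) ≢ (x′ , y′) →
           Path (C (2 + W) 1 c l d) (x , y) (x′ , y′) []
solveTop {c = suc zero} (s≤s ())
solveTop {W} {suc (suc c)} {l} {d} {x} {y} {x′} {y′} _ 1≤l 1≤d p q p′ q′ ne = via d 1≤d
  where
  bands : ∀ {O d} → rect 0 (3 + W) 0 (2 + c) ∪ O ≈ C (2 + W) 1 (2 + c) l d → (∀ {k} → k < suc W → Path O (k , 2 + c) (suc k , 2 + c) []) →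
          Path (C (2 + W) 1 (2 + c) l d) (x , y) (x′ , y′) []
  bands split inO with across? c x x′ (2 + W)
  ... | no ¬A = pathTop split inO (inside (s≤s⁻¹ p) (s≤s⁻¹ q)) (inside (s≤s⁻¹ p′) (s≤s⁻¹ q′)) ne (not-across ¬A)
  ... | yes (refl , refl , r) with inner (s≤s⁻¹ p) r
  ...   | x₀ , e , refl , f with two-rows q q′ ne
  ...     | inj₁ (refl , refl) = pathTop₂ split inO (≤-trans (s≤s (m≤m+n x₀ e)) (≤-reflexive (sym f)))
  ...     | inj₂ (refl , refl) = rev (pathTop₂ split inO (≤-trans (s≤s (m≤m+n x₀ e)) (≤-reflexive (sym f))))
  via : ∀ d → 1 ≤ d → Path (C (2 + W) 1 (2 + c) l d) (x , y) (x′ , y′) []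
  via (suc zero)    _ = bands (O₁-split W (2 + c) l) (O₁-path 1≤l)
  via (suc (suc d)) _ = bands (bands₃ W (2 + c) l (2 + d)) (below 1≤l)

solveUU : ∀ {W l d x y x′ y′} → 1 ≤ l → 2 ≤ d → x < 2 + W → y < 1 + l → x′ < 2 + W → y′ < 1 + l → (x , y) ≢ (x′ , y′) →
          Outcome (2 + W) 1 1 l d (x , y) (x′ , y′)
solveUU {d = suc zero} _ (s≤s ())
solveUU {zero} {suc l} {suc (suc d)} {x} {y} {x′} {y′} 1≤l _ p q p′ q′ ne with y ≟ y′ ×-dec ¬? (y ≟ 0) | unblocked? (y , x) (y′ , x′)
... | yes (refl , r) | _ = inj₂ (cut₁₂ (cutMid₂ ≤-refl (s≤s z≤n) (n≢0⇒n>0 r) q (two-columns p p′ ne)))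
... | no _ | no ¬u = blocked 1≤l (s≤s z≤n) p p′ ¬u
... | no ¬r | yes u with SameSet? (x , y) (x′ , y′) (1 , 0) (1 , 1)
...   | yes e = inj₂ (cut₁₂ (cutCell 1≤l (s≤s z≤n) e))
...   | no ¬e = inj₁ (pathUU (inside (s≤s⁻¹ p) (s≤s⁻¹ q)) (inside (s≤s⁻¹ p′) (s≤s⁻¹ q′)) ne (λ ())
                  (λ _ → (λ e → decidable-stable (y ≟ 0) (λ z → ¬r (e , z))) , u) ¬e)
solveUU {suc W} {suc l} {suc (suc d)} {x} {y} {x′} {y′} 1≤l _ p q p′ q′ ne
  with SameSet? (x , y) (x′ , y′) (2 + W , 0) (2 + W , 1) | l ≟ 0 ×-dec x ≟ x′ ×-dec ¬? (x ≟ 0)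
... | yes e | _ = inj₂ (cut₁₂ (cutCell 1≤l (s≤s z≤n) e))
... | no ¬e | no ¬r = inj₁ (pathUU (inside (s≤s⁻¹ p) (s≤s⁻¹ q)) (inside (s≤s⁻¹ p′) (s≤s⁻¹ q′)) ne
                  (λ _ e e′ → decidable-stable (x ≟ 0) (λ z → ¬r (e , e′ , z))) (λ ()) ¬e)
solveUU {suc W} {suc l} {suc (suc d)} {zero} 1≤l _ p q p′ q′ ne | no ¬e | yes (_ , _ , r) = ⊥-elim (r refl)
solveUU {suc W} {suc l} {suc (suc d)} {suc x} 1≤l _ p q p′ q′ ne | no ¬e | yes (refl , refl , r)
  with m≤n⇒m<n∨m≡n (s≤s⁻¹ (s≤s⁻¹ p)) | two-rows q q′ ne
... | inj₁ x< | inj₁ (refl , refl) = inj₁ (pathUU₂ x<)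
... | inj₁ x< | inj₂ (refl , refl) = inj₁ (rev (pathUU₂ x<))
... | inj₂ refl | e = ⊥-elim (¬e e)

-- A classification by rows, fitting the horizontal bands, where `In` distinguishes the body from
-- the arms.
data Zone (a k c l d : ℕ) : Point → Set where
  upper  : ∀ {x y} → x < a + k → y < c → Zone a k c l d (x , y)
  middle : ∀ {x y} → x < a → c ≤ y → y < c + l → Zone a k c l d (x , y)
  lower  : ∀ {x y} → x < a + k → c + l ≤ y → y < d + (c + l) → Zone a k c l d (x , y)

zone : ∀ {a k c l d p} → In a k c l d p → Zone a k c l d p
zone {a} {k} {c} {l} (body {x} {y} p q) with y <? c | y <? c + l
... | yes r | _ = upper (≤-trans p (m≤m+n a k)) r
... | no r | yes r′ = middle p (≮⇒≥ r) r′
... | no _ | no r′ = lower (≤-trans p (m≤m+n a k)) (≮⇒≥ r′) q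
zone {a} {k} (top {x} p q) = upper (subst (x + a <_) (+-comm k a) (+-monoˡ-< a p)) q
zone {a} {k} {c} {l} (bottom {x} {y} p q) = lower (subst (x + a <_) (+-comm k a) (+-monoˡ-< a p)) (m≤n+m (c + l) y) (+-monoˡ-< (c + l) q)

upside-injective : ∀ {n y y′} → y < n → y′ < n → n ∸ suc y ≡ n ∸ suc y′ → y ≡ y′
upside-injective {n} p p′ e = trans (sym (upside-upside p)) (trans (cong (λ z → n ∸ suc z) e) (upside-upside p′))

data Zone₁ (W l d : ℕ) : Point → Set where
  cell  : Zone₁ W l d (2 + W , 0)
  over  : ∀ {x y} → x < 2 + W → y < 1 + l → Zone₁ W l d (x , y)
  under : ∀ {x y} → x < 3 + W → 1 + l ≤ y → y < d + (1 + l) → Zone₁ W l d (x , y)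

<+1 : ∀ {x W} → x < W + 1 → x < suc W
<+1 {x} {W} = subst (x <_) (+-comm W 1)

zone₁ : ∀ {W l d p} → In (2 + W) 1 1 l d p → Zone₁ W l d p
zone₁ p with zone p
... | middle q _ r = over q r
... | lower q r r′ = under (<+1 q) r r′
... | upper q (s≤s z≤n) with m≤n⇒m<n∨m≡n (s≤s⁻¹ (<+1 q))
...   | inj₁ r    = over r (s≤s z≤n)
...   | inj₂ refl = cell

solve₁₂ : ∀ {W l d s t} → 1 ≤ l → In (2 + W) 1 1 l (2 + d) s → In (2 + W) 1 1 l (2 + d) t → s ≢ t → Outcome (2 + W) 1 1 l (2 + d) s t
solve₁₂ {W} {suc l} {d} {s} {t} 1≤l s∈ t∈ ne = go (zone₁ s∈) (zone₁ t∈)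
  where
  cell-below : ∀ {x y} → x < 3 + W → 2 + l ≤ y → y < 2 + d + (2 + l) → Path (C (2 + W) 1 1 (suc l) (2 + d)) (2 + W , 0) (x , y) []
  cell-below p q r with rest q
  ... | y , refl = pathVL (inside (s≤s⁻¹ p) (s≤s⁻¹ (+-cancelʳ-< (2 + l) y (2 + d) r)))
  above-below : ∀ {x y s} → s ₓ < 2 + W → s ᵧ < 2 + l → x < 3 + W → 2 + l ≤ y → y < 2 + d + (2 + l) → Path (C (2 + W) 1 1 (suc l) (2 + d)) s (x , y) []
  above-below p′ q′ p q r with rest q
  ... | y , refl = pathUL (inside (s≤s⁻¹ p′) (s≤s⁻¹ q′)) (inside (s≤s⁻¹ p) (s≤s⁻¹ (+-cancelʳ-< (2 + l) y (2 + d) r)))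
  go : Zone₁ W (suc l) (2 + d) s → Zone₁ W (suc l) (2 + d) t → Outcome (2 + W) 1 1 (suc l) (2 + d) s t
  go cell cell = ⊥-elim (ne refl)
  go cell (over p q) = inj₁ (pathVU (inside (s≤s⁻¹ p) (s≤s⁻¹ q)))
  go (over p q) cell = inj₁ (rev (pathVU (inside (s≤s⁻¹ p) (s≤s⁻¹ q))))
  go cell (under p q r) = inj₁ (cell-below p q r)
  go (under p q r) cell = inj₁ (rev (cell-below p q r))
  go (over p q) (over p′ q′) = solveUU 1≤l (s≤s (s≤s z≤n)) p q p′ q′ ne
  go (over p q) (under p′ q′ r) = inj₁ (above-below p q p′ q′ r)
  go (under p q r) (over p′ q′) = inj₁ (rev (above-below p′ q′ p q r))
  go (under {y = y} p q r) (under {y = y′} p′ q′ r′) = flipOutcome (s≤s (s≤s (≤-trans (s≤s z≤n) (m≤n+m _ d)))) s∈ t∈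
    (inj₁ (solveTop (s≤s (s≤s z≤n)) 1≤l ≤-refl p (low⇒top 1 (suc l) (2 + d) q r) p′ (low⇒top 1 (suc l) (2 + d) q′ r′)
      (λ e → ne (cong₂ _,_ (cong proj₁ e) (upside-injective r r′ (cong proj₂ e))))))

solveTopMid : ∀ {W c l d x y x′ y′} → 1 ≤ l → x < 3 + W → y < 2 + c → x′ < 2 + W → 2 + c ≤ y′ → y′ < 2 + c + l →
              Path (C (2 + W) 1 (2 + c) l (2 + d)) (x , y) (x′ , y′) []
solveTopMid {c = c} {l} 1≤l p q p′ q′ r′ with rest q′
... | y₀ , refl = go l (+-cancelʳ-< (2 + c) y₀ l (subst (y₀ + (2 + c) <_) (+-comm (2 + c) l) r′))
  where
  go : ∀ l → y₀ < l → Path (C _ 1 (2 + c) l _) _ _ []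
  go (suc zero) (s≤s z≤n) = pathTopMid₁ (inside (s≤s⁻¹ p) (s≤s⁻¹ q)) (s≤s⁻¹ p′)
  go (suc (suc l)) y₀< = pathTopMid (inside (s≤s⁻¹ p) (s≤s⁻¹ q)) (inside (s≤s⁻¹ p′) (s≤s⁻¹ y₀<))

solveMid : ∀ {W c l d x y x′ y′} → 1 ≤ l → x < 2 + W → y < l → x′ < 2 + W → y′ < l → (x , y) ≢ (x′ , y′) →
           Outcome (2 + W) 1 (2 + c) l (2 + d) (x , y + (2 + c)) (x′ , y′ + (2 + c))
solveMid {W} {c} {suc zero} {d} {x} {zero} {x′} {zero} _ p _ p′ _ ne with W ≟ 0
... | yes refl = inj₂ (cut₁₂ (cutMid₂ (s≤s z≤n) (s≤s z≤n) ≤-refl (m<m+n (2 + c) (s≤s z≤n)) (SameSet-map (λ (x , y) → x , y + (2 + c)) (two-columns p p′ ne))))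
... | no W≢0 with <-cmp x x′
...   | tri< r _ _ = inj₁ (pathMidMid₁ r (s≤s⁻¹ p′) W≢0)
...   | tri≈ _ e _ = ⊥-elim (ne (cong (_, 0) e))
...   | tri> _ _ r = inj₁ (rev (pathMidMid₁ r (s≤s⁻¹ p) W≢0))
solveMid {l = suc zero} {y = suc _} _ _ (s≤s ())
solveMid {l = suc zero} {y′ = suc _} _ _ _ _ (s≤s ())
solveMid {W} {c} {suc (suc l)} {d} {x} {y} {x′} {y′} _ p q p′ q′ ne with W ≟ 0 ×-dec y ≟ y′ | across? l x x′ (suc W)
... | yes (refl , refl) | _ = inj₂ (cut₁₂ (cutMid₂ (s≤s z≤n) (s≤s z≤n) (m≤n+m (2 + c) y)
        (subst (y + (2 + c) <_) (+-comm (2 + l) (2 + c)) (+-monoˡ-< (2 + c) q)) (SameSet-map (λ (x , y) → x , y + (2 + c)) (two-columns p p′ ne))))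
... | no ¬r | no ¬A = inj₁ (pathMidMid (inside (s≤s⁻¹ p) (s≤s⁻¹ q)) (inside (s≤s⁻¹ p′) (s≤s⁻¹ q′)) ne (not-across ¬A) (λ e e′ → ¬r (e , e′)))
... | no _ | yes (refl , refl , r) with inner (s≤s⁻¹ p) r
...   | x₀ , e , refl , refl with two-rows q q′ ne
...     | inj₁ (refl , refl) = inj₁ (pathMidMid₂ (s≤s (m≤m+n x₀ e)))
...     | inj₂ (refl , refl) = inj₁ (rev (pathMidMid₂ (s≤s (m≤m+n x₀ e))))

solve₂₂ : ∀ {W c l d s t} → 1 ≤ l → In (2 + W) 1 (2 + c) l (2 + d) s → In (2 + W) 1 (2 + c) l (2 + d) t → s ≢ t →
          Outcome (2 + W) 1 (2 + c) l (2 + d) s t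
solve₂₂ {W} {c} {l} {d} {s} {t} 1≤l s∈ t∈ ne = go (zone s∈) (zone t∈)
  where
  n≥3 : 3 ≤ 2 + d + (2 + c + l)
  n≥3 = s≤s (s≤s (≤-trans (s≤s z≤n) (m≤n+m _ d)))
  top-bottom : ∀ {x y s} → s ₓ < 3 + W → s ᵧ < 2 + c → x < 3 + W → 2 + c + l ≤ y → y < 2 + d + (2 + c + l) → Path (C (2 + W) 1 (2 + c) l (2 + d)) s (x , y) []
  top-bottom p q p′ q′ r′ with rest q′
  ... | y , refl = pathTopBottom 1≤l (inside (s≤s⁻¹ p) (s≤s⁻¹ q)) (inside (s≤s⁻¹ p′) (s≤s⁻¹ (+-cancelʳ-< (2 + c + l) y (2 + d) r′)))
  low-mid : ∀ {x y x′ y′} → x < 3 + W → 2 + c + l ≤ y → y < 2 + d + (2 + c + l) → x′ < 2 + W → 2 + c ≤ y′ → y′ < 2 + c + l →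
            Path (C (2 + W) 1 (2 + d) l (2 + c)) (upside (2 + d + (2 + c + l)) (x , y)) (upside (2 + d + (2 + c + l)) (x′ , y′)) []
  low-mid p q r p′ q′ r′ = let u , v = mid⇒mid (2 + c) l (2 + d) q′ r′ in
    solveTopMid 1≤l p (low⇒top (2 + c) l (2 + d) q r) p′ u v
  go : Zone (2 + W) 1 (2 + c) l (2 + d) s → Zone (2 + W) 1 (2 + c) l (2 + d) t → Outcome (2 + W) 1 (2 + c) l (2 + d) s t
  go (upper p q) (upper p′ q′) = inj₁ (solveTop (s≤s (s≤s z≤n)) 1≤l (s≤s z≤n) (<+1 p) q (<+1 p′) q′ ne)
  go (upper p q) (middle p′ q′ r′) = inj₁ (solveTopMid 1≤l (<+1 p) q p′ q′ r′)
  go (middle p q r) (upper p′ q′) = inj₁ (rev (solveTopMid 1≤l (<+1 p′) q′ p q r))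
  go (upper p q) (lower p′ q′ r′) = inj₁ (top-bottom (<+1 p) q (<+1 p′) q′ r′)
  go (lower p q r) (upper p′ q′) = inj₁ (rev (top-bottom (<+1 p′) q′ (<+1 p) q r))
  go (middle {y = y} p q r) (middle {y = y′} p′ q′ r′) with rest q | rest q′
  ... | y₀ , refl | y₁ , refl = solveMid 1≤l p (+-cancelʳ-< (2 + c) y₀ l (subst (y <_) (+-comm (2 + c) l) r))
    p′ (+-cancelʳ-< (2 + c) y₁ l (subst (y′ <_) (+-comm (2 + c) l) r′)) (λ e → ne (cong (λ (x , y) → x , y + (2 + c)) e))
  go (lower p q r) (middle p′ q′ r′) = flipOutcome n≥3 s∈ t∈ (inj₁ (low-mid (<+1 p) q r p′ q′ r′))
  go (middle p q r) (lower p′ q′ r′) = flipOutcome n≥3 s∈ t∈ (inj₁ (rev (low-mid (<+1 p′) q′ r′ p q r)))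
  go (lower p q r) (lower p′ q′ r′) = flipOutcome n≥3 s∈ t∈
    (inj₁ (solveTop (s≤s (s≤s z≤n)) 1≤l (s≤s z≤n) (<+1 p) (low⇒top (2 + c) l (2 + d) q r) (<+1 p′) (low⇒top (2 + c) l (2 + d) q′ r′)
      (λ e → ne (cong₂ _,_ (cong proj₁ e) (upside-injective r r′ (cong proj₂ e))))))

F9₀ : ℕ → ℕ → Point → Point → Set
F9₀ c l s t = (s ᵧ < c × t ᵧ < c) ⊎ (c + l ≤ s ᵧ × c + l ≤ t ᵧ)

-- The first two cells of row 0 are the ones adjacent to the one-column body. In a band of one row
-- with three or more cells, they can be reached last only from the far end; any other end leaves
-- the far cell pendant.
bandExit : ∀ {K h x y} → x < 2 + K → y < h →
           (∃ λ r → r ≤ 1 × Path (rect 0 (2 + K) 0 h) (x , y) (r , 0) []) ⊎ h ≡ 1 × y ≡ 0 × x ≢ suc K × 1 ≤ K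
bandExit {h = suc (suc h)} p q = inj₁ (topExit (inside (s≤s⁻¹ p) (s≤s⁻¹ q)))
bandExit {K} {suc zero} {x} {zero} p _ with x ≟ suc K
... | yes refl = inj₁ (0 , z≤n , rev (lineX (suc K)))
bandExit {zero} {suc zero} {zero} {zero} p _ | no _ = inj₁ (1 , ≤-refl , lineX 1)
bandExit {zero} {suc zero} {suc zero} {zero} p _ | no ne = ⊥-elim (ne refl)
bandExit {zero} {suc zero} {suc (suc _)} {zero} (s≤s (s≤s ())) _ | no _
bandExit {suc K} {suc zero} {x} {zero} p _ | no ne = inj₂ (refl , refl , ne , s≤s z≤n)
bandExit {h = suc zero} {y = suc _} _ (s≤s ())

module _ {K l : ℕ} (1≤l : 1 ≤ l) where

  -- With a body of one column the region is two bands of full width joined by a line, which the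
  -- path traverses once.
  pathA₁ : ∀ {c d s t r r′} → r ≤ 1 → r′ ≤ 1 → Path (rect 0 (2 + K) 0 (suc c)) s (r , c) [] → Path (rect 0 (2 + K) 0 d) t (r′ , 0) [] →
           Path (C 1 (suc K) (suc c) l d) s (t ₓ , t ᵧ + (suc c + l)) []
  pathA₁ {c} {d} r≤ r′≤ P Q with m≤n⇒∃[o]m+o≡n 1≤l
  ... | o , refl = forget (resp (three-bands 1 (suc K) (suc c) (suc o) d)
    (P ⟨ near (close-≤1 r≤ z≤n) up ⟩ lineY o ⟨ near (close-≤1 z≤n r′≤) (subst (Close (suc c + o)) (sym (+-suc (suc c) o)) up) ⟩ shiftY (suc c + suc o) (rev Q)))

  solveA₁-ul : ∀ {c d x y x′ y′} → x < 2 + K → y < c → x′ < 2 + K → c + l ≤ y′ → y′ < d + (c + l) →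
               In 1 (suc K) c l d (x , y) → In 1 (suc K) c l d (x′ , y′) → Outcome 1 (suc K) c l d (x , y) (x′ , y′)
  solveA₁-ul {suc c} {d} {x} {y} {x′} p q p′ q′ r′ s∈ t∈ with rest q′
  ... | y₀ , refl with bandExit p (s≤s (m∸n≤m c y)) | bandExit p′ (+-cancelʳ-< (suc c + l) y₀ d r′)
  ...   | inj₁ (r , r≤ , P) | inj₁ (r″ , r″≤ , Q) = inj₁ (pathA₁ r≤ r″≤
          (subst (λ z → Path (rect 0 (2 + K) 0 (suc c)) (x , z) (r , c) []) (m∸[m∸n]≡n (s≤s⁻¹ q)) (flipV P)) Q)
  ...   | inj₂ (refl , _ , ne , s≤s {n = K′} _) | _ = inj₂ (pendant (pendantTop {k = K′} 1≤l
          (λ e → ne (trans (sym (cong proj₁ e)) (+-comm (suc K′) 1))) (λ e → <⇒≢ (≤-trans (s≤s z≤n) q′) (cong proj₂ e))))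
  ...   | inj₁ _ | inj₂ (refl , refl , ne , s≤s {n = K′} _) = inj₂ (pendant (pendantBottom {k = K′} 1≤l s∈ t∈
          (above-bottom 1≤l q) (λ e → ne (trans (cong proj₁ e) (+-comm (suc K′) 1)))))

  solveA₁ : ∀ {c d s t} → 1 ≤ c → 1 ≤ d → In 1 (suc K) c l d s → In 1 (suc K) c l d t →
            Outcome 1 (suc K) c l d s t ⊎ F9₀ c l s t
  solveA₁ {c} {d} {s} {t} 1≤c 1≤d s∈ t∈ = go (zone s∈) (zone t∈)
    where
    go : Zone 1 (suc K) c l d s → Zone 1 (suc K) c l d t → Outcome 1 (suc K) c l d s t ⊎ F9₀ c l s t
    go (middle (s≤s z≤n) q r) _ = inj₁ (inj₂ (cut₁ (cutMid₁ 1≤c 1≤d q r)))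
    go _ (middle (s≤s z≤n) q r) = inj₁ (inj₂ (cut₂ (cutMid₁ 1≤c 1≤d q r)))
    go (upper _ q) (upper _ q′) = inj₂ (inj₁ (q , q′))
    go (lower _ q _) (lower _ q′ _) = inj₂ (inj₂ (q , q′))
    go (upper p q) (lower p′ q′ r′) = inj₁ (solveA₁-ul p q p′ q′ r′ s∈ t∈)
    go (lower p q r) (upper p′ q′) = inj₁ (swapOutcome (solveA₁-ul p′ q′ p q r t∈ s∈))

Result : (a k c l d : ℕ) → Point → Point → Set₁
Result a k c l d s t = Outcome a k c l d s t ⊎ (k ≡ 1 × c ≡ 1 × d ≡ 1 × ∃ λ W → a ≡ 2 + W × F8₀ W l s t) ⊎ (a ≡ 1 × F9₀ c l s t)

module _ {W : ℕ} where

  private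
    a = 2 + W

  n≥3 : ∀ {c l d} → 1 ≤ c → 1 ≤ l → 1 ≤ d → 3 ≤ d + (c + l)
  n≥3 p q r = +-mono-≤ r (+-mono-≤ p q)

  flip-bottom : ∀ {k c l d x y q} → Outcome a k d l c (x , d ∸ suc y) q → Outcome a k d l c (upside (d + (c + l)) (x , y + (c + l))) q
  flip-bottom {k} {c} {l} {d} {x} {y} {q} = subst (λ z → Outcome a k d l c (x , z) q) (sym (upside-bottom c l d y))

  flip-bottom′ : ∀ {k c l d x y p} → Outcome a k d l c p (x , d ∸ suc y) → Outcome a k d l c p (upside (d + (c + l)) (x , y + (c + l)))
  flip-bottom′ {k} {c} {l} {d} {x} {y} {p} = subst (λ z → Outcome a k d l c p (x , z)) (sym (upside-bottom c l d y))

  solve-wide : ∀ {K c l d s t} → 1 ≤ c → 1 ≤ l → 1 ≤ d → In a (2 + K) c l d s → In a (2 + K) c l d t → s ≢ t → Outcome a (2 + K) c l d s t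
  solve-wide c≥ l≥ d≥ (body p q) (body p′ q′) ne = solveBB c≥ l≥ d≥ p q p′ q′ ne
  solve-wide c≥ l≥ d≥ (top p q) (body p′ q′) ne = solveTB c≥ l≥ d≥ p q p′ q′
  solve-wide c≥ l≥ d≥ (body p′ q′) (top p q) ne = swapOutcome (solveTB c≥ l≥ d≥ p q p′ q′)
  solve-wide c≥ l≥ d≥ (top p q) (bottom p′ q′) ne = solveTD c≥ l≥ d≥ (inj₁ (s≤s (s≤s z≤n))) (inj₁ (s≤s (s≤s z≤n))) p q p′ q′
  solve-wide c≥ l≥ d≥ (bottom p′ q′) (top p q) ne = swapOutcome (solveTD c≥ l≥ d≥ (inj₁ (s≤s (s≤s z≤n))) (inj₁ (s≤s (s≤s z≤n))) p q p′ q′)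
  solve-wide c≥ l≥ d≥ (top p q) (top p′ q′) ne = solveTT c≥ l≥ d≥ p q p′ q′ (λ e → ne (cong (λ (x , y) → x + a , y) e))
  solve-wide {c = c} {l} {d} c≥ l≥ d≥ s∈@(bottom {y = y} p q) t∈@(bottom {y = y′} p′ q′) ne = flipOutcome (n≥3 c≥ l≥ d≥) s∈ t∈
    (flip-bottom {y = y} (flip-bottom′ {y = y′} (solveTT d≥ l≥ c≥ p (upside-< y d≥) p′ (upside-< y′ d≥)
      (λ e → ne (cong₂ (λ x y → x + a , y + (c + l)) (cong proj₁ e) (upside-injective q q′ (cong proj₂ e)))))))
  solve-wide {c = c} {l} {d} c≥ l≥ d≥ s∈@(bottom {y = y} p q) t∈@(body {y = y′} p′ q′) ne = flipOutcome (n≥3 c≥ l≥ d≥) s∈ t∈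
    (flip-bottom {y = y} (solveTB d≥ l≥ c≥ p (upside-< y d≥) p′ (upside-n c l d y′ (≤-trans (s≤s z≤n) q′))))
  solve-wide {c = c} {l} {d} c≥ l≥ d≥ s∈@(body {y = y′} p′ q′) t∈@(bottom {y = y} p q) ne = flipOutcome (n≥3 c≥ l≥ d≥) s∈ t∈
    (flip-bottom′ {y = y} (swapOutcome (solveTB d≥ l≥ c≥ p (upside-< y d≥) p′ (upside-n c l d y′ (≤-trans (s≤s z≤n) q′)))))

  solve-cells : ∀ {l s t} → 1 ≤ l → In a 1 1 l 1 s → In a 1 1 l 1 t → s ≢ t → Outcome a 1 1 l 1 s t ⊎ F8₀ W l s t
  solve-cells l≥ (body p q) (body p′ q′) ne = solveBB₁ l≥ p q p′ q′ ne
  solve-cells l≥ (top (s≤s z≤n) (s≤s z≤n)) (body p′ q′) ne = inj₁ (solveTB₁ l≥ p′ q′)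
  solve-cells l≥ (body p′ q′) (top (s≤s z≤n) (s≤s z≤n)) ne = inj₁ (swapOutcome (solveTB₁ l≥ p′ q′))
  solve-cells l≥ (top p q) (bottom p′ q′) ne = inj₁ (solveTD ≤-refl l≥ ≤-refl (inj₂ refl) (inj₂ refl) p q p′ q′)
  solve-cells l≥ (bottom p′ q′) (top p q) ne = inj₁ (swapOutcome (solveTD ≤-refl l≥ ≤-refl (inj₂ refl) (inj₂ refl) p q p′ q′))
  solve-cells l≥ (top (s≤s z≤n) (s≤s z≤n)) (top (s≤s z≤n) (s≤s z≤n)) ne = ⊥-elim (ne refl)
  solve-cells l≥ (bottom (s≤s z≤n) (s≤s z≤n)) (bottom (s≤s z≤n) (s≤s z≤n)) ne = ⊥-elim (ne refl)
  solve-cells {l} l≥ s∈@(bottom {y = y} (s≤s z≤n) q@(s≤s z≤n)) t∈@(body {y = y′} p′ q′) ne = inj₁ (flipOutcome (n≥3 {1} {l} {1} ≤-refl l≥ ≤-refl) s∈ t∈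
    (flip-bottom {y = y} (solveTB₁ l≥ p′ (upside-n 1 l 1 y′ (s≤s z≤n)))))
  solve-cells {l} l≥ s∈@(body {y = y′} p′ q′) t∈@(bottom {y = y} (s≤s z≤n) q@(s≤s z≤n)) ne = inj₁ (flipOutcome (n≥3 {1} {l} {1} ≤-refl l≥ ≤-refl) s∈ t∈
    (flip-bottom′ {y = y} (swapOutcome (solveTB₁ l≥ p′ (upside-n 1 l 1 y′ (s≤s z≤n))))))

path-or-obstruction : ∀ {a k c l d s t} → 1 ≤ a → 1 ≤ k → 1 ≤ c → 1 ≤ l → 1 ≤ d → In a k c l d s → In a k c l d t → s ≢ t → Result a k c l d s t
path-or-obstruction {suc zero} {suc K} _ _ c≥ l≥ d≥ s∈ t∈ ne with solveA₁ l≥ c≥ d≥ s∈ t∈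
... | inj₁ o = inj₁ o
... | inj₂ f = inj₂ (inj₂ (refl , f))
path-or-obstruction {suc (suc W)} {suc (suc K)} _ _ c≥ l≥ d≥ s∈ t∈ ne = inj₁ (solve-wide c≥ l≥ d≥ s∈ t∈ ne)
path-or-obstruction {suc (suc W)} {suc zero} {suc zero} {l} {suc zero} _ _ _ l≥ _ s∈ t∈ ne with solve-cells l≥ s∈ t∈ ne
... | inj₁ o = inj₁ o
... | inj₂ f = inj₂ (inj₁ (refl , refl , refl , W , refl , f))
path-or-obstruction {suc (suc W)} {suc zero} {suc zero} {l} {suc (suc d)} _ _ _ l≥ _ s∈ t∈ ne = inj₁ (solve₁₂ l≥ s∈ t∈ ne)
path-or-obstruction {suc (suc W)} {suc zero} {suc (suc c)} {l} {suc zero} _ _ c≥ l≥ d≥ s∈ t∈ ne = inj₁ (flipOutcome (n≥3 {W} c≥ l≥ d≥) s∈ t∈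
  (solve₁₂ l≥ (upside-In s∈) (upside-In t∈) (λ e → ne (cong₂ _,_ (cong proj₁ e) (upside-injective (In-height s∈) (In-height t∈) (cong proj₂ e))))))
path-or-obstruction {suc (suc W)} {suc zero} {suc (suc c)} {l} {suc (suc d)} _ _ _ l≥ _ s∈ t∈ ne = inj₁ (solve₂₂ l≥ s∈ t∈ ne)

-- Passage to the Boolean definitions

T-not⇒¬ : ∀ b → T (not b) → ¬ T b
T-not⇒¬ false _ ()

¬⇒T-not : ∀ b → ¬ T b → T (not b)
¬⇒T-not true  f = ⊥-elim (f _)
¬⇒T-not false f = _

split-∧ : ∀ {x y} → T (x ∧ y) → T x × T y
split-∧ = Equivalence.to T-∧

join-∧ : ∀ {x y} → T x → T y → T (x ∧ y)
join-∧ p q = Equivalence.from T-∧ (p , q)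

-- The sums make `a` and `d` primitive, so truncated subtraction survives only in the form of a sum
-- minus one of its summands.
Params : (a k c l d : ℕ) → CParams
Params a k c l d = cparams (a + k) (d + (c + l)) k l c

Hole : (a k c l : ℕ) → Point → Set
Hole a k c l (x , y) = suc a ≤ x × x ≤ a + k × suc c ≤ y × y ≤ c + l

-- Regions count columns and rows from 0, the theorem from 1.
↑ : Point → Point
↑ (x , y) = suc x , suc y

↓ : Point → Point
↓ (x , y) = pred x , pred y

module _ {a k c l d : ℕ} where

  private
    P = Params a k c l d

  InC⁺ : ∀ {x y} → 1 ≤ x → x ≤ a + k → 1 ≤ y → y ≤ d + (c + l) → ¬ Hole a k c l (x , y) → InC P (x , y)
  InC⁺ {x} {y} p q p′ q′ h = join-∧ (≤⇒≤ᵇ p) (join-∧ (≤⇒≤ᵇ q) (join-∧ (≤⇒≤ᵇ p′) (join-∧ (≤⇒≤ᵇ q′) (¬⇒T-not _ λ t →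
    let u , t′ = split-∧ {suc (a + k ∸ k) ≤ᵇ x} t ; v , t″ = split-∧ {x ≤ᵇ a + k} t′ ; w , z = split-∧ {suc c ≤ᵇ y} t″ in
    h (subst (λ b → suc b ≤ x) (m+n∸n≡m a k) (≤ᵇ⇒≤ _ _ u) , ≤ᵇ⇒≤ _ _ v , ≤ᵇ⇒≤ _ _ w , ≤ᵇ⇒≤ _ _ z)))))

  InC⁻ : ∀ {x y} → InC P (x , y) → 1 ≤ x × x ≤ a + k × 1 ≤ y × y ≤ d + (c + l) × ¬ Hole a k c l (x , y)
  InC⁻ {x} {y} t = let p , t₁ = split-∧ {1 ≤ᵇ x} t ; q , t₂ = split-∧ {x ≤ᵇ a + k} t₁ ; p′ , t₃ = split-∧ {1 ≤ᵇ y} t₂ ; q′ , h = split-∧ {y ≤ᵇ d + (c + l)} t₃ in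
    ≤ᵇ⇒≤ _ _ p , ≤ᵇ⇒≤ _ _ q , ≤ᵇ⇒≤ _ _ p′ , ≤ᵇ⇒≤ _ _ q′ , λ (u , v , w , z) → T-not⇒¬ _ h
      (join-∧ (≤⇒≤ᵇ (subst (λ b → suc b ≤ x) (sym (m+n∸n≡m a k)) u)) (join-∧ (≤⇒≤ᵇ v) (join-∧ (≤⇒≤ᵇ w) (≤⇒≤ᵇ z))))

  In⇒InC : ∀ {p} → In a k c l d p → InC P (↑ p)
  In⇒InC (body p q) = InC⁺ (s≤s z≤n) (≤-trans p (m≤m+n a k)) (s≤s z≤n) q (λ (u , _) → <⇒≱ u p)
  In⇒InC t@(top {x} p q) = InC⁺ (s≤s z≤n) (subst (x + a <_) (+-comm k a) (+-monoˡ-< a p)) (s≤s z≤n) (In-height t) (λ (_ , _ , u , _) → <⇒≱ u q)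
  In⇒InC b@(bottom {x} {y} p q) = InC⁺ (s≤s z≤n) (subst (x + a <_) (+-comm k a) (+-monoˡ-< a p)) (s≤s z≤n) (In-height b) (λ (_ , _ , _ , u) → <⇒≱ u (m≤n+m _ y))

  InC⇒In : ∀ {p} → InC P p → In a k c l d (↓ p)
  InC⇒In {zero , _} ()
  InC⇒In {suc x , zero} t = ⊥-elim (<⇒≱ (proj₁ (proj₂ (proj₂ (InC⁻ {suc x} {zero} t)))) z≤n)
  InC⇒In {suc x , suc y} t with InC⁻ {suc x} {suc y} t | x <? a
  ... | _ , q , _ , q′ , h | yes x<a = body x<a q′
  ... | _ , q , _ , q′ , h | no x≮a with rest (≮⇒≥ x≮a) | y <? c | c + l ≤? y
  ...   | x₀ , refl | yes y<c | _ = top (+-cancelʳ-< a x₀ k (subst (x₀ + a <_) (+-comm a k) q)) y<c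
  ...   | x₀ , refl | no y≮c | no y≱ = ⊥-elim (h (s≤s (m≤n+m a x₀) , q , s≤s (≮⇒≥ y≮c) , ≰⇒> y≱))
  ...   | x₀ , refl | no y≮c | yes y≥ with rest y≥
  ...     | y₀ , refl = bottom (+-cancelʳ-< a x₀ k (subst (x₀ + a <_) (+-comm a k) q)) (+-cancelʳ-< (c + l) y₀ d q′)

  ↑↓ : ∀ {p} → InC P p → ↑ (↓ p) ≡ p
  ↑↓ {zero , _} ()
  ↑↓ {suc x , zero} t = ⊥-elim (<⇒≱ (proj₁ (proj₂ (proj₂ (InC⁻ {suc x} {zero} t)))) z≤n)
  ↑↓ {suc x , suc y} t = refl

close⇒dist : ∀ {x y} → Close x y → ∣ x - y ∣ ≤ 1
close⇒dist {zero}  {zero}  _ = z≤n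
close⇒dist {zero}  {suc y} (close _ q) = q
close⇒dist {suc x} {zero}  (close p _) = p
close⇒dist {suc x} {suc y} (close p q) = close⇒dist (close (s≤s⁻¹ p) (s≤s⁻¹ q))

-- Truncation at 0 can only bring coordinates nearer to each other.
dist⇒close : ∀ {x y} → ∣ x - y ∣ ≤ 1 → Close (pred x) (pred y)
dist⇒close {zero}  {zero}  p = same
dist⇒close {zero}  {suc zero} p = same
dist⇒close {zero}  {suc (suc y)} (s≤s ())
dist⇒close {suc zero} {zero}  p = same
dist⇒close {suc (suc x)} {zero} (s≤s ())
dist⇒close {suc x} {suc y} p = go x y p
  where
  go : ∀ x y → ∣ x - y ∣ ≤ 1 → Close x y
  go zero    zero    p = same
  go zero    (suc zero) p = up
  go zero    (suc (suc y)) (s≤s ())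
  go (suc zero) zero p = down
  go (suc (suc x)) zero (s≤s ())
  go (suc x) (suc y) p with go x y p
  ... | close q r = close (s≤s q) (s≤s r)

Adj⁺ : ∀ {p q} → p ≢ q → p ~ q → Adj (↑ p) (↑ q)
Adj⁺ {x , y} {x′ , y′} ne (near p q) = join-∧
  (¬⇒T-not ((x ≡ᵇ x′) ∧ (y ≡ᵇ y′)) (λ t → let u , v = split-∧ {x ≡ᵇ x′} t in ne (cong₂ _,_ (≡ᵇ⇒≡ x x′ u) (≡ᵇ⇒≡ y y′ v))))
  (join-∧ (≤⇒≤ᵇ (close⇒dist p)) (≤⇒≤ᵇ (close⇒dist q)))

Adj⇒≢ : ∀ {p q} → Adj p q → p ≢ q
Adj⇒≢ {x , y} t refl = T-not⇒¬ ((x ≡ᵇ x) ∧ (y ≡ᵇ y)) (proj₁ (split-∧ {not ((x ≡ᵇ x) ∧ (y ≡ᵇ y))} t)) (join-∧ (≡⇒≡ᵇ x x refl) (≡⇒≡ᵇ y y refl))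

Adj⇒~ : ∀ {p q} → Adj p q → ↓ p ~ ↓ q
Adj⇒~ {x , y} {x′ , y′} t = let u , v = split-∧ {∣ x - x′ ∣ ≤ᵇ 1} (proj₂ (split-∧ {not ((x ≡ᵇ x′) ∧ (y ≡ᵇ y′))} t)) in
  near (dist⇒close {x} {x′} (≤ᵇ⇒≤ _ _ u)) (dist⇒close {y} {y′} (≤ᵇ⇒≤ _ _ v))

Adj-sym : ∀ {p q} → Adj p q → Adj q p
Adj-sym {x , y} {x′ , y′} t = let a , b = split-∧ {not ((x ≡ᵇ x′) ∧ (y ≡ᵇ y′))} t ; u , v = split-∧ {∣ x - x′ ∣ ≤ᵇ 1} b in join-∧
  (¬⇒T-not ((x′ ≡ᵇ x) ∧ (y′ ≡ᵇ y)) (λ t′ → let u , v = split-∧ {x′ ≡ᵇ x} t′ in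
    T-not⇒¬ _ a (join-∧ (≡⇒≡ᵇ x x′ (sym (≡ᵇ⇒≡ x′ x u))) (≡⇒≡ᵇ y y′ (sym (≡ᵇ⇒≡ y′ y v))))))
  (join-∧ (subst (λ z → T (z ≤ᵇ 1)) (∣-∣-comm x x′) u) (subst (λ z → T (z ≤ᵇ 1)) (∣-∣-comm y y′) v))

range⇒≤ : ∀ {x n z} → z ∈ range x n → x ≤ z × z < x + n
range⇒≤ {x} {suc n} (here refl) = ≤-refl , m<m+n x (s≤s z≤n)
range⇒≤ {x} {suc n} {z} (there p) = let u , v = range⇒≤ p in <⇒≤ u , subst (z <_) (sym (+-suc x n)) v

range-unique : ∀ x n → Unique (range x n)
range-unique x zero    = []
range-unique x (suc n) = All.tabulate (λ p → <⇒≢ (proj₁ (range⇒≤ p))) ∷ range-unique (suc x) n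

rect-unique : ∀ x w y h → Unique ⟦ rect x w y h ⟧
rect-unique x w y h = Unique.cartesianProduct⁺ (range-unique x w) (range-unique y h)

∈-rect⁻ : ∀ {x w y h p} → p ∈ ⟦ rect x w y h ⟧ → (x ≤ proj₁ p × proj₁ p < x + w) × (y ≤ proj₂ p × proj₂ p < y + h)
∈-rect⁻ {x} {w} {y} {h} p = let u , v = ∈-cartesianProduct⁻ (range x w) (range y h) p in range⇒≤ u , range⇒≤ v

∈-rect⁺ : ∀ {x w y h u v} → x ≤ u → u < x + w → y ≤ v → v < y + h → (u , v) ∈ ⟦ rect x w y h ⟧
∈-rect⁺ p q p′ q′ = ∈-cartesianProduct⁺ (∈-range p q) (∈-range p′ q′)

module _ {a k c l d : ℕ} where

  In⇒∈ : ∀ {p} → In a k c l d p → p ∈ ⟦ C a k c l d ⟧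
  In⇒∈ (body p q) = ∈-++⁺ˡ (∈-rect⁺ z≤n p z≤n q)
  In⇒∈ (top {x} p q) = ∈-++⁺ʳ ⟦ rect 0 a 0 (d + (c + l)) ⟧ (∈-++⁺ˡ (∈-rect⁺ (m≤n+m a x) (subst (x + a <_) (+-comm k a) (+-monoˡ-< a p)) z≤n q))
  In⇒∈ (bottom {x} {y} p q) = ∈-++⁺ʳ ⟦ rect 0 a 0 (d + (c + l)) ⟧ (∈-++⁺ʳ ⟦ rect a k 0 c ⟧
    (∈-rect⁺ (m≤n+m a x) (subst (x + a <_) (+-comm k a) (+-monoˡ-< a p)) (m≤n+m (c + l) y) (subst (y + (c + l) <_) (+-comm d (c + l)) (+-monoˡ-< (c + l) q))))

  ∈⇒In : ∀ {p} → p ∈ ⟦ C a k c l d ⟧ → In a k c l d p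
  ∈⇒In {x , y} p with ∈-++⁻ ⟦ rect 0 a 0 (d + (c + l)) ⟧ p
  ... | inj₁ q = let (_ , u) , (_ , v) = ∈-rect⁻ {0} {a} {0} q in body u v
  ... | inj₂ q with ∈-++⁻ ⟦ rect a k 0 c ⟧ q
  ...   | inj₁ r with ∈-rect⁻ {a} {k} {0} r
  ...     | (u , u′) , (_ , v) with rest u
  ...       | x₀ , refl = top (+-cancelʳ-< a x₀ k (subst (x₀ + a <_) (+-comm a k) u′)) v
  ∈⇒In {x , y} p | inj₂ q | inj₂ r with ∈-rect⁻ {a} {k} {c + l} r
  ...     | (u , u′) , (v , v′) with rest u | rest v
  ...       | x₀ , refl | y₀ , refl = bottom (+-cancelʳ-< a x₀ k (subst (x₀ + a <_) (+-comm a k) u′)) (+-cancelʳ-< (c + l) y₀ d (subst (y₀ + (c + l) <_) (+-comm (c + l) d) v′))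

  C-unique : 1 ≤ l → Unique ⟦ C a k c l d ⟧
  C-unique 1≤l = Unique.++⁺ (rect-unique 0 a 0 (d + (c + l))) (Unique.++⁺ (rect-unique a k 0 c) (rect-unique a k (c + l) d)
      (λ (p , q) → <⇒≱ (proj₂ (proj₂ (∈-rect⁻ {a} {k} {0} p))) (≤-trans (m≤m+n c l) (proj₁ (proj₂ (∈-rect⁻ {a} {k} {c + l} q))))))
    (λ (p , q) → <⇒≱ (proj₂ (proj₁ (∈-rect⁻ {0} {a} {0} p))) (Sum.[ (λ r → proj₁ (proj₁ (∈-rect⁻ {a} {k} {0} r))) , (λ r → proj₁ (proj₁ (∈-rect⁻ {a} {k} {c + l} r))) ]
      (∈-++⁻ ⟦ rect a k 0 c ⟧ q)))

unique-↭ : ∀ {xs ys : List Point} → Unique xs → Unique ys → (∀ {z} → z ∈ xs → z ∈ ys) → (∀ {z} → z ∈ ys → z ∈ xs) → xs ↭ ys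
unique-↭ {[]} {[]} _ _ _ _ = ↭-refl
unique-↭ {[]} {y ∷ ys} _ _ _ g with g (here refl)
... | ()
unique-↭ {x ∷ xs} {ys} (x∉ ∷ ux) uy f g with ∈-∃++ (f (here refl))
... | as , bs , refl with Unique-resp-↭ (setoid Point) (↭⇒↭ₛ (Perm.shift x as bs)) uy
...   | x∉′ ∷ uy′ = ↭-trans (prep x (unique-↭ ux uy′ into out)) (↭-sym (Perm.shift x as bs))
  where
  into : ∀ {z} → z ∈ xs → z ∈ as ++ bs
  into p with Perm.∈-resp-↭ (Perm.shift x as bs) (f (there p))
  ... | here refl = ⊥-elim (All.lookup x∉ p refl)
  ... | there q   = q
  out : ∀ {z} → z ∈ as ++ bs → z ∈ xs
  out p with g (Perm.∈-resp-↭ (↭-sym (Perm.shift x as bs)) (there p))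
  ... | here refl = ⊥-elim (All.lookup x∉′ p refl)
  ... | there q   = q

↑-injective : ∀ {p q} → ↑ p ≡ ↑ q → p ≡ q
↑-injective e = cong ↓ e

walk-last : ∀ {s t ps} → Walk s t ps → last (map ↑ ps) ≡ just (↑ t)
walk-last one                  = refl
walk-last (step _ one)         = refl
walk-last (step _ w@(step _ _)) = walk-last w

walk-start : ∀ {s t ps} → Walk s t ps → head (map ↑ ps) ≡ just (↑ s)
walk-start one        = refl
walk-start (step _ _) = refl

walk-linked : ∀ {s t ps} → Walk s t ps → Unique ps → Linked Adj (map ↑ ps)
walk-linked one _ = [-]
walk-linked (step n one) ((ne ∷ _) ∷ _) = Adj⁺ ne n ∷ [-]
walk-linked (step n w@(step _ _)) ((ne ∷ _) ∷ u) = Adj⁺ ne n ∷ walk-linked w u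

linked-walk : ∀ {s t ps} → head ps ≡ just s → last ps ≡ just t → Linked Adj ps → Walk (↓ s) (↓ t) (map ↓ ps)
linked-walk refl refl [-]            = one
linked-walk {ps = p ∷ q ∷ _} refl e (adj ∷ linked) = step (Adj⇒~ {p} {q} adj) (linked-walk refl e linked)

module _ {a k c l d : ℕ} (1≤l : 1 ≤ l) where

  private
    P = Params a k c l d

  path⇒ham : ∀ {s t} → Path (C a k c l d) s t [] → HamiltonianPath P (↑ s) (↑ t)
  path⇒ham (path {cells} w r _) = map ↑ cells , walk-start w , walk-last w , Unique.map⁺ ↑-injective unique ,
    All.map⁺ (All.tabulate (λ {p} p∈ → In⇒InC {a} {k} {c} {l} {d} {p} (∈⇒In {a} {k} {c} {l} {d} {p} (Perm.∈-resp-↭ r p∈)))) ,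
    (λ v v∈ → subst (_∈ map ↑ cells) (↑↓ {a} {k} {c} {l} {d} v∈)
      (∈-map⁺ ↑ (Perm.∈-resp-↭ (↭-sym r) (In⇒∈ {a} {k} {c} {l} {d} (InC⇒In {a} {k} {c} {l} {d} {v} v∈))))) ,
    walk-linked w unique
    where
    unique : Unique cells
    unique = Unique-resp-↭ (setoid Point) (↭⇒↭ₛ (↭-sym r)) (C-unique {a} {k} {c} {l} {d} 1≤l)

  ham⇒path : ∀ {s t} → HamiltonianPath P s t → Path (C a k c l d) (↓ s) (↓ t) []
  ham⇒path (ps , h , e , u , allIn , covers , linked) = path (linked-walk h e linked)
    (unique-↭ (unique-down allIn u) (C-unique {a} {k} {c} {l} {d} 1≤l)
      (λ q → let p , p∈ , e = ∈-map⁻ ↓ q in subst (_∈ ⟦ C a k c l d ⟧) (sym e)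
        (In⇒∈ {a} {k} {c} {l} {d} (InC⇒In {a} {k} {c} {l} {d} {p} (All.lookup allIn p∈))))
      (λ {z} q → ∈-map⁺ ↓ (covers (↑ z) (In⇒InC {a} {k} {c} {l} {d} {z} (∈⇒In {a} {k} {c} {l} {d} {z} q))))) []
    where
    unique-down : ∀ {ps} → All (InC P) ps → Unique ps → Unique (map ↓ ps)
    unique-down [] [] = []
    unique-down (i ∷ is) (x∉ ∷ u) = All.map⁺ (All.zipWith (λ (j , ne) e → ne (trans (sym (↑↓ {a} {k} {c} {l} {d} i)) (trans (cong ↑ e) (↑↓ {a} {k} {c} {l} {d} j)))) (is , x∉)) ∷ unique-down is u

length-singleton : ∀ {xs} {z : Point} → Unique xs → z ∈ xs → (∀ {q} → q ∈ xs → q ≡ z) → length xs ≡ 1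
length-singleton {_ ∷ []} _ _ _ = refl
length-singleton {_ ∷ _ ∷ _} ((ne ∷ _) ∷ _) _ f = ⊥-elim (ne (trans (f (here refl)) (sym (f (there (here refl))))))

neighbours : CParams → Point → List Point
neighbours P w = filter (λ v → T? (adjᵇ w v)) (vertices P)

module _ {a k c l d : ℕ} where

  private
    P = Params a k c l d

  InC↑ : ∀ {p} → In a k c l d p → InC P (↑ p)
  InC↑ {p} = In⇒InC {a} {k} {c} {l} {d} {p}

  In↓ : ∀ {p} → InC P p → In a k c l d (↓ p)
  In↓ {p} = InC⇒In {a} {k} {c} {l} {d} {p}

  ↑-↓ : ∀ {p} → InC P p → ↑ (↓ p) ≡ p
  ↑-↓ {p} = ↑↓ {a} {k} {c} {l} {d} {p}

  vertex⁺ : ∀ {p} → InC P (↑ p) → ↑ p ∈ vertices P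
  vertex⁺ {x , y} i = let _ , q , _ , q′ , _ = InC⁻ {a} {k} {c} {l} {d} {suc x} {suc y} i in
    ∈-filter⁺ (λ v → T? (inCᵇ P v)) (∈-cartesianProduct⁺ (∈-applyUpTo⁺ suc q) (∈-applyUpTo⁺ suc q′)) i

  vertices-unique : Unique (vertices P)
  vertices-unique = Unique.filter⁺ (λ v → T? (inCᵇ P v)) (Unique.cartesianProduct⁺
    (Unique.applyUpTo⁺₁ suc (a + k) (λ i<j _ → <⇒≢ (s≤s i<j))) (Unique.applyUpTo⁺₁ suc (d + (c + l)) (λ i<j _ → <⇒≢ (s≤s i<j))))

  neighbour⁺ : ∀ w {q} → InC P q → Adj w q → q ∈ neighbours P w
  neighbour⁺ w {q} i adj = ∈-filter⁺ (λ v → T? (adjᵇ w v)) (subst (_∈ vertices P) (↑-↓ {q} i) (vertex⁺ {↓ q} (subst (InC P) (sym (↑-↓ {q} i)) i))) adj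

  neighbour⁻ : ∀ w {q} → q ∈ neighbours P w → InC P q × Adj w q
  neighbour⁻ w {q} q∈ = let i , adj = ∈-filter⁻ (λ v → T? (adjᵇ w v)) {xs = vertices P} q∈ in
    proj₂ (∈-filter⁻ (λ v → T? (inCᵇ P v)) {xs = cartesianProduct (applyUpTo suc (a + k)) (applyUpTo suc (d + (c + l)))} i) , adj

  stays : ∀ {X xs} (K : Cut a k c l d X) → (∀ {p} → InC P p → p ∉ xs → ¬ X (↓ p)) → ∀ {u v ps} → head ps ≡ just u → last ps ≡ just v →
          All (λ w → InC P w × w ∉ xs) ps → Linked Adj ps → Cut.σ K (↓ u) → Cut.σ K (↓ v)
  stays K f refl refl _ [-] σu = σu
  stays K f {ps = p ∷ q ∷ _} refl e ((i , i∉) ∷ is@((j , j∉) ∷ _)) (adj ∷ linked) σu =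
    stays K f refl e is linked (Cut.closed K (In↓ {p} i) (f i i∉) (In↓ {q} j) (f j j∉) (Adj⇒~ {p} {q} adj) σu)

  disconnected : ∀ {X xs} → (∀ {p} → InC P p → p ∉ xs → ¬ X (↓ p)) → (∀ {p} → ↑ p ∈ xs → X p) → Cut a k c l d X → Disconnected P xs
  disconnected f g K = ↑ u , ↑ v , InC↑ u∈ , u∉ ∘ g , InC↑ v∈ , v∉ ∘ g ,
    λ (ps , h , e , is , linked) → ¬σv (stays K f h e is linked σu)
    where open Cut K

  pendant⇒F3 : ∀ {s t} → Pendant a k c l d s t → F3 P (↑ s) (↑ t)
  pendant⇒F3 {s} {t} pen = ↑ w , InC↑ w∈ , w≢s ∘ ↑-injective , w≢t ∘ ↑-injective ,
    length-singleton (Unique.filter⁺ _ vertices-unique) (neighbour⁺ (↑ w) {↑ z} (InC↑ z∈) (Adj⁺ w≢z w~z)) one-neighbour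
    where
    open Pendant pen
    one-neighbour : ∀ {q} → q ∈ neighbours P (↑ w) → q ≡ ↑ z
    one-neighbour {q} q∈ with neighbour⁻ (↑ w) {q} q∈
    ... | i , adj with only (In↓ {q} i) (Adj⇒~ {↑ w} {q} adj)
    ...   | inj₁ e = ⊥-elim (Adj⇒≢ {↑ w} {q} adj (trans (cong ↑ (sym e)) (↑-↓ {q} i)))
    ...   | inj₂ e = trans (sym (↑-↓ {q} i)) (cong ↑ e)

  obstruction⇒forbidden : ∀ {s t} → 1 ≤ c → 1 ≤ l → Obstruction a k c l d s t → Forbidden P (↑ s) (↑ t)
  obstruction⇒forbidden {s} _ _ (cut₁ K) = inj₁ (inj₁ (disconnected
    (λ {p} i p∉ e → p∉ (here (trans (sym (↑-↓ {p} i)) (cong ↑ e)))) (λ { (here e) → ↑-injective e ; (there ()) }) K))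
  obstruction⇒forbidden _ _ (cut₂ K) = inj₁ (inj₂ (inj₁ (disconnected
    (λ {p} i p∉ e → p∉ (here (trans (sym (↑-↓ {p} i)) (cong ↑ e)))) (λ { (here e) → ↑-injective e ; (there ()) }) K)))
  obstruction⇒forbidden _ _ (cut₁₂ K) = inj₁ (inj₂ (inj₂ (disconnected
    (λ { {p} i p∉ (inj₁ e) → p∉ (here (trans (sym (↑-↓ {p} i)) (cong ↑ e)))
       ; {p} i p∉ (inj₂ e) → p∉ (there (here (trans (sym (↑-↓ {p} i)) (cong ↑ e)))) })
    (λ { (here e) → inj₁ (↑-injective e) ; (there (here e)) → inj₂ (↑-injective e) ; (there (there ())) }) K)))
  obstruction⇒forbidden _ _ (pendant p) = inj₂ (inj₁ (pendant⇒F3 p))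
  obstruction⇒forbidden _ _ (f7-top refl refl refl x) = inj₂ (inj₂ (inj₁ (refl , refl , inj₁ (refl , Sum.map (SameSet-map ↑) (SameSet-map ↑) x))))
  obstruction⇒forbidden (s≤s {n = c′} _) _ (f7-bottom refl refl refl x) = inj₂ (inj₂ (inj₁ (refl , refl , inj₂ (d≡1 , Sum.map (SameSet-map ↑) (SameSet-map ↑) x))))
    where
    d≡1 : suc (c + l) ∸ l ∸ c ≡ 1
    d≡1 = trans (cong (_∸ c) (m+n∸n≡m (suc c) l)) (m+n∸n≡m 1 c)

-- `F8₀` is symmetric in the ends, (F8) is not; the order of the abscissas excludes the exchanged
-- labelling in its last two cases.
F8₀⇒F8 : ∀ {W l s t} → s ₓ ≤ t ₓ → F8₀ W l s t → F8 (Params (2 + W) 1 1 l 1) (↑ s) (↑ t)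
F8₀⇒F8 {W} s≤t (refl , x) rewrite +-comm W 1 = refl , refl , refl , refl , (case x of λ where
  (inj₁ (inj₁ (refl , refl))) → inj₁ (s≤s (s≤s z≤n) , refl , refl , refl)
  (inj₁ (inj₂ (refl , refl))) → inj₁ (s≤s (s≤s z≤n) , refl , refl , refl)
  (inj₂ (inj₁ (refl , inj₁ (inj₁ (refl , refl))))) → inj₂ (inj₁ (refl , refl , refl , refl))
  (inj₂ (inj₁ (refl , inj₁ (inj₂ (refl , refl))))) → case s≤t of λ ()
  (inj₂ (inj₁ (refl , inj₂ (inj₁ (refl , refl))))) → inj₂ (inj₁ (refl , refl , refl , refl))
  (inj₂ (inj₁ (refl , inj₂ (inj₂ (refl , refl))))) → case s≤t of λ ()
  (inj₂ (inj₂ (1≤W , inj₁ (s< , refl)))) → inj₂ (inj₂ (s≤s (s≤s 1≤W) , s≤s s< , refl))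
  (inj₂ (inj₂ (1≤W , inj₂ (t< , refl)))) → ⊥-elim (<⇒≱ t< s≤t))

F9₀⇒F9 : ∀ {k c l d s t} → F9₀ c l s t → F9 (Params 1 k c l d) (↑ s) (↑ t)
F9₀⇒F9 {k} (inj₁ (p , q)) = m+n∸n≡m 1 k , inj₁ (p , q)
F9₀⇒F9 {k} (inj₂ (p , q)) = m+n∸n≡m 1 k , inj₂ (s≤s p , s≤s q)

-- Necessity: vertex cuts

module _ {P : CParams} {xs : List Point} where

  private
    Allowed : Point → Set
    Allowed w = InC P w × w ∉ xs

  data Reach : Point → Point → Set where
    stop : ∀ {u} → Allowed u → Reach u u
    go   : ∀ {u v w} → Allowed u → Adj u v → Reach v w → Reach u w

  reach⇒reachable : ∀ {u v} → Reach u v → ReachableAvoiding P xs u v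
  reach⇒reachable (stop {u} i) = u ∷ [] , refl , refl , i ∷ [] , [-]
  reach⇒reachable (go {u} i adj r) with reach⇒reachable r
  ... | p ∷ ps , refl , e , is , linked = u ∷ p ∷ ps , refl , e , i ∷ is , adj ∷ linked

  reach-trans : ∀ {u v w} → Reach u v → Reach v w → Reach u w
  reach-trans (stop _)     r = r
  reach-trans (go i adj q) r = go i adj (reach-trans q r)

  reach-start : ∀ {u v} → Reach u v → Allowed u
  reach-start (stop i)   = i
  reach-start (go i _ _) = i

  reach-sym : ∀ {u v} → Reach u v → Reach v u
  reach-sym (stop i)         = stop i
  reach-sym (go {u} {v} i adj r) = reach-trans (reach-sym r) (go (reach-start r) (Adj-sym {u} {v} adj) (stop i))

  reach-all : ∀ {x ps v} → Linked Adj (x ∷ ps) → All Allowed (x ∷ ps) → v ∈ x ∷ ps → Reach x v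
  reach-all _ (i ∷ _) (here refl) = stop i
  reach-all (adj ∷ linked) (i ∷ is) (there v∈) = go i adj (reach-all linked is v∈)

  connected : ∀ {ps} → Linked Adj ps → All Allowed ps → (∀ w → InC P w → w ∉ xs → w ∈ ps) → ¬ Disconnected P xs
  connected {[]} _ _ f (u , v , i , u∉ , j , v∉ , _) = ¬Any[] (f u i u∉)
  connected {x ∷ ps} linked is f (u , v , i , u∉ , j , v∉ , separated) = separated (reach⇒reachable
    (reach-trans (reach-sym (reach-all linked is (f u i u∉))) (reach-all linked is (f v j v∉))))

last-∷ʳ : ∀ {t : Point} ps → last ps ≡ just t → ∃ λ qs → ps ≡ qs ∷ʳ t
last-∷ʳ (x ∷ []) refl = [] , refl
last-∷ʳ (x ∷ y ∷ ps) e = let qs , f = last-∷ʳ (y ∷ ps) e in x ∷ qs , cong (x ∷_) f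

linked-init : ∀ {R : Point → Point → Set} qs {t} → Linked R (qs ∷ʳ t) → Linked R qs
linked-init [] _ = []
linked-init (x ∷ []) _ = [-]
linked-init (x ∷ y ∷ qs) (r ∷ rs) = r ∷ linked-init (y ∷ qs) rs

linked-tail : ∀ {R : Point → Point → Set} {x qs} → Linked R (x ∷ qs) → Linked R qs
linked-tail [-] = []
linked-tail (_ ∷ rs) = rs

unique-init : ∀ qs {t : Point} → Unique (qs ∷ʳ t) → All (_≢ t) qs
unique-init [] _ = []
unique-init (x ∷ qs) (x∉ ∷ u) = All.head (All.++⁻ʳ qs x∉) ∷ unique-init qs u

∈-init : ∀ qs {t w : Point} → w ∈ qs ∷ʳ t → w ≢ t → w ∈ qs
∈-init qs w∈ ne with ∈-++⁻ qs w∈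
... | inj₁ p = p
... | inj₂ (here e) = ⊥-elim (ne e)

-- Without one or both of its ends, a Hamiltonian path is still a path through all remaining cells.
ham⇒¬F1 : ∀ {P s t} → s ≢ t → HamiltonianPath P s t → ¬ F1 P s t
ham⇒¬F1 {P} {s = s} _ (_ ∷ ps , refl , e , x∉ ∷ _ , _ ∷ is , covers , linked) (inj₁ D) =
  connected {P} (linked-tail linked) (All.zipWith (λ (i , ne) → i , λ { (here e) → ne (sym e) ; (there ()) }) (is , x∉))
    (λ w i w∉ → case covers w i of λ { (here e) → ⊥-elim (w∉ (here e)) ; (there p) → p }) D
ham⇒¬F1 {P} _ (ps , h , e , u , is , covers , linked) (inj₂ (inj₁ D)) with last-∷ʳ ps e
... | qs , refl = connected {P} (linked-init qs linked)
    (All.zipWith (λ (i , ne) → i , λ { (here e) → ne e ; (there ()) }) (All.++⁻ˡ qs is , unique-init qs u))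
    (λ w i w∉ → ∈-init qs (covers w i) (w∉ ∘ here)) D
ham⇒¬F1 ne (s ∷ [] , refl , refl , _) (inj₂ (inj₂ D)) = ne refl
ham⇒¬F1 {P} _ (s ∷ ps@(_ ∷ _) , refl , e , x∉ ∷ u , _ ∷ is , covers , linked) (inj₂ (inj₂ D)) with last-∷ʳ ps e
... | qs , f rewrite f = connected {P} (linked-init qs (linked-tail linked))
    (All.zipWith (λ (i , ne , ne′) → i , λ { (here e) → ne (sym e) ; (there (here e)) → ne′ e ; (there (there ())) })
      (All.++⁻ˡ qs is , All.zip (All.++⁻ˡ qs x∉ , unique-init qs u)))
    (λ w i w∉ → case covers w i of λ { (here e) → ⊥-elim (w∉ (here e)) ; (there p) → ∈-init qs p (λ e → w∉ (there (here e))) }) D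

-- Necessity: forced edges

edge-~ : ∀ {s t ps u v} → Walk s t ps → Edge (u , v) ps → u ~ v
edge-~ (step n w) fwd with refl ← walk-head w = n
edge-~ (step n w) bwd with refl ← walk-head w = ~-sym n
edge-~ (step n w) (there e) = edge-~ w e

edge-∈ : ∀ {u v ps} → Edge (u , v) ps → v ∈ ps
edge-∈ fwd       = there (here refl)
edge-∈ bwd       = here refl
edge-∈ (there e) = there (edge-∈ e)

edge-≢ : ∀ {u v ps} → Unique ps → Edge (u , v) ps → v ≢ u
edge-≢ ((ne ∷ _) ∷ _) fwd = ne ∘ sym
edge-≢ ((ne ∷ _) ∷ _) bwd = ne
edge-≢ (_ ∷ u) (there e)  = edge-≢ u e

interior : ∀ {s t ps p} → Walk s t ps → Unique ps → p ∈ ps → p ≢ s → p ≢ t →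
           ∃₂ λ u v → u ≢ v × Edge (p , u) ps × Edge (p , v) ps
interior w _ (here e) p≢s _ = ⊥-elim (p≢s (trans e (walk-head w)))
interior (step _ one) _ (there (here e)) _ p≢t = ⊥-elim (p≢t e)
interior (step _ (step _ one)) ((_ ∷ ne ∷ _) ∷ _) (there (here refl)) _ _ = _ , _ , ne , bwd , there fwd
interior (step _ (step _ (step _ _))) ((_ ∷ ne ∷ _) ∷ _) (there (here refl)) _ _ = _ , _ , ne , bwd , there fwd
interior (step _ w@(step _ _)) (_ ∷ u@(v∉ ∷ _)) (there p∈@(there q∈)) _ p≢t with interior w u p∈ (λ { refl → All.lookup v∉ q∈ refl }) p≢t
... | _ , _ , ne , e , f = _ , _ , ne , there e , there f

leaves : ∀ {s t ps} → Walk s t ps → s ≢ t → ∃ λ v → Edge (s , v) ps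
leaves one ne = ⊥-elim (ne refl)
leaves (step _ one) _ = _ , fwd
leaves (step _ (step _ _)) _ = _ , fwd

drop-edge : ∀ {x u v ps} → x ≢ u → x ≢ v → Edge (u , v) (x ∷ ps) → Edge (u , v) ps
drop-edge p q fwd       = ⊥-elim (p refl)
drop-edge p q bwd       = ⊥-elim (q refl)
drop-edge p q (there e) = e

drop-edges : ∀ {x ps qs} → All (x ≢_) qs → Linked (λ u v → Edge (u , v) (x ∷ ps)) qs → Linked (λ u v → Edge (u , v) ps) qs
drop-edges _ [] = []
drop-edges _ [-] = [-]
drop-edges (p ∷ ps@(q ∷ _)) (e ∷ es) = drop-edge p q e ∷ drop-edges ps es

walk-end : ∀ {s t ps} → Walk s t ps → t ∈ ps
walk-end one        = here refl
walk-end (step _ w) = there (walk-end w)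

first-edge : ∀ {s q v t ps} → Walk v t ps → All (s ≢_) ps → Edge (s , q) (s ∷ ps) → q ≡ v
first-edge w _        fwd       = walk-head w
first-edge w (ne ∷ _) bwd       = ⊥-elim (ne refl)
first-edge w s∉       (there e) = ⊥-elim (All.lookup s∉ (edge-∈ (Edge-sym e)) refl)

-- The start lies on one edge only, so the first edge of the chain is the first step of the path;
-- after removing the start the argument repeats. A chain that arrives at `t` therefore exhausts the
-- path.
prefix : ∀ {s t ps} → Walk s t ps → Unique ps → ∀ qs → Unique (s ∷ qs) → Linked (λ u v → Edge (u , v) ps) (s ∷ qs) →
         ∃ λ rs → ps ≡ s ∷ qs ++ rs × (last (s ∷ qs) ≡ just t → rs ≡ [])
prefix one _ [] _ _ = [] , refl , λ _ → refl
prefix (step {ps = ps} _ w) (s∉ ∷ _) [] _ _ = ps , refl , λ { refl → ⊥-elim (All.lookup s∉ (walk-end w) refl) }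
prefix one _ (q ∷ qs) _ (there () ∷ _)
prefix (step n w) (s∉ ∷ u) (q ∷ qs) (q∉ ∷ u′) (e ∷ es) with refl ← first-edge w s∉ e with prefix w u qs u′ (drop-edges q∉ es)
... | rs , f , g = rs , cong (_ ∷_) f , g

module Facts {a k c l d : ℕ} {s t : Point} (1≤l : 1 ≤ l) (Q : Path (C a k c l d) s t []) where

  open Path Q using () renaming (cells to trail; walk to w; perm to r) public

  unique : Unique trail
  unique = Unique-resp-↭ (setoid Point) (↭⇒↭ₛ (↭-sym r)) (C-unique {a} {k} {c} {l} {d} 1≤l)

  member : ∀ {p} → In a k c l d p → p ∈ trail
  member p = Perm.∈-resp-↭ (↭-sym r) (In⇒∈ p)

  region∈ : ∀ {p} → p ∈ trail → In a k c l d p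
  region∈ p = ∈⇒In (Perm.∈-resp-↭ r p)

  E : Point → Point → Set
  E u v = Edge (u , v) trail

  two-edges : ∀ {p} → In a k c l d p → p ≢ s → p ≢ t → ∃₂ λ u v → u ≢ v × E p u × E p v
  two-edges p = interior w unique (member p)

  Neighbour : Point → Point → Set
  Neighbour p q = In a k c l d q × p ~ q × q ≢ p

  neighbour : ∀ {p q} → E p q → Neighbour p q
  neighbour e = region∈ (edge-∈ e) , edge-~ w e , edge-≢ unique e

  both : ∀ {p x y} → In a k c l d p → p ≢ s → p ≢ t → (∀ {q} → Neighbour p q → q ≡ x ⊎ q ≡ y) → E p x × E p y
  both p p≢s p≢t f with two-edges p p≢s p≢t
  ... | u , v , ne , e , e′ with f (neighbour e) | f (neighbour e′)
  ...   | inj₁ refl | inj₁ refl = ⊥-elim (ne refl)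
  ...   | inj₁ refl | inj₂ refl = e , e′
  ...   | inj₂ refl | inj₁ refl = e′ , e
  ...   | inj₂ refl | inj₂ refl = ⊥-elim (ne refl)

  other : ∀ {p} x → In a k c l d p → p ≢ s → p ≢ t → ∃ λ y → y ≢ x × E p y
  other x p p≢s p≢t with two-edges p p≢s p≢t
  ... | u , v , ne , e , e′ with u ≟ᵖ x
  ...   | yes refl = v , ne ∘ sym , e′
  ...   | no u≢x   = u , u≢x , e

  initial : ∀ qs → Unique (s ∷ qs) → Linked E (s ∷ qs) → ∃ λ rs → trail ≡ s ∷ qs ++ rs
  initial qs u es = let rs , e , _ = prefix w unique qs u es in rs , e

  exhausts : ∀ qs → Unique (s ∷ qs) → Linked E (s ∷ qs) → last (s ∷ qs) ≡ just t → ∀ {p} → In a k c l d p → p ∈ s ∷ qs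
  exhausts qs u es e p with prefix w unique qs u es
  ... | rs , f , g rewrite g e = subst (_ ∈_) (trans f (++-[] qs)) (member p)
    where
    ++-[] : ∀ qs → s ∷ qs ++ [] ≡ s ∷ qs
    ++-[] qs = cong (s ∷_) (List.++-identityʳ qs)

  start-unique : ∀ {x y} → E s x → E s y → x ≡ y
  start-unique {x} {y} e e′ with initial (x ∷ []) ((edge-≢ unique e ∘ sym ∷ []) ∷ [] ∷ []) (e ∷ [-])
                       | initial (y ∷ []) ((edge-≢ unique e′ ∘ sym ∷ []) ∷ [] ∷ []) (e′ ∷ [-])
  ... | _ , f | _ , g with trans (sym f) g
  ...   | refl = refl

  finish : s ≢ t → ∃ λ v → E t v
  finish ne = let v , e = leaves (reverseʷ w) (ne ∘ sym) in v , subst (Edge (t , v)) (List.reverse-involutive trail) (Edge-reverse e)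

ham⇒¬F3 : ∀ {a k c l d s t} → 1 ≤ l → Path (C a k c l d) s t [] → ¬ F3 (Params a k c l d) (↑ s) (↑ t)
ham⇒¬F3 {a} {k} {c} {l} {d} {s} {t} 1≤l Q (x , i , x≢s , x≢t , deg≡1)
  with two-edges (In↓ {a} {k} {c} {l} {d} {x} i) (λ e → x≢s (trans (sym (↑-↓ {a} {k} {c} {l} {d} {x} i)) (cong ↑ e))) (λ e → x≢t (trans (sym (↑-↓ {a} {k} {c} {l} {d} {x} i)) (cong ↑ e)))
  where open Facts {a} {k} {c} {l} {d} 1≤l Q
... | u , v , ne , e , e′ = ne (↑-injective (length≡1 deg≡1 (listed e) (listed e′)))
  where
  open Facts {a} {k} {c} {l} {d} 1≤l Q
  length≡1 : ∀ {xs : List Point} {u v} → length xs ≡ 1 → u ∈ xs → v ∈ xs → u ≡ v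
  length≡1 {_ ∷ []} _ (here refl) (here refl) = refl
  length≡1 {_ ∷ []} _ (there ()) _
  length≡1 {_ ∷ []} _ _ (there ())
  listed : ∀ {u} → E (↓ x) u → ↑ u ∈ neighbours (Params a k c l d) x
  listed {u} e = let i′ , n , ne = neighbour e in
    neighbour⁺ {a} {k} {c} {l} {d} x {↑ u} (InC↑ {a} {k} {c} {l} {d} i′) (subst (λ z → Adj z (↑ u)) (↑-↓ {a} {k} {c} {l} {d} {x} i) (Adj⁺ (ne ∘ sym) n))

module _ {W l d : ℕ} where

  corner∈ : In (2 + W) 1 1 l d (2 + W , 0)
  corner∈ = top {x = 0} (s≤s z≤n) (s≤s z≤n)

  corner-neighbour : ∀ {q} → 1 ≤ l → In (2 + W) 1 1 l d q × (2 + W , 0) ~ q × q ≢ (2 + W , 0) → q ≡ (1 + W , 0) ⊎ q ≡ (1 + W , 1)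
  corner-neighbour _ (body p _ , near (close r _) (close _ z≤n) , _) = inj₁ (cong (_, 0) (≤-antisym (s≤s⁻¹ p) (s≤s⁻¹ r)))
  corner-neighbour _ (body p _ , near (close r _) (close _ (s≤s z≤n)) , _) = inj₂ (cong (_, 1) (≤-antisym (s≤s⁻¹ p) (s≤s⁻¹ r)))
  corner-neighbour _ (top (s≤s z≤n) (s≤s z≤n) , _ , ne) = ⊥-elim (ne refl)
  corner-neighbour 1≤l (bottom {y = y} _ _ , near _ (close _ r) , _) = ⊥-elim (<⇒≱ (+-monoʳ-≤ 1 1≤l) (≤-trans (m≤n+m (1 + l) y) r))

module _ {W : ℕ} where

  foot∈ : In (2 + W) 1 1 1 1 (2 + W , 2)
  foot∈ = bottom {x = 0} {0} (s≤s z≤n) (s≤s z≤n)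

  foot-neighbour : ∀ {q} → In (2 + W) 1 1 1 1 q × (2 + W , 2) ~ q × q ≢ (2 + W , 2) → q ≡ (1 + W , 1) ⊎ q ≡ (1 + W , 2)
  foot-neighbour (body {y = 0} _ _ , near _ (close (s≤s ()) _) , _)
  foot-neighbour (body {y = 1} p _ , near (close r _) _ , _) = inj₁ (cong (_, 1) (≤-antisym (s≤s⁻¹ p) (s≤s⁻¹ r)))
  foot-neighbour (body {y = 2} p _ , near (close r _) _ , _) = inj₂ (cong (_, 2) (≤-antisym (s≤s⁻¹ p) (s≤s⁻¹ r)))
  foot-neighbour (body {y = suc (suc (suc _))} _ (s≤s (s≤s (s≤s ()))) , _)
  foot-neighbour (top _ (s≤s z≤n) , near _ (close (s≤s ()) _) , _)
  foot-neighbour (bottom (s≤s z≤n) (s≤s z≤n) , _ , ne) = ⊥-elim (ne refl)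

-- Each arm cell lies between its two neighbours, and both share the neighbour (1 + W , 1). The
-- resulting chain of five cells joins the ends and misses (0 , 0).
no-F8₁ : ∀ {W} → ¬ Path (C (2 + W) 1 1 1 1) (1 + W , 0) (1 + W , 2) []
no-F8₁ {W} Q =
  let e₁ , e₂ = both corner∈ (λ ()) (λ ()) (corner-neighbour ≤-refl)
      e₃ , e₄ = both foot∈ (λ ()) (λ ()) foot-neighbour
  in case exhausts ((2 + W , 0) ∷ (1 + W , 1) ∷ (2 + W , 2) ∷ (1 + W , 2) ∷ [])
      (((λ ()) ∷ (λ ()) ∷ (λ ()) ∷ (λ ()) ∷ []) ∷ ((λ ()) ∷ (λ ()) ∷ (λ ()) ∷ []) ∷ ((λ ()) ∷ (λ ()) ∷ []) ∷ ((λ ()) ∷ []) ∷ [] ∷ [])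
      (Edge-sym e₁ ∷ e₂ ∷ Edge-sym e₃ ∷ e₄ ∷ [-]) refl (body {y = 0} (s≤s z≤n) (s≤s z≤n)) of λ
    { (here ()) ; (there (here ())) ; (there (there (here ()))) ; (there (there (there (here ())))) ; (there (there (there (there (here ()))))) }
  where open Facts ≤-refl Q

-- The arm cells force the chain (1 , 2), (2 , 2), (1 , 1), (2 , 0), (1 , 0). Then (0 , 2) finds no
-- second neighbour besides (0 , 1): the start has used its only edge and (1 , 1) both of its edges.
no-F8₂ : ¬ Path (C 2 1 1 1 1) (1 , 2) (0 , 0) []
no-F8₂ Q =
  let e₁ , e₂ = both corner∈ (λ ()) (λ ()) (corner-neighbour ≤-refl)
      e₃ , e₄ = both foot∈ (λ ()) (λ ()) foot-neighbour
  in case other (0 , 1) (body {x = 0} {2} (s≤s z≤n) (s≤s (s≤s (s≤s z≤n)))) (λ ()) (λ ()) of λ (y , y≢ , e) → case low (neighbour e) of λ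
    { (inj₁ r) → y≢ r
    ; (inj₂ (inj₁ refl)) → case start-unique (Edge-sym e) (Edge-sym e₄) of λ ()
    ; (inj₂ (inj₂ refl)) →
        let _ , f = initial ((2 , 2) ∷ (1 , 1) ∷ (0 , 2) ∷ []) (((λ ()) ∷ (λ ()) ∷ (λ ()) ∷ []) ∷ ((λ ()) ∷ (λ ()) ∷ []) ∷ ((λ ()) ∷ []) ∷ [] ∷ []) (Edge-sym e₄ ∷ e₃ ∷ Edge-sym e ∷ [-])
            _ , g = initial ((2 , 2) ∷ (1 , 1) ∷ (2 , 0) ∷ []) (((λ ()) ∷ (λ ()) ∷ (λ ()) ∷ []) ∷ ((λ ()) ∷ (λ ()) ∷ []) ∷ ((λ ()) ∷ []) ∷ [] ∷ []) (Edge-sym e₄ ∷ e₃ ∷ Edge-sym e₂ ∷ [-])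
        in case trans (sym f) g of λ () }
  where
  open Facts ≤-refl Q
  low : ∀ {q} → In 2 1 1 1 1 q × (0 , 2) ~ q × q ≢ (0 , 2) → q ≡ (0 , 1) ⊎ q ≡ (1 , 2) ⊎ q ≡ (1 , 1)
  low (body {0} {0} _ _ , near _ (close (s≤s ()) _) , _)
  low (body {0} {1} _ _ , _ , _) = inj₁ refl
  low (body {0} {2} _ _ , _ , ne) = ⊥-elim (ne refl)
  low (body {1} {0} _ _ , near _ (close (s≤s ()) _) , _)
  low (body {1} {1} _ _ , _ , _) = inj₂ (inj₂ refl)
  low (body {1} {2} _ _ , _ , _) = inj₂ (inj₁ refl)
  low (body {suc (suc _)} (s≤s (s≤s ())) _ , _)
  low (body {_} {suc (suc (suc _))} _ (s≤s (s≤s (s≤s ()))) , _)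
  low (top (s≤s z≤n) _ , near (close _ (s≤s ())) _ , _)
  low (bottom (s≤s z≤n) _ , near (close _ (s≤s ())) _ , _)

-- Both arm cells need the start as a neighbour on the path, but the start has only one.
no-F8₃ : ∀ {W t} → t ₓ < 1 + W → ¬ Path (C (2 + W) 1 1 1 1) (1 + W , 1) t []
no-F8₃ {W} t< Q =
  let _ , e = both corner∈ (λ ()) (λ { refl → <⇒≱ t< (n≤1+n _) }) (corner-neighbour ≤-refl)
      f , _ = both foot∈ (λ ()) (λ { refl → <⇒≱ t< (n≤1+n _) }) foot-neighbour
  in case start-unique (Edge-sym e) (Edge-sym f) of λ ()
  where open Facts ≤-refl Q

module _ {l d : ℕ} (1≤l : 1 ≤ l) (1≤d : 1 ≤ d) where

  private
    tall : 3 ≤ d + (1 + l)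
    tall = +-mono-≤ 1≤d (s≤s 1≤l)

    body′ : ∀ {x y} → x < 2 → y < 3 → In 2 1 1 l d (x , y)
    body′ p q = body p (≤-trans q tall)

    low : ∀ {q} → In 2 1 1 l d q → q ᵧ ≤ 1 → q ≡ (0 , 0) ⊎ q ≡ (1 , 0) ⊎ q ≡ (0 , 1) ⊎ q ≡ (1 , 1) ⊎ q ≡ (2 , 0)
    low (body (s≤s z≤n) _) z≤n = inj₁ refl
    low (body (s≤s (s≤s z≤n)) _) z≤n = inj₂ (inj₁ refl)
    low (body (s≤s z≤n) _) (s≤s z≤n) = inj₂ (inj₂ (inj₁ refl))
    low (body (s≤s (s≤s z≤n)) _) (s≤s z≤n) = inj₂ (inj₂ (inj₂ (inj₁ refl)))
    low (top (s≤s z≤n) (s≤s z≤n)) _ = inj₂ (inj₂ (inj₂ (inj₂ refl)))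
    low (bottom {y = y} _ _) r = ⊥-elim (<⇒≱ (+-monoʳ-≤ 1 1≤l) (≤-trans (m≤n+m (1 + l) y) r))

  -- The path begins (1 , 1), (2 , 0), (1 , 0). From there it reaches (0 , 0) at once or by way of
  -- (0 , 1), because the last step into (0 , 0) can come from no other cell; either way (0 , 2) is
  -- missed.
  no-F7₁ : ¬ Path (C 2 1 1 l d) (1 , 1) (0 , 0) []
  no-F7₁ Q =
    let e₁ , e₂ = both corner∈ (λ ()) (λ ()) (corner-neighbour 1≤l)
        short : E (1 , 0) (0 , 0) → ⊥
        short g = case exhausts ((2 , 0) ∷ (1 , 0) ∷ (0 , 0) ∷ [])
          (((λ ()) ∷ (λ ()) ∷ (λ ()) ∷ []) ∷ ((λ ()) ∷ (λ ()) ∷ []) ∷ ((λ ()) ∷ []) ∷ [] ∷ []) (Edge-sym e₂ ∷ e₁ ∷ g ∷ [-]) refl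
          (body′ {0} {2} (s≤s z≤n) ≤-refl) of λ { (here ()) ; (there (here ())) ; (there (there (here ()))) ; (there (there (there (here ())))) }
    in case other (2 , 0) (body′ {1} {0} (s≤s (s≤s z≤n)) (s≤s z≤n)) (λ ()) (λ ()) of λ (y , y≢ , e) →
       case finish (λ ()) of λ (z , f) →
       let y∈ , near _ (close _ r) , y≢′ = neighbour e
           z∈ , near _ (close _ r′) , z≢ = neighbour f
       in case low y∈ r of λ
      { (inj₁ refl) → short e
      ; (inj₂ (inj₁ refl)) → y≢′ refl
      ; (inj₂ (inj₂ (inj₁ refl))) → case low z∈ r′ of λ
          { (inj₁ refl) → z≢ refl
          ; (inj₂ (inj₁ refl)) → short (Edge-sym f)
          ; (inj₂ (inj₂ (inj₁ refl))) → case exhausts ((2 , 0) ∷ (1 , 0) ∷ (0 , 1) ∷ (0 , 0) ∷ [])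
              (((λ ()) ∷ (λ ()) ∷ (λ ()) ∷ (λ ()) ∷ []) ∷ ((λ ()) ∷ (λ ()) ∷ (λ ()) ∷ []) ∷ ((λ ()) ∷ (λ ()) ∷ []) ∷ ((λ ()) ∷ []) ∷ [] ∷ [])
              (Edge-sym e₂ ∷ e₁ ∷ e ∷ Edge-sym f ∷ [-]) refl (body′ {0} {2} (s≤s z≤n) ≤-refl) of λ
              { (here ()) ; (there (here ())) ; (there (there (here ()))) ; (there (there (there (here ())))) ; (there (there (there (there (here ()))))) }
          ; (inj₂ (inj₂ (inj₂ (inj₁ refl)))) → case start-unique (Edge-sym f) (Edge-sym e₂) of λ ()
          ; (inj₂ (inj₂ (inj₂ (inj₂ refl)))) → case proj₁ (proj₂ (neighbour f)) of λ { (near (close _ (s≤s ())) _) } }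
      ; (inj₂ (inj₂ (inj₂ (inj₁ refl)))) → case start-unique (Edge-sym e) (Edge-sym e₂) of λ ()
      ; (inj₂ (inj₂ (inj₂ (inj₂ refl)))) → y≢ refl }
    where open Facts 1≤l Q

  -- The path begins (1 , 0), (2 , 0), (1 , 1). Of the three neighbours of (0 , 0) the start is used
  -- up, so (0 , 0) lies between (1 , 1) and the target, and the path ends too early.
  no-F7₂ : ¬ Path (C 2 1 1 l d) (1 , 0) (0 , 1) []
  no-F7₂ Q =
    let e₁ , e₂ = both corner∈ (λ ()) (λ ()) (corner-neighbour 1≤l)
        not-start : E (0 , 0) (1 , 0) → ⊥
        not-start h = case start-unique (Edge-sym h) (Edge-sym e₁) of λ ()
        long : E (0 , 0) (0 , 1) → E (0 , 0) (1 , 1) → ⊥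
        long h h′ = case exhausts ((2 , 0) ∷ (1 , 1) ∷ (0 , 0) ∷ (0 , 1) ∷ [])
          (((λ ()) ∷ (λ ()) ∷ (λ ()) ∷ (λ ()) ∷ []) ∷ ((λ ()) ∷ (λ ()) ∷ (λ ()) ∷ []) ∷ ((λ ()) ∷ (λ ()) ∷ []) ∷ ((λ ()) ∷ []) ∷ [] ∷ [])
          (Edge-sym e₁ ∷ e₂ ∷ Edge-sym h′ ∷ h ∷ [-]) refl (body′ {0} {2} (s≤s z≤n) ≤-refl) of λ
          { (here ()) ; (there (here ())) ; (there (there (here ()))) ; (there (there (there (here ())))) ; (there (there (there (there (here ()))))) }
    in case two-edges (body′ {0} {0} (s≤s z≤n) (s≤s z≤n)) (λ ()) (λ ()) of λ (u , v , u≢v , f , g) → case near-corner (neighbour f) , near-corner (neighbour g) of λ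
      { (inj₁ refl , _) → not-start f
      ; (_ , inj₁ refl) → not-start g
      ; (inj₂ (inj₁ refl) , inj₂ (inj₁ refl)) → u≢v refl
      ; (inj₂ (inj₁ refl) , inj₂ (inj₂ refl)) → long f g
      ; (inj₂ (inj₂ refl) , inj₂ (inj₁ refl)) → long g f
      ; (inj₂ (inj₂ refl) , inj₂ (inj₂ refl)) → u≢v refl }
    where
    open Facts 1≤l Q
    near-corner : ∀ {q} → In 2 1 1 l d q × (0 , 0) ~ q × q ≢ (0 , 0) → q ≡ (1 , 0) ⊎ q ≡ (0 , 1) ⊎ q ≡ (1 , 1)
    near-corner (q∈ , near p (close _ r) , ne) with low q∈ r
    ... | inj₁ refl = ⊥-elim (ne refl)
    ... | inj₂ (inj₁ e) = inj₁ e
    ... | inj₂ (inj₂ (inj₁ e)) = inj₂ (inj₁ e)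
    ... | inj₂ (inj₂ (inj₂ (inj₁ e))) = inj₂ (inj₂ e)
    ... | inj₂ (inj₂ (inj₂ (inj₂ refl))) = case p of λ { (close _ (s≤s ())) }

  no-F7 : ∀ {s t} → SameSet s t (0 , 0) (1 , 1) ⊎ SameSet s t (0 , 1) (1 , 0) → ¬ Path (C 2 1 1 l d) s t []
  no-F7 (inj₁ (inj₁ (refl , refl))) = no-F7₁ ∘ rev
  no-F7 (inj₁ (inj₂ (refl , refl))) = no-F7₁
  no-F7 (inj₂ (inj₁ (refl , refl))) = no-F7₂ ∘ rev
  no-F7 (inj₂ (inj₂ (refl , refl))) = no-F7₂

module _ {a k c l d : ℕ} {z : Point} (K : Cut a k c l d (_≡ z)) where

  open Cut K

  never-back : ∀ {s t ps} → Walk s t ps → All (In a k c l d) ps → All (_≢ z) ps → σ t → All σ ps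
  never-back one _ _ σt = σt ∷ []
  never-back (step n w) (i ∷ is) (p ∷ ps) σt with never-back w is ps σt
  ... | σs@(σv ∷ _) with refl ← walk-head w with is | ps
  ...   | i′ ∷ _ | p′ ∷ _ = closed i′ p′ i p (~-sym n) σv ∷ σs

  -- Leaving `σ` is possible only through `z`, which is visited at most once. After `z`, the cells
  -- are traced back from `t` by `never-back`, so they lie in `σ` again.
  never-over : ∀ {s t ps} → Walk s t ps → Unique ps → All (In a k c l d) ps → s ≢ z → σ s → σ t → ∀ {p} → p ∈ ps → σ p ⊎ p ≡ z
  never-over w _ _ _ σs _ (here refl) with refl ← walk-head w = inj₁ σs
  never-over (step {v = v} n w) (_ ∷ u) (i ∷ is) s≢z σs σt (there p∈) with v ≟ᵖ z
  never-over (step n one) _ _ _ _ _ (there (here e)) | yes refl = inj₂ e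
  never-over (step n (step _ w)) _ _ _ _ _ (there (here e)) | yes refl = inj₂ e
  never-over (step n (step _ w)) (_ ∷ v∉ ∷ _) (_ ∷ _ ∷ is) _ _ σt (there (there p∈)) | yes refl =
    inj₁ (All.lookup (never-back w is (All.map (_∘ sym) v∉) σt) p∈)
  never-over (step n w@one) (_ ∷ u) (i ∷ is@(i′ ∷ _)) s≢z σs σt (there p∈) | no v≢z = never-over w u is v≢z (closed i s≢z i′ v≢z n σs) σt p∈
  never-over (step n w@(step _ _)) (_ ∷ u) (i ∷ is@(i′ ∷ _)) s≢z σs σt (there p∈) | no v≢z = never-over w u is v≢z (closed i s≢z i′ v≢z n σs) σt p∈

-- The uppermost cell (0 , `c`) of the one-column passage is a cut cell. A path with both ends above
-- it never gets to the bottom band.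
no-F9 : ∀ {k c l d s t} → 1 ≤ c → 1 ≤ l → 1 ≤ d → s ᵧ < c → t ᵧ < c → ¬ Path (C 1 k c l d) s t []
no-F9 {k} {c} {l} {suc d} 1≤c 1≤l 1≤d s< t< Q = Sum.[ Cut.¬σv K , Cut.v∉ K ]
  (never-over K w unique (All.tabulate region∈) (λ { refl → <-irrefl refl s< }) s< t< (member (Cut.v∈ K)))
  where
  open Facts 1≤l Q
  K : Cut 1 k c l (suc d) (_≡ (0 , c))
  K = cutMid₁ 1≤c 1≤d ≤-refl (m<m+n c 1≤l)

far-apart : ∀ {x y} → x < 3 → y < 3 → ∣ x - y ∣ ≡ 2 → (x ≡ 0 × y ≡ 2) ⊎ (x ≡ 2 × y ≡ 0)
far-apart {0} {2} _ _ _ = inj₁ (refl , refl)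
far-apart {2} {0} _ _ _ = inj₂ (refl , refl)
far-apart {0} {0} _ _ ()
far-apart {0} {1} _ _ ()
far-apart {1} {0} _ _ ()
far-apart {1} {1} _ _ ()
far-apart {1} {2} _ _ ()
far-apart {2} {1} _ _ ()
far-apart {2} {2} _ _ ()
far-apart {suc (suc (suc _))} (s≤s (s≤s (s≤s ())))
far-apart {_} {suc (suc (suc _))} _ (s≤s (s≤s (s≤s ())))

path⇒¬F8 : ∀ {a s t} → In a 1 1 1 1 s → In a 1 1 1 1 t → Path (C a 1 1 1 1) s t [] → ¬ F8 (Params a 1 1 1 1) (↑ s) (↑ t)
path⇒¬F8 {a} s∈ t∈ Q (_ , _ , _ , _ , x) rewrite m+n∸n≡m a 1 with x
path⇒¬F8 s∈ t∈ Q _ | inj₁ (s≤s (s≤s z≤n) , refl , refl , e) with far-apart (In-height s∈) (In-height t∈) e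
... | inj₁ (refl , refl) = no-F8₁ Q
... | inj₂ (refl , refl) = no-F8₁ (rev Q)
path⇒¬F8 s∈ t∈ Q _ | inj₂ (inj₁ (refl , refl , refl , e)) with far-apart (In-height s∈) (In-height t∈) e
... | inj₁ (refl , refl) = no-F8₂ (rev Q)
... | inj₂ (refl , refl) = no-F8₂ (rev (flipC {2} {1} {1} {1} {1} Q))
path⇒¬F8 s∈ t∈ Q _ | inj₂ (inj₂ (s≤s (s≤s (s≤s z≤n)) , s≤s s< , refl)) = no-F8₃ s< (rev Q)

module _ {a k c l d : ℕ} (1≤c : 1 ≤ c) (1≤l : 1 ≤ l) (1≤d : 1 ≤ d) where

  private
    P = Params a k c l d

    a≡ : Defs.CParams.a P ≡ a
    a≡ = m+n∸n≡m a k

    d≡ : Defs.CParams.d P ≡ d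
    d≡ = trans (cong (_∸ c) (trans (cong (_∸ l) (sym (+-assoc d c l))) (m+n∸n≡m (d + c) l))) (m+n∸n≡m d c)

  forbids : ∀ {s t} → In a k c l d s → In a k c l d t → s ≢ t → HamiltonianPath P (↑ s) (↑ t) → ¬ Forbidden P (↑ s) (↑ t)
  forbids {s} {t} s∈ t∈ ne H = λ where
      (inj₁ x)                             → ham⇒¬F1 {P} (ne ∘ ↑-injective) H x
      (inj₂ (inj₁ x))                      → ham⇒¬F3 1≤l Q x
      (inj₂ (inj₂ (inj₁ x)))               → f7 x
      (inj₂ (inj₂ (inj₂ (inj₁ x))))        → f8 x
      (inj₂ (inj₂ (inj₂ (inj₂ (e , x))))) → f9 (trans (sym a≡) e) x
    where
    Q : Path (C a k c l d) s t []
    Q = ham⇒path {a} {k} {c} {l} {d} 1≤l {↑ s} {↑ t} H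
    f7 : ¬ F7 P (↑ s) (↑ t)
    f7 (e , e′ , x) with trans (sym a≡) e′
    ... | refl with suc-injective (suc-injective e) | x
    ...   | refl | inj₁ (refl , y) = no-F7 1≤l 1≤d (Sum.map (SameSet-map ↓) (SameSet-map ↓) y) Q
    ...   | refl | inj₂ (e″ , y) with trans (sym d≡) e″
    ...     | refl = no-F7 1≤l 1≤c (Sum.map (bottom-top 1≤c) (bottom-top′ 1≤c) y) (flipC {2} {1} {c} {l} {1} Q)
      where
      bottom-top : 1 ≤ c → SameSet (↑ s) (↑ t) (1 , suc (c + l)) (2 , c + l) → SameSet (upside (1 + (c + l)) s) (upside (1 + (c + l)) t) (0 , 0) (1 , 1)
      bottom-top (s≤s {n = c′} _) y = subst₂ (λ u v → SameSet (upside (1 + (c + l)) s) (upside (1 + (c + l)) t) (0 , u) (1 , v)) (n∸n≡0 (c′ + l)) (m+n∸n≡m 1 (c′ + l)) (SameSet-map (upside (2 + (c′ + l)) ∘ ↓) y)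
      bottom-top′ : 1 ≤ c → SameSet (↑ s) (↑ t) (1 , c + l) (2 , suc (c + l)) → SameSet (upside (1 + (c + l)) s) (upside (1 + (c + l)) t) (0 , 1) (1 , 0)
      bottom-top′ (s≤s {n = c′} _) y = subst₂ (λ u v → SameSet (upside (1 + (c + l)) s) (upside (1 + (c + l)) t) (0 , u) (1 , v)) (m+n∸n≡m 1 (c′ + l)) (n∸n≡0 (c′ + l)) (SameSet-map (upside (2 + (c′ + l)) ∘ ↓) y)
    f8 : ¬ F8 P (↑ s) (↑ t)
    f8 x@(e , refl , refl , e′ , _) with trans (sym d≡) e′
    ... | refl with suc-injective (suc-injective e)
    ...   | refl = path⇒¬F8 s∈ t∈ Q x
    f9 : a ≡ 1 → ¬ ((suc (s ᵧ) ≤ c × suc (t ᵧ) ≤ c) ⊎ (c + l < suc (s ᵧ) × c + l < suc (t ᵧ)))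
    f9 refl (inj₁ (p , q)) = no-F9 1≤c 1≤l 1≤d p q Q
    f9 refl (inj₂ (p , q)) = no-F9 1≤d 1≤l 1≤c (lift s∈ (s≤s⁻¹ p)) (lift t∈ (s≤s⁻¹ q)) (flipC {1} {k} {c} {l} {d} Q)
      where
      lift : ∀ {p} → In 1 k c l d p → c + l ≤ p ᵧ → (d + (c + l)) ∸ suc (p ᵧ) < d
      lift {_ , y} _ r = ≤-<-trans (∸-monoʳ-≤ (d + (c + l)) (s≤s r)) (shorter 1≤d)
        where
        shorter : 1 ≤ d → d + (c + l) ∸ suc (c + l) < d
        shorter (s≤s {n = d′} _) = s≤s (≤-reflexive (m+n∸n≡m d′ (c + l)))

hamiltonian⇔ : ∀ {a k c l d s t} → 1 ≤ a → 1 ≤ k → 1 ≤ c → 1 ≤ l → 1 ≤ d → In a k c l d s → In a k c l d t → s ≢ t → s ₓ ≤ t ₓ →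
               HamiltonianPath (Params a k c l d) (↑ s) (↑ t) ⇔ (¬ Forbidden (Params a k c l d) (↑ s) (↑ t))
hamiltonian⇔ {a} {k} {c} {l} {d} {s} {t} 1≤a 1≤k 1≤c 1≤l 1≤d s∈ t∈ ne s≤t = mk⇔ (forbids 1≤c 1≤l 1≤d s∈ t∈ ne)
  λ allowed → build allowed (path-or-obstruction 1≤a 1≤k 1≤c 1≤l 1≤d s∈ t∈ ne)
  where
  P = Params a k c l d
  build : ¬ Forbidden P (↑ s) (↑ t) → Result a k c l d s t → HamiltonianPath P (↑ s) (↑ t)
  build _ (inj₁ (inj₁ Q)) = path⇒ham 1≤l Q
  build f (inj₁ (inj₂ o)) = ⊥-elim (f (obstruction⇒forbidden 1≤c 1≤l o))
  build f (inj₂ (inj₁ (refl , refl , refl , W , refl , x))) = ⊥-elim (f (inj₂ (inj₂ (inj₂ (inj₁ (F8₀⇒F8 s≤t x))))))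
  build f (inj₂ (inj₂ (refl , x))) = ⊥-elim (f (inj₂ (inj₂ (inj₂ (inj₂ (F9₀⇒F9 {k} {c} {l} {d} {s} {t} x))))))

theorem5 : (m n k l c : ℕ) → 2 ≤ m → 3 ≤ n → 1 ≤ k → 1 ≤ l → 1 ≤ c →
    k < m → l + c < n →
    (s t : Point) → InC (cparams m n k l c) s → InC (cparams m n k l c) t →
    s ≢ t → s ₓ ≤ t ₓ →
    (HamiltonianPath (cparams m n k l c) s t ⇔ (¬ Forbidden (cparams m n k l c) s t))
theorem5 m n k l c _ _ 1≤k 1≤l 1≤c k<m l+c<n s t s∈ t∈ ne s≤t
  -- Matching replaces m by `a + k` and n by `d + (c + l)`; strictness of the two inequalities
  -- becomes positivity of `a` and `d`.
  with rest (<⇒≤ k<m) | rest (<⇒≤ (subst (_< n) (+-comm l c) l+c<n))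
... | a , refl | d , refl =
  subst₂ (λ s t → HamiltonianPath P s t ⇔ (¬ Forbidden P s t)) (↑-↓ {a} {k} {c} {l} {d} {s} s∈) (↑-↓ {a} {k} {c} {l} {d} {t} t∈)
    (hamiltonian⇔ (+-cancelʳ-< k 0 a k<m) 1≤k 1≤c 1≤l (+-cancelʳ-< (c + l) 0 d (subst (_< d + (c + l)) (+-comm l c) l+c<n))
      (In↓ {a} {k} {c} {l} {d} {s} s∈) (In↓ {a} {k} {c} {l} {d} {t} t∈)
      (λ e → ne (trans (sym (↑-↓ {a} {k} {c} {l} {d} {s} s∈)) (trans (cong ↑ e) (↑-↓ {a} {k} {c} {l} {d} {t} t∈)))) (pred-mono-≤ s≤t))
  where
  P = Params a k c l d
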